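{- There is an algorithm that, given a bicolored interval graph on $n$ vertices, solves the Balanced Connected Subgraph problem (BCS) on it in $O(n^3)$ time.
   Context: All graphs are finite, simple and undirected. A graph is bicolored if every vertex is colored blue or red (adjacent vertices may have the same color); $B$ and $R$ denote the sets of blue and red vertices. The Balanced Connected Subgraph problem (BCS): the input is a bicolored graph $G=(B\cup R,E)$; the output is a connected induced subgraph $H$ of $G$ with $|V(H)\cap B|=|V(H)\cap R|$ having the maximum number of vertices. The empty subgraph (of size $0$) counts as feasible, so an optimum always exists. A graph is an interval graph if one can assign to each vertex an interval of the real line such that two distinct vertices are adjacent if and only if their intervals intersect. Running times are in the standard unit-cost RAM model. -}

module Defs where

open import Level using (0ℓ)
open import Data.Bool.Base using (Bool; true; false; if_then_else_)
open import Data.Nat.Base using (ℕ; zero; suc; _+_; _*_; _∸_; _≤_; _≡ᵇ_)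
open import Data.Fin.Base using (Fin; toℕ)
open import Data.Fin.Subset using (Subset; ∣_∣; _∩_) renaming (_∈_ to _∈ₛ_)
open import Data.List.Base using (List; []; _∷_; _++_; map; concatMap; allFin; head; drop)
open import Data.Maybe.Base using (Maybe; just; nothing)
open import Data.Product.Base using (∃-syntax; Σ-syntax; _×_; _,_)
open import Data.Rational.Base using (ℚ) renaming (_<_ to _<ℚ_)
open import Data.Sum.Base using (_⊎_)
open import Data.Vec.Base using (lookup; tabulate)
open import Function.Bundles using (_⇔_)
open import Relation.Binary.Construct.Closure.ReflexiveTransitive using (Star)
open import Relation.Binary.Core using (Rel)
open import Relation.Binary.Definitions using (Decidable; Irreflexive; Symmetric)
open import Relation.Binary.PropositionalEquality.Core using (_≡_; _≢_)
open import Relation.Nullary.Decidable.Core using (does)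
open import Relation.Nullary.Negation.Core using (¬_)
open import Relation.Unary using (Pred; Satisfiable; _∈_; _≬_)

record Graph (n : ℕ) : Set₁ where
  field
    Adj    : Rel (Fin n) 0ℓ
    adj?   : Decidable Adj
    sym    : Symmetric Adj
    irrefl : Irreflexive _≡_ Adj

data Color : Set where
  blue red : Color

isBlue isRed : Color → Bool
isBlue blue = true
isBlue red  = false
isRed  blue = false
isRed  red  = true

record BicoloredGraph (n : ℕ) : Set₁ where
  field
    graph : Graph n
    color : Fin n → Color

  open Graph graph public

  B R : Subset n
  B = tabulate (λ v → isBlue (color v))
  R = tabulate (λ v → isRed (color v))

-- Real numbers are two-sided Dedekind cuts of ℚ.

record ℝ : Set₁ where
  field
    L U          : Pred ℚ 0ℓ
    L-inhabited  : Satisfiable L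
    U-inhabited  : Satisfiable U
    L-rounded    : ∀ q → q ∈ L ⇔ (∃[ r ] q <ℚ r × r ∈ L)
    U-rounded    : ∀ q → q ∈ U ⇔ (∃[ r ] r <ℚ q × r ∈ U)
    disjoint     : ∀ q → ¬ (q ∈ L × q ∈ U)
    located      : ∀ {q r} → q <ℚ r → q ∈ L ⊎ r ∈ U

infix 4 _≤ᴿ_

_≤ᴿ_ : Rel ℝ 0ℓ
x ≤ᴿ y = ∀ {q} → q ∈ ℝ.L x → q ∈ ℝ.L y

-- Intervals may be open, closed, half-open, bounded or unbounded, but not
-- empty.  Convexity with x ≤ᴿ y ≤ᴿ x makes membership respect equality of cuts.

record Interval : Set₁ where
  field
    points   : Pred ℝ 0ℓ
    nonempty : Satisfiable points
    convex   : ∀ {x y z} → x ∈ points → z ∈ points →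
               x ≤ᴿ y → y ≤ᴿ z → y ∈ points

IsIntervalGraph : ∀ {n} → Graph n → Set₁
IsIntervalGraph {n} G =
  Σ[ I ∈ (Fin n → Interval) ]
    (∀ u v → u ≢ v → Adj u v ⇔ (Interval.points (I u) ≬ Interval.points (I v)))
  where open Graph G

-- An induced subgraph is represented by its vertex set.

InducedAdj : ∀ {n} → Graph n → Subset n → Rel (Fin n) 0ℓ
InducedAdj G S u v = u ∈ₛ S × v ∈ₛ S × Graph.Adj G u v

-- The empty subgraph counts as connected.
InducesConnected : ∀ {n} → Graph n → Subset n → Set
InducesConnected G S = ∀ u v → u ∈ₛ S → v ∈ₛ S → Star (InducedAdj G S) u v

Balanced : ∀ {n} → BicoloredGraph n → Subset n → Set
Balanced G S = ∣ S ∩ B ∣ ≡ ∣ S ∩ R ∣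
  where open BicoloredGraph G

IsFeasible : ∀ {n} → BicoloredGraph n → Subset n → Set
IsFeasible G S = InducesConnected (BicoloredGraph.graph G) S × Balanced G S

IsOptimal : ∀ {n} → BicoloredGraph n → Subset n → Set
IsOptimal G S = IsFeasible G S × (∀ S′ → IsFeasible G S′ → ∣ S′ ∣ ≤ ∣ S ∣)

-- A random access machine over ℕ.  Registers are addressed directly, by the
-- constants in the program; memory cells are addressed indirectly, through the
-- contents of a register.

Store : Set
Store = ℕ → ℕ

infixl 6 _[_≔_]

_[_≔_] : Store → ℕ → ℕ → Store
(s [ a ≔ x ]) b = if a ≡ᵇ b then x else s b

data Instr : Set where
  const : (i k : ℕ) → Instr
  add   : (i j k : ℕ) → Instr
  sub   : (i j k : ℕ) → Instr
  load  : (i j : ℕ) → Instr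
  store : (i j : ℕ) → Instr
  jump  : (l : ℕ) → Instr
  jz    : (i l : ℕ) → Instr

Program : Set
Program = List Instr

record Config : Set where
  constructor ⟨_,_,_⟩
  field
    pc  : ℕ
    reg : Store
    mem : Store

exec : Instr → Config → Config
exec (const i k)  ⟨ p , r , m ⟩ = ⟨ suc p , r [ i ≔ k ] , m ⟩
exec (add i j k)  ⟨ p , r , m ⟩ = ⟨ suc p , r [ i ≔ r j + r k ] , m ⟩
exec (sub i j k)  ⟨ p , r , m ⟩ = ⟨ suc p , r [ i ≔ r j ∸ r k ] , m ⟩
exec (load i j)   ⟨ p , r , m ⟩ = ⟨ suc p , r [ i ≔ m (r j) ] , m ⟩
exec (store i j)  ⟨ p , r , m ⟩ = ⟨ suc p , r , m [ r i ≔ r j ] ⟩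
exec (jump l)     ⟨ p , r , m ⟩ = ⟨ l , r , m ⟩
exec (jz i l)     ⟨ p , r , m ⟩ = ⟨ (if r i ≡ᵇ 0 then l else suc p) , r , m ⟩

fetch : Program → ℕ → Maybe Instr
fetch P p = head (drop p P)

-- Halts P c t c′: started in c, the program P executes exactly t instructions
-- and then halts, by leaving the range of program addresses, in c′.

data Halts (P : Program) : Config → ℕ → Config → Set where
  stop : ∀ {c} → fetch P (Config.pc c) ≡ nothing → Halts P c 0 c
  step : ∀ {c ι t c′} → fetch P (Config.pc c) ≡ just ι →
         Halts P (exec ι c) t c′ → Halts P c (suc t) c′

bit : Bool → ℕ
bit false = 0
bit true  = 1

-- The n color bits (1 for red), then the adjacency matrix row by row.
encode : ∀ {n} → BicoloredGraph n → List ℕ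
encode {n} G =
  map (λ v → bit (isRed (color v))) (allFin n) ++
  concatMap (λ u → map (λ v → bit (does (adj? u v))) (allFin n)) (allFin n)
  where open BicoloredGraph G

fromList : List ℕ → Store
fromList []       _       = 0
fromList (x ∷ xs) zero    = x
fromList (x ∷ xs) (suc a) = fromList xs a

-- Register 0 initially holds the number of vertices, all other registers 0.
initial : ∀ {n} → BicoloredGraph n → Config
initial {n} G = ⟨ 0 , (λ _ → 0) [ 0 ≔ n ] , fromList (encode G) ⟩

-- The first n memory cells hold the characteristic vector of S.
Outputs : ∀ {n} → Config → Subset n → Set
Outputs {n} c S = ∀ (v : Fin n) → Config.mem c (toℕ v) ≡ bit (lookup S v)

SolvesBCSWithin : ∀ {n} → Program → BicoloredGraph n → ℕ → Set
SolvesBCSWithin P G b =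
  ∃[ t ] ∃[ c ] ∃[ S ] Halts P (initial G) t c × t ≤ b × Outputs c S × IsOptimal G S

infix 4 _∈O_

_∈O_ : (ℕ → ℕ) → (ℕ → ℕ) → Set
f ∈O g = ∃[ k ] ∃[ n₀ ] (∀ n → n₀ ≤ n → f n ≤ k * g n)

{-# OPTIONS --safe #-}
module Submission where

-- Write N(w) for the closed neighbourhood of w, and D(u, v) for the set of all w
-- such that every walk from u to v meets N(w).  A u–v path together with any
-- vertices of D(u, v) is connected.  Choosing a point in every interval preorders
-- the vertices so that x ≤ w ≤ y and y ∈ N(x) imply w ∈ N(x) ∪ N(y); hence a
-- connected set H is contained in D(u, v) for its extreme vertices u and v.
--
-- Call the colour that is more frequent in D(u, v) heavy, the other one light,
-- and let ℓ be the number of light vertices of D(u, v).  A balanced subset has at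
-- most 2ℓ vertices, and 2ℓ is attained once a u–v path P ⊆ D(u, v) has at most ℓ
-- heavy vertices: add to P all light vertices and some heavy vertices of D(u, v).
-- When heavy vertices weigh n + 1 and light ones 1, a shortest walk has the fewest
-- heavy vertices possible, and it stays in D(u, v), for otherwise it could be
-- shortcut.  So Floyd–Warshall decides for all pairs at once, and D(u, v) is read
-- off the components of G − N(w), which are found in O(n²) for every w.
--
-- The program is compiled from an array language in which every loop runs n
-- times, so that the nesting depth of its loops bounds the degree of its time.

-- One test per pair is enough because of a converse. Let H be nonempty, balanced and connected,
-- with extreme vertices u and v. As H is contained in D(u, v), it has |H|/2 ≤ ℓ light vertices, and
-- a simple u-v path inside H has at most |H|/2 ≤ ℓ heavy ones. So the pair passes the test, and its
-- 2ℓ is at least |H|. A simple path has at most n light vertices. With weights n + 1 and 1 it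
-- therefore has at most ℓ heavy vertices if and only if it weighs at most (n + 1) ℓ + n. Which
-- colour is heavy depends on the pair, so the search runs once per colour, on the pairs where that
-- colour is at least as frequent as the other. The program never sees an interval: the preorder
-- serves the correctness proof alone. The points are Dedekind cuts, whose order is not decidable,
-- so the preorder is available only under a double negation. This is harmless, as it is used only
-- for negations and for inequalities of natural numbers.

open import Defs
open import Data.Bool.Base using (Bool; true; false; if_then_else_; _∧_; not; T)
open import Data.Empty using (⊥; ⊥-elim)
open import Data.Fin.Base using (Fin; zero; suc; toℕ; fromℕ<)
open import Data.Fin.Properties using (toℕ<n; toℕ-fromℕ<; toℕ-injective; sequence)
import Data.Fin.Properties as Fin
open import Data.Fin.Subset using (Subset; ∣_∣; _∩_) renaming (_∈_ to _∈ₛ_)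
open import Data.List.Base using (List; []; _∷_; _++_; length; replicate; head; drop; map; concatMap; allFin)
  renaming (tabulate to tabulateᴸ)
open import Data.List.Properties using (map-tabulate; length-map; length-tabulate)
open import Data.Maybe.Base using (just; nothing)
open import Data.Nat.Base
open import Data.Nat.Properties
open import Data.Nat.Tactic.RingSolver using (solve-∀)
open import Data.Product.Base using (∃-syntax; Σ-syntax; _×_; _,_; proj₁; proj₂)
import Data.Rational.Base as ℚ
import Data.Rational.Properties as ℚ
open import Data.Sum.Base as Sum using (_⊎_; inj₁; inj₂)
open import Data.Unit.Base using (⊤; tt)
open import Data.Vec.Base using ([]; _∷_; lookup; tabulate)
open import Data.Vec.Properties using (lookup∘tabulate; lookup-zipWith; lookup⇒[]=; []=⇒lookup)
open import Effect.Monad using (RawMonad)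
open import Function.Base using (_∘_; case_of_; id)
open import Function.Bundles using (Equivalence)
open import Relation.Binary.Construct.Closure.ReflexiveTransitive using (Star; ε; _◅_; _◅◅_; gmap; reverse)
open import Relation.Binary.Definitions using (tri<; tri≈; tri>)
open import Relation.Binary.PropositionalEquality hiding (J)
open import Relation.Nullary.Decidable.Core using (Dec; yes; no; does; decidable-stable)
open import Relation.Nullary.Negation using (¬¬-Monad)
open import Relation.Nullary.Negation.Core using (¬_; contradiction)

-- Stores

≡ᵇ-true : ∀ {a b} → a ≡ b → (a ≡ᵇ b) ≡ true
≡ᵇ-true {zero}  refl = refl
≡ᵇ-true {suc a} refl = ≡ᵇ-true {a} refl

≡ᵇ-false : ∀ {a b} → a ≢ b → (a ≡ᵇ b) ≡ false
≡ᵇ-false {a} {b} a≢b with a ≡ᵇ b in eq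
... | false = refl
... | true  = contradiction (≡ᵇ⇒≡ a b (subst T (sym eq) tt)) a≢b

<ᵇ-true : ∀ {a b} → a < b → (a <ᵇ b) ≡ true
<ᵇ-true {a} {b} a<b with a <ᵇ b in eq
... | true  = refl
... | false = ⊥-elim (subst T eq (<⇒<ᵇ a<b))

<ᵇ-false : ∀ {a b} → b ≤ a → (a <ᵇ b) ≡ false
<ᵇ-false {a} {b} b≤a with a <ᵇ b in eq
... | false = refl
... | true  = contradiction (<ᵇ⇒< a b (subst T (sym eq) tt)) (≤⇒≯ b≤a)

≔-hit : ∀ (s : Store) a {x} → (s [ a ≔ x ]) a ≡ x
≔-hit s a rewrite ≡ᵇ-true {a} refl = refl

≔-miss : ∀ (s : Store) {a b x} → a ≢ b → (s [ a ≔ x ]) b ≡ s b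
≔-miss s a≢b rewrite ≡ᵇ-false a≢b = refl

-- Injectivity of every numbering below comes from this: base 4 for registers, base n for columns,
-- base `suc n` for the rows of an array.
digits-unique : ∀ {n} x y {i j} → i < n → j < n →
                x * n + i ≡ y * n + j → x ≡ y × i ≡ j
digits-unique zero    zero    i<n j<n eq = refl , eq
digits-unique {n} zero (suc y) {i} {j} i<n j<n eq =
  contradiction (≤-trans (m≤m+n n (y * n)) (≤-trans (m≤m+n (n + y * n) j) (≤-reflexive (sym eq)))) (<⇒≱ i<n)
digits-unique {n} (suc x) zero {i} {j} i<n j<n eq =
  contradiction (≤-trans (m≤m+n n (x * n)) (≤-trans (m≤m+n (n + x * n) i) (≤-reflexive eq))) (<⇒≱ j<n)
digits-unique {n} (suc x) (suc y) {i} {j} i<n j<n eq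
  with digits-unique x y i<n j<n
         (+-cancelˡ-≡ n _ _ (trans (sym (+-assoc n (x * n) i)) (trans eq (+-assoc n (y * n) j))))
... | refl , i≡j = refl , i≡j

-- Execution

infixr 5 _▸_

-- Unlike `Halts`, such a run may end at any instruction, so runs of consecutive code fragments
-- compose.
data Steps (P : Program) : Config → ℕ → Config → Set where
  done : ∀ {c} → Steps P c 0 c
  _▸_  : ∀ {c ι t c′} → fetch P (Config.pc c) ≡ just ι →
         Steps P (exec ι c) t c′ → Steps P c (suc t) c′

infixr 5 _▸▸_

_▸▸_ : ∀ {P c t c′ t′ c″} → Steps P c t c′ → Steps P c′ t′ c″ → Steps P c (t + t′) c″
done     ▸▸ q = q
(f ▸ p) ▸▸ q = f ▸ (p ▸▸ q)

steps-halt : ∀ {P c t c′} → Steps P c t c′ → fetch P (Config.pc c′) ≡ nothing → Halts P c t c′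
steps-halt done    h = stop h
steps-halt (f ▸ p) h = step f (steps-halt p h)

-- Counting along the list, instead of adding a length, lets the addresses inside a fragment reduce
-- to the `suc p` that `exec` produces.
endOf : ℕ → Program → ℕ
endOf p []       = p
endOf p (_ ∷ is) = endOf (suc p) is

At : Program → ℕ → Program → Set
At P p []       = ⊤
At P p (ι ∷ is) = fetch P p ≡ just ι × At P (suc p) is

endOf-++ : ∀ p is {js} → endOf p (is ++ js) ≡ endOf (endOf p is) js
endOf-++ p []       = refl
endOf-++ p (_ ∷ is) = endOf-++ (suc p) is

at-++ˡ : ∀ {P} p is {js} → At P p (is ++ js) → At P p is
at-++ˡ p []       _       = tt
at-++ˡ p (_ ∷ is) (f , a) = f , at-++ˡ (suc p) is a

at-++ʳ : ∀ {P} p is {js} → At P p (is ++ js) → At P (endOf p is) js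
at-++ʳ p []       a       = a
at-++ʳ p (_ ∷ is) (f , a) = at-++ʳ (suc p) is a

fetch-suc : ∀ (is : Program) p {ι js} → drop p is ≡ ι ∷ js → drop (suc p) is ≡ js
fetch-suc (_ ∷ is) zero    refl = refl
fetch-suc (_ ∷ is) (suc p) eq   = fetch-suc is p eq

at-drop : ∀ P p is → drop p P ≡ is → At P p is
at-drop P p []       eq = tt
at-drop P p (ι ∷ is) eq = cong head eq , at-drop P (suc p) is (fetch-suc P p eq)

fetch-end : ∀ P p is → drop p P ≡ is → fetch P (endOf p is) ≡ nothing
fetch-end P p []       eq = cong head eq
fetch-end P p (ι ∷ is) eq = fetch-end P (suc p) is (fetch-suc P p eq)

-- Register allocation

data Kind : Set where
  aux scl idx off : Kind

code : Kind → ℕ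
code aux = 0
code scl = 1
code idx = 2
code off = 3

code<4 : ∀ k → code k < 4
code<4 aux = s≤s z≤n
code<4 scl = s≤s (s≤s z≤n)
code<4 idx = s≤s (s≤s (s≤s z≤n))
code<4 off = s≤s (s≤s (s≤s (s≤s z≤n)))

code-injective : ∀ k k′ → code k ≡ code k′ → k ≡ k′
code-injective aux aux _ = refl
code-injective scl scl _ = refl
code-injective idx idx _ = refl
code-injective off off _ = refl

-- Residues modulo 4 provide four unbounded families, so neither the scalars nor the loop depth need
-- a bound. As `code aux` is 0, `nᴿ` is register 0, where the input size arrives.
reg : Kind → ℕ → ℕ
reg k i = i * 4 + code k

reg-injective : ∀ {k k′ i i′} → reg k i ≡ reg k′ i′ → k ≡ k′ × i ≡ i′
reg-injective {k} {k′} {i} {i′} eq with digits-unique i i′ (code<4 k) (code<4 k′) eq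
... | i≡i′ , c = code-injective k k′ c , i≡i′

nᴿ oneᴿ areaᴿ zeroᴿ : ℕ
nᴿ    = reg aux 0
oneᴿ  = reg aux 1
areaᴿ = reg aux 2
zeroᴿ = reg aux 3

-- An array language.  Its scalars are total, and its arrays have a header
-- row 0 and rows 1, …, n, each of length n; entries outside the columns are 0 and
-- stay so.  Loop variables are numbered by nesting depth.

data Ix (d : ℕ) : Set where
  # : (l : ℕ) {l<d : T (l <ᵇ d)} → Ix d

data Row (d : ℕ) : Set where
  hdr : Row d
  row : Ix d → Row d

infixl 6 _⊕_ _⊖_

data Exp (d : ℕ) : Set where
  lit       : ℕ → Exp d
  size area : Exp d
  var       : ℕ → Exp d
  ix        : Ix d → Exp d
  _⊕_ _⊖_   : Exp d → Exp d → Exp d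
  read      : (a : ℕ) → Row d → Exp d → Exp d

infixr 4 _⨾_

data Cmd (d : ℕ) : Set where
  skip  : Cmd d
  set   : ℕ → Exp d → Cmd d
  write : (a : ℕ) → Row d → Exp d → Exp d → Cmd d
  _⨾_   : Cmd d → Cmd d → Cmd d
  ifz   : Exp d → Cmd d → Cmd d → Cmd d
  for   : Cmd (suc d) → Cmd d

record St : Set where
  constructor st
  field
    sc : ℕ → ℕ
    ar : ℕ → ℕ → ℕ → ℕ

open St public

-- The array number is tested outermost: a write to one array leaves every other array unchanged as
-- a function, so frame conditions need no extensionality.
put : (n a ρ j v : ℕ) → (ℕ → ℕ → ℕ → ℕ) → ℕ → ℕ → ℕ → ℕ
put n a ρ j v ar b =
  if a ≡ᵇ b
  then (λ ρ′ → if ρ ≡ᵇ ρ′ then (λ j′ → if (j ≡ᵇ j′) ∧ (j′ <ᵇ n) then v else ar b ρ′ j′) else ar b ρ′)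
  else ar b

onZero : {A : Set} → ℕ → A → A → A
onZero zero    x y = x
onZero (suc _) x y = y

-- Rounds run in the order 0, 1, 2, ...; peeling off the last one makes `iter k f s` the state after
-- k rounds, which is the shape of a loop invariant.
iter : {A : Set} → ℕ → (ℕ → A → A) → A → A
iter zero    f s = s
iter (suc k) f s = f k (iter k f s)

rowNo : ∀ {d} → Row d → Store → ℕ
rowNo hdr         ρ = 0
rowNo (row (# l)) ρ = suc (ρ l)

module _ (n : ℕ) where

  evalᴱ : ∀ {d} → Exp d → Store → St → ℕ
  evalᴱ (lit k)      ρ s = k
  evalᴱ size         ρ s = n
  evalᴱ area         ρ s = suc n * n
  evalᴱ (var x)      ρ s = sc s x
  evalᴱ (ix (# l))   ρ s = ρ l
  evalᴱ (e ⊕ f)      ρ s = evalᴱ e ρ s + evalᴱ f ρ s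
  evalᴱ (e ⊖ f)      ρ s = evalᴱ e ρ s ∸ evalᴱ f ρ s
  evalᴱ (read a r e) ρ s = ar s a (rowNo r ρ) (evalᴱ e ρ s)

  run : ∀ {d} → Cmd d → Store → St → St
  run skip            ρ s = s
  run (set x e)       ρ s = st (sc s [ x ≔ evalᴱ e ρ s ]) (ar s)
  run (write a r j e) ρ s = st (sc s) (put n a (rowNo r ρ) (evalᴱ j ρ s) (evalᴱ e ρ s) (ar s))
  run (c ⨾ c′)        ρ s = run c′ ρ (run c ρ s)
  run (ifz e c c′)    ρ s = onZero (evalᴱ e ρ s) (run c ρ s) (run c′ ρ s)
  run {d} (for c)     ρ s = iter n (λ k → run c (ρ [ d ≔ k ])) s

  put-hit : ∀ a ρ j {v} ar → j < n → put n a ρ j v ar a ρ j ≡ v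
  put-hit a ρ j ar j<n rewrite ≡ᵇ-true {a} refl | ≡ᵇ-true {ρ} refl | ≡ᵇ-true {j} refl | <ᵇ-true j<n = refl

  put-out : ∀ a ρ j {v} ar {b ρ′ j′} → n ≤ j′ → put n a ρ j v ar b ρ′ j′ ≡ ar b ρ′ j′
  put-out a ρ j ar {b} {ρ′} {j′} n≤j′ with a ≡ᵇ b
  ... | false = refl
  ... | true with ρ ≡ᵇ ρ′
  ... | false = refl
  ... | true with j ≡ᵇ j′
  ... | false = refl
  ... | true rewrite <ᵇ-false n≤j′ = refl

  put-miss : ∀ a ρ j {v} ar {b ρ′ j′} → (a ≡ b → ρ ≡ ρ′ → j ≢ j′) →
             put n a ρ j v ar b ρ′ j′ ≡ ar b ρ′ j′
  put-miss a ρ j ar {b} {ρ′} {j′} ne with a ≟ b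
  ... | no a≢b rewrite ≡ᵇ-false a≢b = refl
  ... | yes refl rewrite ≡ᵇ-true {a} refl with ρ ≟ ρ′
  ... | no ρ≢ρ′ rewrite ≡ᵇ-false ρ≢ρ′ = refl
  ... | yes refl rewrite ≡ᵇ-true {ρ} refl | ≡ᵇ-false (ne refl refl) = refl

-- Compilation

-- Without multiplication a row offset cannot be computed on demand, so each loop keeps the start of
-- its current row in `off` and advances it by n per round.
rowᴿ : ∀ {d} → Row d → ℕ
rowᴿ hdr         = zeroᴿ
rowᴿ (row (# l)) = reg off l

tmp : ℕ → ℕ
tmp t = reg aux t

-- With a column number in register t, address a r t computes the address of
-- the cell in the same register.
address : ∀ {d} → ℕ → Row d → ℕ → Program
address a r t = add (tmp t) (tmp t) (rowᴿ r) ∷ replicate a (add (tmp t) (tmp t) areaᴿ)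

compileᴱ : ∀ {d} → Exp d → ℕ → ℕ → Program
compileᴱ (lit k)      t p = const (tmp t) k ∷ []
compileᴱ size         t p = add (tmp t) nᴿ zeroᴿ ∷ []
compileᴱ area         t p = add (tmp t) areaᴿ zeroᴿ ∷ []
compileᴱ (var x)      t p = add (tmp t) (reg scl x) zeroᴿ ∷ []
compileᴱ (ix (# l))   t p = add (tmp t) (reg idx l) zeroᴿ ∷ []
compileᴱ (e ⊕ f)      t p =
  let ce = compileᴱ e t p ; q = endOf p ce ; cf = compileᴱ f (suc t) q in
  ce ++ cf ++ add (tmp t) (tmp t) (tmp (suc t)) ∷ []
compileᴱ (e ⊖ f)      t p =
  let ce = compileᴱ e t p ; q = endOf p ce ; cf = compileᴱ f (suc t) q in
  ce ++ cf ++ sub (tmp t) (tmp t) (tmp (suc t)) ∷ []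
compileᴱ (read a r e) t p =
  let ce = compileᴱ e t p ; q = endOf p ce ; ca = address a r t ; q′ = endOf (2 + q) ca in
  -- The truncated difference n ∸ column vanishes exactly when the column is out of range; the jump
  -- then skips the memory access and delivers the default 0.
  ce ++ sub (tmp (suc t)) nᴿ (tmp t) ∷ jz (tmp (suc t)) (2 + q′) ∷ ca ++
  load (tmp t) (tmp t) ∷ jump (3 + q′) ∷ const (tmp t) 0 ∷ []

compile : ∀ {d} → Cmd d → ℕ → Program
compile skip            p = []
compile (set x e)       p = compileᴱ e 4 p ++ add (reg scl x) (tmp 4) zeroᴿ ∷ []
compile (write a r j e) p =
  let ce = compileᴱ e 4 p ; q = endOf p ce ; cj = compileᴱ j 5 q ; q′ = endOf q cj
      ca = address a r 5 ; q″ = endOf (2 + q′) ca in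
  ce ++ cj ++ sub (tmp 6) nᴿ (tmp 5) ∷ jz (tmp 6) (suc q″) ∷ ca ++ store (tmp 5) (tmp 4) ∷ []
compile (c ⨾ c′)        p =
  let is = compile c p in is ++ compile c′ (endOf p is)
compile (ifz e c c′)    p =
  let ce = compileᴱ e 4 p ; q = endOf p ce
      is′ = compile c′ (suc q) ; q′ = endOf (suc q) is′
      is = compile c (suc q′) ; q″ = endOf (suc q′) is in
  ce ++ jz (tmp 4) (suc q′) ∷ is′ ++ jump q″ ∷ is
compile {d} (for c)     p =
  let is = compile c (4 + p) ; q = endOf (4 + p) is in
  -- The offset starts at n and not at 0: round k works on row k + 1, behind the header row.
  const (reg idx d) 0 ∷ add (reg off d) nᴿ zeroᴿ ∷
  sub (tmp 4) nᴿ (reg idx d) ∷ jz (tmp 4) (3 + q) ∷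
  is ++ add (reg idx d) (reg idx d) oneᴿ ∷ add (reg off d) (reg off d) nᴿ ∷ jump (2 + p) ∷ []

-- Running time against loop depth.

timeᴱ : ∀ {d} → Exp d → ℕ
timeᴱ (e ⊕ f)      = timeᴱ e + timeᴱ f + 1
timeᴱ (e ⊖ f)      = timeᴱ e + timeᴱ f + 1
timeᴱ (read a r e) = timeᴱ e + (a + 5)
timeᴱ _            = 1

-- An upper bound, as a conditional pays for both branches. For a loop, 5 is the test, the two
-- counter updates and the jump back; 4 is the initialisation and the final test.
time : ∀ {d} → Cmd d → ℕ → ℕ
time skip            n = 0
time (set x e)       n = timeᴱ e + 1
time (write a r j e) n = timeᴱ e + (timeᴱ j + (a + 4))
time (c ⨾ c′)        n = time c n + time c′ n
time (ifz e c c′)    n = timeᴱ e + (2 + (time c n + time c′ n))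
time (for c)         n = 4 + n * (time c n + 5)

depth : ∀ {d} → Cmd d → ℕ
depth (c ⨾ c′)     = depth c ⊔ depth c′
depth (ifz e c c′) = depth c ⊔ depth c′
depth (for c)      = suc (depth c)
depth _            = 0

factor : ∀ {d} → Cmd d → ℕ
factor (c ⨾ c′)        = factor c + factor c′
factor (ifz e c c′)    = timeᴱ e + 2 + (factor c + factor c′)
factor (for c)         = factor c + 5
factor c               = time c 0

join-bound : ∀ {a b} f g i j n → a ≤ f * suc n ^ i → b ≤ g * suc n ^ j →
             a + b ≤ (f + g) * suc n ^ (i ⊔ j)
join-bound {a} {b} f g i j n a≤ b≤ = begin
  a + b
    ≤⟨ +-mono-≤ a≤ b≤ ⟩
  f * suc n ^ i + g * suc n ^ j
    ≤⟨ +-mono-≤ (*-monoʳ-≤ f (^-monoʳ-≤ (suc n) (m≤m⊔n i j)))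
                (*-monoʳ-≤ g (^-monoʳ-≤ (suc n) (m≤n⊔m i j))) ⟩
  f * N + g * N ≡⟨ *-distribʳ-+ N f g ⟨
  (f + g) * N ∎
  where open ≤-Reasoning
        N = suc n ^ (i ⊔ j)

-- Powers of `suc n` are positive even for n = 0, so they absorb the loop overhead and grow with the
-- exponent without a side condition.
time≤ : ∀ {d} (c : Cmd d) n → time c n ≤ factor c * suc n ^ depth c
time≤ skip            n = z≤n
time≤ (set x e)       n = ≤-reflexive (sym (*-identityʳ _))
time≤ (write a r j e) n = ≤-reflexive (sym (*-identityʳ _))
time≤ (c ⨾ c′)        n =
  join-bound (factor c) (factor c′) (depth c) (depth c′) n (time≤ c n) (time≤ c′ n)
time≤ (ifz e c c′)    n = begin
  timeᴱ e + (2 + (time c n + time c′ n))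
    ≡⟨ +-assoc (timeᴱ e) 2 _ ⟨
  K + (time c n + time c′ n)
    ≤⟨ +-mono-≤ (≤-reflexive (sym (*-identityʳ K)))
         (join-bound (factor c) (factor c′) (depth c) (depth c′) n (time≤ c n) (time≤ c′ n)) ⟩
  K * suc n ^ 0 + (factor c + factor c′) * suc n ^ (depth c ⊔ depth c′)
    ≤⟨ join-bound K _ 0 (depth c ⊔ depth c′) n ≤-refl ≤-refl ⟩
  (K + (factor c + factor c′)) * suc n ^ (depth c ⊔ depth c′) ∎
  where open ≤-Reasoning
        K = timeᴱ e + 2
time≤ (for c)         n = begin
  4 + n * (time c n + 5)
    ≤⟨ +-mono-≤ (m≤n+m 4 (factor c + 1)) (*-monoʳ-≤ n (+-monoˡ-≤ 5 (time≤ c n))) ⟩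
  factor c + 1 + 4 + n * (factor c * N + 5)
    ≡⟨ cong (_+ n * (factor c * N + 5)) (+-assoc (factor c) 1 4) ⟩
  K + n * (factor c * N + 5)
    ≤⟨ +-mono-≤ (≤-trans (≤-reflexive (sym (*-identityʳ K))) (*-monoʳ-≤ K (m^n>0 (suc n) (depth c))))
        (*-monoʳ-≤ n (+-monoʳ-≤ (factor c * N) (*-monoʳ-≤ 5 (m^n>0 (suc n) (depth c))))) ⟩
  K * N + n * (factor c * N + 5 * N)
    ≡⟨ rearrange (factor c) n N ⟩
  K * (suc n * N) ∎
  where open ≤-Reasoning
        N = suc n ^ depth c
        K = factor c + 5
        rearrange : ∀ f n N → (f + 5) * N + n * (f * N + 5 * N) ≡ (f + 5) * (suc n * N)
        rearrange = solve-∀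

-- Simulation of array commands by machine code.

jz-zero : ∀ {P p r m i l t c′} → fetch P p ≡ just (jz i l) → r i ≡ 0 →
          Steps P ⟨ l , r , m ⟩ t c′ → Steps P ⟨ p , r , m ⟩ (suc t) c′
jz-zero {P} {p} {r} {m} {i} {l} {t} {c′} f eq s =
  f ▸ subst (λ b → Steps P ⟨ (if b then l else suc p) , r , m ⟩ t c′) (sym (≡ᵇ-true eq)) s

jz-suc : ∀ {P p r m i l t c′} → fetch P p ≡ just (jz i l) → r i ≢ 0 →
         Steps P ⟨ suc p , r , m ⟩ t c′ → Steps P ⟨ p , r , m ⟩ (suc t) c′
jz-suc {P} {p} {r} {m} {i} {l} {t} {c′} f ne s =
  f ▸ subst (λ b → Steps P ⟨ (if b then l else suc p) , r , m ⟩ t c′) (sym (≡ᵇ-false ne)) s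

-- r′ differs from r at most in the temporaries t, t + 1, …
record Agree (t : ℕ) (r r′ : Store) : Set where
  constructor agrees
  field kept : ∀ k i → (k ≡ aux → i < t) → r′ (reg k i) ≡ r (reg k i)

open Agree

agree-refl : ∀ {t r} → Agree t r r
agree-refl = agrees λ k i _ → refl

agree-trans : ∀ {t r r′ r″} → Agree t r r′ → Agree t r′ r″ → Agree t r r″
agree-trans p q = agrees λ k i b → trans (kept q k i b) (kept p k i b)

agree-weaken : ∀ {t t′ r r′} → t′ ≤ t → Agree t r r′ → Agree t′ r r′
agree-weaken le p = agrees λ k i b → kept p k i (λ eq → ≤-trans (b eq) le)

agree-≔ : ∀ {t r} u {v} → t ≤ u → Agree t r (r [ tmp u ≔ v ])
agree-≔ {t} {r} u t≤u = agrees λ k i b → ≔-miss r λ eq → case reg-injective {aux} {k} {u} {i} eq of λ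
  { (refl , refl) → <⇒≱ (b refl) t≤u }

retarget : ∀ {P c t p q r m} → p ≡ q → Steps P c t ⟨ p , r , m ⟩ → Steps P c t ⟨ q , r , m ⟩
retarget refl s = s

reg-≔-miss : ∀ {r : Store} {k k′ i i′ v} → (k ≡ k′ → i ≢ i′) → (r [ reg k i ≔ v ]) (reg k′ i′) ≡ r (reg k′ i′)
reg-≔-miss {r} {k} {k′} {i} {i′} ne = ≔-miss r λ eq → case reg-injective {k} {k′} {i} {i′} eq of λ
  { (k≡k′ , i≡i′) → ne k≡k′ i≡i′ }

module _ (n : ℕ) where

  -- Only loop variables below depth d are constrained, so inner loops may overwrite the deeper
  -- ones. `bound` keeps the row numbers within the range where addresses are injective.
  record Regs (d : ℕ) (ρ σ r : Store) : Set where
    field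
      n-ok    : r nᴿ ≡ n
      one-ok  : r oneᴿ ≡ 1
      area-ok : r areaᴿ ≡ suc n * n
      zero-ok : r zeroᴿ ≡ 0
      scl-ok  : ∀ x → r (reg scl x) ≡ σ x
      idx-ok  : ∀ {l} → l < d → r (reg idx l) ≡ ρ l
      off-ok  : ∀ {l} → l < d → r (reg off l) ≡ suc (ρ l) * n
      bound   : ∀ {l} → l < d → ρ l < n

  open Regs

  addr : ℕ → ℕ → ℕ → ℕ
  addr a ρ j = (a * suc n + ρ) * n + j

  -- The bounds in `cell` are those under which `addr` is injective; `out` justifies the default 0
  -- of an out-of-range read.
  record Cells (ar : ℕ → ℕ → ℕ → ℕ) (m : Store) : Set where
    field
      cell : ∀ a ρ j → ρ ≤ n → j < n → m (addr a ρ j) ≡ ar a ρ j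
      out  : ∀ a ρ j → n ≤ j → ar a ρ j ≡ 0

  open Cells

  addr-injective : ∀ {a ρ j a′ ρ′ j′} → ρ ≤ n → j < n → ρ′ ≤ n → j′ < n →
                   addr a ρ j ≡ addr a′ ρ′ j′ → a ≡ a′ × ρ ≡ ρ′ × j ≡ j′
  addr-injective {a} {ρ} {j} {a′} {ρ′} ρ≤n j<n ρ′≤n j′<n eq
    with digits-unique (a * suc n + ρ) (a′ * suc n + ρ′) j<n j′<n eq
  ... | eq′ , j≡j′ with digits-unique a a′ (s≤s ρ≤n) (s≤s ρ′≤n) eq′
  ... | a≡a′ , ρ≡ρ′ = a≡a′ , ρ≡ρ′ , j≡j′

  cells-put : ∀ {ar m a ρ j v} → ρ ≤ n → j < n → Cells ar m →
              Cells (put n a ρ j v ar) (m [ addr a ρ j ≔ v ])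
  cells-put {ar} {m} {a} {ρ} {j} {v} ρ≤n j<n c = record
    { cell = λ b ρ′ j′ ρ′≤n j′<n → lemma b ρ′ j′ ρ′≤n j′<n
    ; out  = λ b ρ′ j′ n≤j′ → trans (put-out n a ρ j ar n≤j′) (out c b ρ′ j′ n≤j′) }
    where
    lemma : ∀ b ρ′ j′ → ρ′ ≤ n → j′ < n → (m [ addr a ρ j ≔ v ]) (addr b ρ′ j′) ≡ put n a ρ j v ar b ρ′ j′
    lemma b ρ′ j′ ρ′≤n j′<n with addr a ρ j ≟ addr b ρ′ j′
    ... | yes eq with addr-injective {a} {ρ} {j} {b} {ρ′} {j′} ρ≤n j<n ρ′≤n j′<n eq
    ... | refl , refl , refl = trans (≔-hit m (addr a ρ j)) (sym (put-hit n a ρ j ar j<n))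
    lemma b ρ′ j′ ρ′≤n j′<n | no ne =
      trans (≔-miss m ne) (trans (cell c b ρ′ j′ ρ′≤n j′<n)
        (sym (put-miss n a ρ j ar λ { refl refl refl → ne refl })))

  cells-put-out : ∀ {ar m a ρ j v} → n ≤ j → Cells ar m → Cells (put n a ρ j v ar) m
  cells-put-out {ar} {m} {a} {ρ} {j} n≤j c = record
    { cell = λ b ρ′ j′ ρ′≤n j′<n → trans (cell c b ρ′ j′ ρ′≤n j′<n)
        (sym (put-miss n a ρ j ar λ { _ _ refl → <⇒≱ j′<n n≤j }))
    ; out  = λ b ρ′ j′ n≤j′ → trans (put-out n a ρ j ar n≤j′) (out c b ρ′ j′ n≤j′) }

  regs-agree : ∀ {d ρ σ r r′ t} → 4 ≤ t → Agree t r r′ → Regs d ρ σ r → Regs d ρ σ r′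
  regs-agree {t = t} 4≤t ag R = record
    { n-ok    = trans (kept ag aux 0 λ _ → ≤-trans (s≤s z≤n) 4≤t) (n-ok R)
    ; one-ok  = trans (kept ag aux 1 λ _ → ≤-trans (s≤s (s≤s z≤n)) 4≤t) (one-ok R)
    ; area-ok = trans (kept ag aux 2 λ _ → ≤-trans (s≤s (s≤s (s≤s z≤n))) 4≤t) (area-ok R)
    ; zero-ok = trans (kept ag aux 3 λ _ → 4≤t) (zero-ok R)
    ; scl-ok  = λ x → trans (kept ag scl x λ ()) (scl-ok R x)
    ; idx-ok  = λ {l} l<d → trans (kept ag idx l λ ()) (idx-ok R l<d)
    ; off-ok  = λ {l} l<d → trans (kept ag off l λ ()) (off-ok R l<d)
    ; bound   = bound R }

  regs-set : ∀ {d ρ σ r} x {v} → Regs d ρ σ r → Regs d ρ (σ [ x ≔ v ]) (r [ reg scl x ≔ v ])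
  regs-set {d} {ρ} {σ} {r} x {v} R = record
    { n-ok    = trans (reg-≔-miss {r} {scl} {aux} {x} {0} λ ()) (n-ok R)
    ; one-ok  = trans (reg-≔-miss {r} {scl} {aux} {x} {1} λ ()) (one-ok R)
    ; area-ok = trans (reg-≔-miss {r} {scl} {aux} {x} {2} λ ()) (area-ok R)
    ; zero-ok = trans (reg-≔-miss {r} {scl} {aux} {x} {3} λ ()) (zero-ok R)
    ; scl-ok  = lemma
    ; idx-ok  = λ {l} l<d → trans (reg-≔-miss {r} {scl} {idx} {x} {l} λ ()) (idx-ok R l<d)
    ; off-ok  = λ {l} l<d → trans (reg-≔-miss {r} {scl} {off} {x} {l} λ ()) (off-ok R l<d)
    ; bound   = bound R }
    where
    lemma : ∀ y → (r [ reg scl x ≔ v ]) (reg scl y) ≡ (σ [ x ≔ v ]) y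
    lemma y with x ≟ y
    ... | yes refl = trans (≔-hit r (reg scl x)) (sym (≔-hit σ x))
    ... | no x≢y   = trans (reg-≔-miss {r} {scl} {scl} {x} {y} (λ _ → x≢y))
                       (trans (scl-ok R y) (sym (≔-miss σ x≢y)))

  -- The counters of depth d are not among the constrained ones, so a loop can initialise and
  -- increment them outside its body.
  regs-counter : ∀ {d ρ σ r} κ v → κ ≡ idx ⊎ κ ≡ off → Regs d ρ σ r → Regs d ρ σ (r [ reg κ d ≔ v ])
  regs-counter {d} {ρ} {σ} {r} κ v κ-counter R = record
    { n-ok    = trans (keep aux 0 (inj₁ (inj₁ refl))) (n-ok R)
    ; one-ok  = trans (keep aux 1 (inj₁ (inj₁ refl))) (one-ok R)
    ; area-ok = trans (keep aux 2 (inj₁ (inj₁ refl))) (area-ok R)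
    ; zero-ok = trans (keep aux 3 (inj₁ (inj₁ refl))) (zero-ok R)
    ; scl-ok  = λ x → trans (keep scl x (inj₁ (inj₂ refl))) (scl-ok R x)
    ; idx-ok  = λ {l} l<d → trans (keep idx l (inj₂ l<d)) (idx-ok R l<d)
    ; off-ok  = λ {l} l<d → trans (keep off l (inj₂ l<d)) (off-ok R l<d)
    ; bound   = bound R }
    where
    differ : ∀ {κ′} → κ ≡ idx ⊎ κ ≡ off → κ′ ≡ aux ⊎ κ′ ≡ scl → κ ≢ κ′
    differ (inj₁ refl) (inj₁ refl) ()
    differ (inj₁ refl) (inj₂ refl) ()
    differ (inj₂ refl) (inj₁ refl) ()
    differ (inj₂ refl) (inj₂ refl) ()
    keep : ∀ κ′ i → (κ′ ≡ aux ⊎ κ′ ≡ scl) ⊎ i < d → (r [ reg κ d ≔ v ]) (reg κ′ i) ≡ r (reg κ′ i)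
    keep κ′ i (inj₁ q)   = reg-≔-miss {r} {κ} {κ′} {d} {i} λ eq → contradiction eq (differ κ-counter q)
    keep κ′ i (inj₂ i<d) = reg-≔-miss {r} {κ} {κ′} {d} {i} λ { _ refl → <-irrefl refl i<d }

  regs-enter : ∀ {d ρ σ r k} → k < n → r (reg idx d) ≡ k → r (reg off d) ≡ suc k * n →
               Regs d ρ σ r → Regs (suc d) (ρ [ d ≔ k ]) σ r
  regs-enter {d} {ρ} {σ} {r} {k} k<n i≡k o≡k R = record
    { n-ok = n-ok R ; one-ok = one-ok R ; area-ok = area-ok R ; zero-ok = zero-ok R ; scl-ok = scl-ok R
    ; idx-ok = λ l<1+d → proj₁ (lemma l<1+d)
    ; off-ok = λ l<1+d → proj₁ (proj₂ (lemma l<1+d))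
    ; bound  = λ l<1+d → proj₂ (proj₂ (lemma l<1+d)) }
    where
    lemma : ∀ {l} → l < suc d → r (reg idx l) ≡ (ρ [ d ≔ k ]) l × r (reg off l) ≡ suc ((ρ [ d ≔ k ]) l) * n × (ρ [ d ≔ k ]) l < n
    lemma {l} l<1+d with d ≟ l
    ... | yes refl rewrite ≡ᵇ-true {d} refl = i≡k , o≡k , k<n
    ... | no d≢l rewrite ≡ᵇ-false d≢l = idx-ok R l<d , off-ok R l<d , bound R l<d
      where l<d = ≤∧≢⇒< (s≤s⁻¹ l<1+d) (d≢l ∘ sym)

  regs-leave : ∀ {d ρ σ r k} → Regs (suc d) (ρ [ d ≔ k ]) σ r → Regs d ρ σ r
  regs-leave {d} {ρ} {σ} {r} {k} R = record
    { n-ok = n-ok R ; one-ok = one-ok R ; area-ok = area-ok R ; zero-ok = zero-ok R ; scl-ok = scl-ok R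
    ; idx-ok = λ l<d → trans (idx-ok R (m≤n⇒m≤1+n l<d)) (same l<d)
    ; off-ok = λ l<d → trans (off-ok R (m≤n⇒m≤1+n l<d)) (cong (λ x → suc x * n) (same l<d))
    ; bound  = λ l<d → subst (_< n) (same l<d) (bound R (m≤n⇒m≤1+n l<d)) }
    where
    same : ∀ {l} → l < d → (ρ [ d ≔ k ]) l ≡ ρ l
    same {l} l<d = ≔-miss ρ {d} {l} λ { refl → <-irrefl refl l<d }

  rowᴿ-value : ∀ {d ρ σ r} (q : Row d) → Regs d ρ σ r → r (rowᴿ q) ≡ rowNo q ρ * n
  rowᴿ-value hdr                 R = zero-ok R
  rowᴿ-value (row (# l {l<d})) R = off-ok R (<ᵇ⇒< l _ l<d)

  rowNo≤ : ∀ {d ρ σ r} (q : Row d) → Regs d ρ σ r → rowNo q ρ ≤ n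
  rowNo≤ hdr                 R = z≤n
  rowNo≤ (row (# l {l<d})) R = bound R (<ᵇ⇒< l _ l<d)

  module _ (P : Program) where

    record Result (p : ℕ) (r m : Store) (t bnd : ℕ) (x : ℕ) (q : ℕ) : Set where
      field
        r′    : Store
        τ     : ℕ
        steps : Steps P ⟨ p , r , m ⟩ τ ⟨ q , r′ , m ⟩
        τ≤    : τ ≤ bnd
        value : r′ (tmp t) ≡ x
        agree : Agree t r r′

    open Result

    add-areas : ∀ a {p r m} t → 4 ≤ t → At P p (replicate a (add (tmp t) (tmp t) areaᴿ)) →
                Result p r m t a (r (tmp t) + a * r areaᴿ) (endOf p (replicate a (add (tmp t) (tmp t) areaᴿ)))
    add-areas zero    {r = r} t 4≤t at = record
      { steps = done ; τ≤ = z≤n ; value = sym (+-identityʳ _) ; agree = agree-refl }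
    add-areas (suc a) {p} {r} {m} t 4≤t (f , at) = record
      { steps = f ▸ steps ih
      ; τ≤    = s≤s (τ≤ ih)
      ; value = trans (value ih) (begin
          r₁ (tmp t) + a * r₁ areaᴿ
            ≡⟨ cong₂ (λ x y → x + a * y) (≔-hit r (tmp t)) (kept agree₁ aux 2 (λ _ → ≤-trans (s≤s (s≤s (s≤s z≤n))) 4≤t)) ⟩
          r (tmp t) + r areaᴿ + a * r areaᴿ
            ≡⟨ +-assoc (r (tmp t)) (r areaᴿ) _ ⟩
          r (tmp t) + suc a * r areaᴿ ∎)
      ; agree = agree-trans agree₁ (agree ih) }
      where
      open ≡-Reasoning
      r₁ = r [ tmp t ≔ r (tmp t) + r areaᴿ ]
      agree₁ : Agree t r r₁
      agree₁ = agree-≔ {t} {r} t ≤-refl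
      ih = add-areas a {suc p} {r₁} {m} t 4≤t at

    address-correct : ∀ {d ρ σ} a (q : Row d) t {p r m} → 4 ≤ t → Regs d ρ σ r →
                      At P p (address a q t) →
                      Result p r m t (suc a) (addr a (rowNo q ρ) (r (tmp t))) (endOf p (address a q t))
    address-correct {d} {ρ} a q t {p} {r} {m} 4≤t R (f , at) = record
      { steps = f ▸ steps rest
      ; τ≤    = s≤s (τ≤ rest)
      ; value = trans (value rest) (begin
          r₁ (tmp t) + a * r₁ areaᴿ
            ≡⟨ cong₂ (λ x y → x + a * y) (≔-hit r (tmp t))
                 (trans (kept agree₁ aux 2 (λ _ → ≤-trans (s≤s (s≤s (s≤s z≤n))) 4≤t)) (area-ok R)) ⟩
          r (tmp t) + r (rowᴿ q) + a * (suc n * n)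
            ≡⟨ cong (λ x → r (tmp t) + x + a * (suc n * n)) (rowᴿ-value q R) ⟩
          r (tmp t) + rowNo q ρ * n + a * (suc n * n)
            ≡⟨ rearrange (r (tmp t)) (rowNo q ρ) n a ⟩
          addr a (rowNo q ρ) (r (tmp t)) ∎)
      ; agree = agree-trans agree₁ (agree rest) }
      where
      open ≡-Reasoning
      r₁ = r [ tmp t ≔ r (tmp t) + r (rowᴿ q) ]
      agree₁ : Agree t r r₁
      agree₁ = agree-≔ {t} {r} t ≤-refl
      rest = add-areas a {suc p} {r₁} {m} t 4≤t at
      rearrange : ∀ j ρ n a → j + ρ * n + a * (suc n * n) ≡ (a * suc n + ρ) * n + j
      rearrange = solve-∀

    move-correct : ∀ {d ρ σ p r m t i x} → Regs d ρ σ r → r i ≡ x →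
                   At P p (add (tmp t) i zeroᴿ ∷ []) → Result p r m t 1 x (suc p)
    move-correct {r = r} {t = t} {i} R eq (f , _) = record
      { steps = f ▸ done
      ; τ≤    = ≤-refl
      ; value = trans (≔-hit r (tmp t)) (trans (cong (r i +_) (zero-ok R)) (trans (+-identityʳ _) eq))
      ; agree = agree-≔ {t} {r} t ≤-refl }

    compileᴱ-correct : ∀ {d ρ s m} (e : Exp d) {t p r} → 4 ≤ t → Regs d ρ (sc s) r → Cells (ar s) m →
                       At P p (compileᴱ e t p) →
                       Result p r m t (timeᴱ e) (evalᴱ n e ρ s) (endOf p (compileᴱ e t p))

    -- One proof for sums and differences. The second operand is computed in temporary `suc t`, and
    -- its `Agree (suc t)` protects the first operand in t.
    binary-correct : ∀ {d ρ s m} (e f : Exp d) (op : ℕ → ℕ → ℕ → Instr) (_∙_ : ℕ → ℕ → ℕ) {t p r} →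
                     (∀ i j k {p r m} → exec (op i j k) ⟨ p , r , m ⟩ ≡ ⟨ suc p , r [ i ≔ r j ∙ r k ] , m ⟩) →
                     4 ≤ t → Regs d ρ (sc s) r → Cells (ar s) m →
                     let ce = compileᴱ e t p ; q = endOf p ce ; cf = compileᴱ f (suc t) q
                         is = ce ++ cf ++ op (tmp t) (tmp t) (tmp (suc t)) ∷ [] in
                     At P p is →
                     Result p r m t (timeᴱ e + timeᴱ f + 1) (evalᴱ n e ρ s ∙ evalᴱ n f ρ s) (endOf p is)

    compileᴱ-correct (lit k) {t} {p} {r} 4≤t R C (f , _) = record
      { steps = f ▸ done ; τ≤ = ≤-refl ; value = ≔-hit r (tmp t) ; agree = agree-≔ {t} {r} t ≤-refl }
    compileᴱ-correct size 4≤t R C at = move-correct R (n-ok R) at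
    compileᴱ-correct area 4≤t R C at = move-correct R (area-ok R) at
    compileᴱ-correct (var x) 4≤t R C at = move-correct R (scl-ok R x) at
    compileᴱ-correct (ix (# l {l<d})) 4≤t R C at = move-correct R (idx-ok R (<ᵇ⇒< l _ l<d)) at
    compileᴱ-correct (e ⊕ f) 4≤t R C at = binary-correct e f add _+_ (λ _ _ _ → refl) 4≤t R C at
    compileᴱ-correct (e ⊖ f) 4≤t R C at = binary-correct e f sub _∸_ (λ _ _ _ → refl) 4≤t R C at
    compileᴱ-correct {d} {ρ} {s} {m} (read a q e) {t} {p} {r} 4≤t R C at
      with evalᴱ n e ρ s <? n
         | compileᴱ-correct e 4≤t R C (at-++ˡ p (compileᴱ e t p) at)
         | at-++ʳ p (compileᴱ e t p) at
    ... | yes v<n | E | (f₁ , f₂ , at′) = record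
      { steps = steps E ▸▸ f₁ ▸ jz-suc f₂ nonzero
                  (steps A ▸▸ proj₁ at″ ▸ proj₁ (proj₂ at″) ▸
                   retarget (sym end-eq) done)
      ; τ≤    = +-mono-≤ (τ≤ E) (≤-trans (+-monoʳ-≤ 2 (+-monoˡ-≤ 2 (τ≤ A))) (≤-reflexive (arith a)))
      ; value = trans (≔-hit (r′ A) (tmp t)) (trans (cong m (trans (value A) (cong (addr a (rowNo q ρ)) value₁)))
                  (cell C a (rowNo q ρ) (evalᴱ n e ρ s) (rowNo≤ q R) v<n))
      ; agree = agree-trans (agree E) (agree-trans (agree-weaken {suc t} {t} {r′ E} {r₁} (n≤1+n t) agree₁)
                  (agree-trans (agree A) (agree-≔ {t} {r′ A} t ≤-refl))) }
      where
      q₁ = endOf p (compileᴱ e t p)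
      r₁ = r′ E [ tmp (suc t) ≔ r′ E nᴿ ∸ r′ E (tmp t) ]
      agree₁ : Agree (suc t) (r′ E) r₁
      agree₁ = agree-≔ {suc t} {r′ E} (suc t) ≤-refl
      R₁ : Regs d ρ (sc s) r₁
      R₁ = regs-agree {t = suc t} (m≤n⇒m≤1+n 4≤t) agree₁ (regs-agree 4≤t (agree E) R)
      value₁ : r₁ (tmp t) ≡ evalᴱ n e ρ s
      value₁ = trans (kept agree₁ aux t (λ _ → ≤-refl)) (value E)
      nonzero : r₁ (tmp (suc t)) ≢ 0
      nonzero eq = m>n⇒m∸n≢0 v<n (trans (sym (trans (≔-hit (r′ E) (tmp (suc t)))
                     (cong₂ _∸_ (n-ok (regs-agree 4≤t (agree E) R)) (value E)))) eq)
      A = address-correct a q t 4≤t R₁ (at-++ˡ (2 + q₁) (address a q t) at′)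
      at″ = at-++ʳ (2 + q₁) (address a q t) at′
      r₃ = r′ A [ tmp t ≔ m (r′ A (tmp t)) ]
      end-eq : endOf p (compileᴱ (read a q e) t p) ≡ 3 + endOf (2 + q₁) (address a q t)
      end-eq = trans (endOf-++ p (compileᴱ e t p)) (endOf-++ (2 + q₁) (address a q t))
      arith : ∀ a → 2 + (suc a + 2) ≡ a + 5
      arith = solve-∀
    ... | no v≮n | E | (f₁ , f₂ , at′) = record
      { steps = steps E ▸▸ f₁ ▸ jz-zero f₂ is-zero (proj₁ (proj₂ (proj₂ at″)) ▸
                   retarget (sym end-eq) done)
      ; τ≤    = +-mono-≤ (τ≤ E) (≤-trans (m≤n+m 3 (a + 2)) (≤-reflexive (+-assoc a 2 3)))
      ; value = trans (≔-hit r₁ (tmp t)) (sym (out C a (rowNo q ρ) (evalᴱ n e ρ s) (≮⇒≥ v≮n)))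
      ; agree = agree-trans (agree E) (agree-trans (agree-weaken {suc t} {t} {r′ E} {r₁} (n≤1+n t) agree₁)
                  (agree-≔ {t} {r₁} t ≤-refl)) }
      where
      q₁ = endOf p (compileᴱ e t p)
      r₁ = r′ E [ tmp (suc t) ≔ r′ E nᴿ ∸ r′ E (tmp t) ]
      agree₁ : Agree (suc t) (r′ E) r₁
      agree₁ = agree-≔ {suc t} {r′ E} (suc t) ≤-refl
      is-zero : r₁ (tmp (suc t)) ≡ 0
      is-zero = trans (trans (≔-hit (r′ E) (tmp (suc t)))
                     (cong₂ _∸_ (n-ok (regs-agree 4≤t (agree E) R)) (value E))) (m≤n⇒m∸n≡0 (≮⇒≥ v≮n))
      at″ = at-++ʳ (2 + q₁) (address a q t) at′
      r₃ = r₁ [ tmp t ≔ 0 ]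
      end-eq : endOf p (compileᴱ (read a q e) t p) ≡ 3 + endOf (2 + q₁) (address a q t)
      end-eq = trans (endOf-++ p (compileᴱ e t p)) (endOf-++ (2 + q₁) (address a q t))

    binary-correct {d} {ρ} {s} {m} e f op _∙_ {t} {p} {r} exec-op 4≤t R C at = record
      { steps = steps E ▸▸ steps F ▸▸ proj₁ at″ ▸
                subst (λ x → Steps P x 0 ⟨ _ , r₃ , m ⟩) (sym (exec-op (tmp t) (tmp t) (tmp (suc t)))) (retarget (sym end-eq) done)
      ; τ≤    = ≤-trans (+-mono-≤ (τ≤ E) (+-monoˡ-≤ 1 (τ≤ F))) (≤-reflexive (sym (+-assoc (timeᴱ e) _ 1)))
      ; value = trans (≔-hit (r′ F) (tmp t)) (cong₂ _∙_ (trans (kept (agree F) aux t (λ _ → ≤-refl)) (value E)) (value F))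
      ; agree = agree-trans (agree E) (agree-trans (agree-weaken {suc t} {t} {r′ E} {r′ F} (n≤1+n t) (agree F))
                  (agree-≔ {t} {r′ F} t ≤-refl)) }
      where
      ce = compileᴱ e t p
      q = endOf p ce
      cf = compileᴱ f (suc t) q
      E = compileᴱ-correct e 4≤t R C (at-++ˡ p ce at)
      at′ = at-++ʳ p ce at
      F = compileᴱ-correct f (m≤n⇒m≤1+n 4≤t) (regs-agree 4≤t (agree E) R) C (at-++ˡ q cf at′)
      at″ = at-++ʳ q cf at′
      r₃ = r′ F [ tmp t ≔ r′ F (tmp t) ∙ r′ F (tmp (suc t)) ]
      end-eq : endOf p (ce ++ cf ++ op (tmp t) (tmp t) (tmp (suc t)) ∷ []) ≡ suc (endOf q cf)
      end-eq = trans (endOf-++ p ce) (endOf-++ q cf)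

    record Outcome (d : ℕ) (ρ : Store) (p : ℕ) (r m : Store) (bnd : ℕ) (s : St) (q : ℕ) : Set where
      field
        r′ m′ : Store
        τ     : ℕ
        steps : Steps P ⟨ p , r , m ⟩ τ ⟨ q , r′ , m′ ⟩
        τ≤    : τ ≤ bnd
        regs  : Regs d ρ (sc s) r′
        cells : Cells (ar s) m′

    module O = Outcome

    compile-correct : ∀ {d ρ s m r p} (c : Cmd d) → Regs d ρ (sc s) r → Cells (ar s) m →
                      At P p (compile c p) →
                      Outcome d ρ p r m (time c n) (run n c ρ s) (endOf p (compile c p))

    -- The induction is on the number j of rounds still to come. The registers represent the state
    -- after k rounds, and control is always at the loop test `2 + p`.
    loop-correct : ∀ {d ρ s m r p} (c : Cmd (suc d)) j k → k + j ≡ n →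
                   let F = λ k → run n c (ρ [ d ≔ k ]) in
                   Regs d ρ (sc (iter k F s)) r → Cells (ar (iter k F s)) m →
                   r (reg idx d) ≡ k → r (reg off d) ≡ suc k * n → At P p (compile (for c) p) →
                   Outcome d ρ (2 + p) r m (2 + j * (time c n + 5)) (iter n F s) (endOf p (compile (for c) p))

    compile-correct skip R C at = record { steps = done ; τ≤ = z≤n ; regs = R ; cells = C }
    compile-correct {d} {ρ} {s} {m} {r} {p} (set x e) R C at = record
      { steps = steps E ▸▸ proj₁ at′ ▸
                retarget (sym (endOf-++ p (compileᴱ e 4 p))) done
      ; τ≤    = +-monoˡ-≤ 1 (τ≤ E)
      ; regs  = subst (λ v → Regs d ρ (sc s [ x ≔ v ]) r₁) v-eq (regs-set x RE)
      ; cells = C }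
      where
      E = compileᴱ-correct e ≤-refl R C (at-++ˡ p (compileᴱ e 4 p) at)
      at′ = at-++ʳ p (compileᴱ e 4 p) at
      RE = regs-agree {t = 4} ≤-refl (agree E) R
      r₁ = r′ E [ reg scl x ≔ r′ E (tmp 4) + r′ E zeroᴿ ]
      v-eq : r′ E (tmp 4) + r′ E zeroᴿ ≡ evalᴱ n e ρ s
      v-eq = trans (cong₂ _+_ (value E) (zero-ok RE)) (+-identityʳ _)
    compile-correct {d} {ρ} {s} {m} {r} {p} (write a q j e) R C at =
      finish (col <? n)
      where
      ce = compileᴱ e 4 p
      q₀ = endOf p ce
      cj = compileᴱ j 5 q₀
      q₁ = endOf q₀ cj
      ca = address a q 5
      v = evalᴱ n e ρ s
      col = evalᴱ n j ρ s
      E = compileᴱ-correct e ≤-refl R C (at-++ˡ p ce at)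
      at₁ = at-++ʳ p ce at
      RE = regs-agree {t = 4} ≤-refl (agree E) R
      J = compileᴱ-correct j (n≤1+n 4) RE C (at-++ˡ q₀ cj at₁)
      at₂ = at-++ʳ q₀ cj at₁
      f₁ = proj₁ at₂
      f₂ = proj₁ (proj₂ at₂)
      at₃ = proj₂ (proj₂ at₂)
      RJ = regs-agree {t = 5} (n≤1+n 4) (agree J) RE
      r₂ = r′ J [ tmp 6 ≔ r′ J nᴿ ∸ r′ J (tmp 5) ]
      agree₂ : Agree 6 (r′ J) r₂
      agree₂ = agree-≔ {6} {r′ J} 6 ≤-refl
      R₂ = regs-agree {t = 6} (m≤n+m 4 2) agree₂ RJ
      test : r₂ (tmp 6) ≡ n ∸ col
      test = trans (≔-hit (r′ J) (tmp 6)) (cong₂ _∸_ (n-ok RJ) (value J))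
      end-eq : endOf p (compile (write a q j e) p) ≡ suc (endOf (2 + q₁) ca)
      end-eq = trans (endOf-++ p ce) (trans (endOf-++ q₀ cj) (endOf-++ (2 + q₁) ca))
      A = address-correct a q 5 {2 + q₁} {r₂} {m} (n≤1+n 4) R₂ (at-++ˡ (2 + q₁) ca at₃)
      at₄ = at-++ʳ (2 + q₁) ca at₃
      add-times : ∀ {x y z} → x ≤ timeᴱ e → y ≤ timeᴱ j → z ≤ a + 4 → x + (y + z) ≤ time (write a q j e) n
      add-times x≤ y≤ z≤ = +-mono-≤ x≤ (+-mono-≤ y≤ z≤)
      arith : ∀ a → 2 + (suc a + 1) ≡ a + 4
      arith = solve-∀
      finish : Dec (col < n) → Outcome d ρ p r m (time (write a q j e) n)
                 (run n (write a q j e) ρ s) (endOf p (compile (write a q j e) p))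
      finish (no v≮n) = record
        { steps = steps E ▸▸ steps J ▸▸ f₁ ▸ jz-zero f₂ (trans test (m≤n⇒m∸n≡0 (≮⇒≥ v≮n)))
                    (retarget (sym end-eq) done)
        ; τ≤    = add-times (τ≤ E) (τ≤ J) (≤-trans (m≤n+m 2 (a + 2)) (≤-reflexive (+-assoc a 2 2)))
        ; regs  = R₂
        ; cells = cells-put-out {a = a} {rowNo q ρ} {col} {v} (≮⇒≥ v≮n) C }
      finish (yes v<n) = record
        { steps = steps E ▸▸ steps J ▸▸ f₁ ▸ jz-suc f₂ (λ eq → m>n⇒m∸n≢0 v<n (trans (sym test) eq))
                    (steps A ▸▸ proj₁ at₄ ▸
                     retarget (sym end-eq) done)
        ; τ≤    = add-times (τ≤ E) (τ≤ J) (≤-trans (+-monoʳ-≤ 2 (+-monoˡ-≤ 1 (τ≤ A))) (≤-reflexive (arith a)))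
        ; regs  = regs-agree {t = 5} (n≤1+n 4) (agree A) R₂
        ; cells = subst₂ (λ x y → Cells (put n a (rowNo q ρ) col v (ar s)) (m [ x ≔ y ])) (sym addr-eq) (sym v-eq)
                    (cells-put {a = a} {rowNo q ρ} {col} {v} (rowNo≤ q R) v<n C) }
        where
        m₁ = m [ r′ A (tmp 5) ≔ r′ A (tmp 4) ]
        addr-eq : r′ A (tmp 5) ≡ addr a (rowNo q ρ) col
        addr-eq = trans (value A) (cong (addr a (rowNo q ρ)) (trans (kept agree₂ aux 5 (λ _ → ≤-refl)) (value J)))
        v-eq : r′ A (tmp 4) ≡ v
        v-eq = trans (kept (agree A) aux 4 (λ _ → ≤-refl))
                 (trans (kept agree₂ aux 4 (λ _ → m≤n+m 5 1)) (trans (kept (agree J) aux 4 (λ _ → ≤-refl)) (value E)))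
    compile-correct {d} {ρ} {s} {m} {r} {p} (c ⨾ c′) R C at = record
      { steps = O.steps X ▸▸ retarget (sym (endOf-++ p is)) (O.steps Y)
      ; τ≤    = +-mono-≤ (O.τ≤ X) (O.τ≤ Y)
      ; regs  = O.regs Y
      ; cells = O.cells Y }
      where
      is = compile c p
      X = compile-correct c R C (at-++ˡ p is at)
      Y = compile-correct c′ (O.regs X) (O.cells X) (at-++ʳ p is at)
    compile-correct {d} {ρ} {s} {m} {r} {p} (ifz e c c′) R C at
      with compileᴱ-correct e ≤-refl R C (at-++ˡ p (compileᴱ e 4 p) at) | at-++ʳ p (compileᴱ e 4 p) at
    ... | E | (f₁ , at′) = finish (evalᴱ n e ρ s) refl
      where
      ce = compileᴱ e 4 p
      q = endOf p ce
      is′ = compile c′ (suc q)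
      q′ = endOf (suc q) is′
      is = compile c (suc q′)
      q″ = endOf (suc q′) is
      RE = regs-agree {t = 4} ≤-refl (agree E) R
      at″ = at-++ʳ (suc q) is′ at′
      end-eq : endOf p (compile (ifz e c c′) p) ≡ q″
      end-eq = trans (endOf-++ p ce) (endOf-++ (suc q) is′)
      tz = time c n
      ts = time c′ n
      finish : ∀ v → evalᴱ n e ρ s ≡ v → Outcome d ρ p r m (time (ifz e c c′) n)
                 (onZero v (run n c ρ s) (run n c′ ρ s)) (endOf p (compile (ifz e c c′) p))
      finish zero eq = record
        { steps = steps E ▸▸ jz-zero f₁ (trans (value E) eq)
                    (retarget (sym end-eq) (O.steps X))
        ; τ≤    = +-mono-≤ (τ≤ E) (s≤s (m≤n⇒m≤1+n (≤-trans (O.τ≤ X) (m≤m+n tz ts))))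
        ; regs  = O.regs X
        ; cells = O.cells X }
        where X = compile-correct c RE C (proj₂ at″)
      finish (suc v) eq = record
        { steps = steps E ▸▸ jz-suc f₁ (λ eq′ → 0≢1+n (trans (sym (trans (sym (value E)) eq′)) eq))
                    (O.steps X ▸▸ proj₁ at″ ▸ retarget (sym end-eq) done)
        ; τ≤    = +-mono-≤ (τ≤ E) (s≤s (≤-trans (≤-reflexive (+-comm (O.τ X) 1)) (s≤s (≤-trans (O.τ≤ X) (m≤n+m ts tz)))))
        ; regs  = O.regs X
        ; cells = O.cells X }
        where X = compile-correct c′ RE C (at-++ˡ (suc q) is′ at′)
    compile-correct {d} {ρ} {s} {m} {r} {p} (for c) R C at@(f₁ , f₂ , _) = record
      { steps = f₁ ▸ f₂ ▸ O.steps L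
      ; τ≤    = s≤s (s≤s (O.τ≤ L))
      ; regs  = O.regs L
      ; cells = O.cells L }
      where
      r₁ = r [ reg idx d ≔ 0 ]
      r₂ = r₁ [ reg off d ≔ r₁ nᴿ + r₁ zeroᴿ ]
      R₁ = regs-counter idx 0 (inj₁ refl) R
      L = loop-correct c n 0 refl (regs-counter off _ (inj₂ refl) R₁) C
            (trans (reg-≔-miss {r₁} {off} {idx} {d} {d} λ ()) (≔-hit r (reg idx d)))
            (trans (≔-hit r₁ (reg off d)) (cong₂ _+_ (n-ok R₁) (zero-ok R₁)))
            at

    loop-correct {d} {ρ} {s} {m} {r} {p} c zero k k+0≡n R C i≡k _ (_ , _ , f₃ , f₄ , at) = record
      { steps = f₃ ▸ jz-zero f₄ test (retarget (sym end-eq) done)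
      ; τ≤    = ≤-refl
      ; regs  = regs-agree {t = 4} ≤-refl (agree-≔ {4} {r} 4 ≤-refl) (subst (λ k → Regs d ρ (sc (iter k F s)) r) k≡n R)
      ; cells = subst (λ k → Cells (ar (iter k F s)) m) k≡n C }
      where
      F = λ k → run n c (ρ [ d ≔ k ])
      k≡n = trans (sym (+-identityʳ k)) k+0≡n
      test : (r [ tmp 4 ≔ r nᴿ ∸ r (reg idx d) ]) (tmp 4) ≡ 0
      test = trans (≔-hit r (tmp 4)) (trans (cong₂ _∸_ (n-ok R) (trans i≡k k≡n)) (n∸n≡0 n))
      end-eq : endOf p (compile (for c) p) ≡ 3 + endOf (4 + p) (compile c (4 + p))
      end-eq = endOf-++ (4 + p) (compile c (4 + p))
    loop-correct {d} {ρ} {s} {m} {r} {p} c (suc j) k k+j≡n R C i≡k o≡k at₀@(_ , _ , f₃ , f₄ , at) = record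
      { steps = f₃ ▸ jz-suc f₄ test (O.steps B ▸▸ proj₁ at₁ ▸ proj₁ (proj₂ at₁) ▸ proj₁ (proj₂ (proj₂ at₁)) ▸ O.steps L)
      ; τ≤    = s≤s (s≤s (begin
          O.τ B + (3 + O.τ L)                                ≤⟨ +-mono-≤ (O.τ≤ B) (+-monoʳ-≤ 3 (O.τ≤ L)) ⟩
          time c n + (3 + (2 + j * (time c n + 5)))          ≡⟨ +-assoc (time c n) 5 _ ⟨
          suc j * (time c n + 5)                             ∎))
      ; regs  = O.regs L
      ; cells = O.cells L }
      where
      open ≤-Reasoning
      F = λ k → run n c (ρ [ d ≔ k ])
      is = compile c (4 + p)
      k<n : k < n
      k<n = ≤-trans (≤-trans (s≤s (m≤m+n k j)) (≤-reflexive (sym (+-suc k j)))) (≤-reflexive k+j≡n)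
      test : (r [ tmp 4 ≔ r nᴿ ∸ r (reg idx d) ]) (tmp 4) ≢ 0
      test eq = m>n⇒m∸n≢0 k<n (trans (sym (trans (≔-hit r (tmp 4)) (cong₂ _∸_ (n-ok R) i≡k))) eq)
      r₁ = r [ tmp 4 ≔ r nᴿ ∸ r (reg idx d) ]
      ag : Agree 4 r r₁
      ag = agree-≔ {4} {r} 4 ≤-refl
      B = compile-correct c (regs-enter k<n (trans (kept ag idx d λ ()) i≡k) (trans (kept ag off d λ ()) o≡k) (regs-agree {t = 4} ≤-refl ag R)) C
            (at-++ˡ (4 + p) is at)
      at₁ = at-++ʳ (4 + p) is at
      RB = O.regs B
      r₂ = O.r′ B
      r₃ = r₂ [ reg idx d ≔ r₂ (reg idx d) + r₂ oneᴿ ]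
      r₄ = r₃ [ reg off d ≔ r₃ (reg off d) + r₃ nᴿ ]
      R₃ = regs-counter idx _ (inj₁ refl) (regs-leave RB)
      i₂ : r₂ (reg idx d) ≡ k
      i₂ = trans (idx-ok RB ≤-refl) (≔-hit ρ d)
      o₂ : r₂ (reg off d) ≡ suc k * n
      o₂ = trans (off-ok RB ≤-refl) (cong (λ x → suc x * n) (≔-hit ρ d))
      L = loop-correct c j (suc k) (trans (sym (+-suc k j)) k+j≡n) (regs-counter off _ (inj₂ refl) R₃) (O.cells B)
            (trans (reg-≔-miss {r₃} {off} {idx} {d} {d} λ ())
              (trans (≔-hit r₂ (reg idx d)) (trans (cong₂ _+_ i₂ (one-ok RB)) (+-comm k 1))))
            (trans (≔-hit r₃ (reg off d))
              (trans (cong₂ _+_ (trans (reg-≔-miss {r₂} {idx} {off} {d} {d} λ ()) o₂) (n-ok R₃)) (+-comm (suc k * n) n)))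
            at₀

-- The prologue computes (n + 1) n by repeated addition.
prologue : Program
prologue =
  const oneᴿ 1 ∷ add (tmp 4) nᴿ oneᴿ ∷
  jz (tmp 4) 6 ∷ add areaᴿ areaᴿ nᴿ ∷ sub (tmp 4) (tmp 4) oneᴿ ∷ jump 2 ∷ []

assemble : Cmd 0 → Program
assemble c = prologue ++ compile c 6

module _ (n : ℕ) (m : Store) where

  -- All of memory is read as arrays. Array 0 then coincides with the layout of `encode`: colours in
  -- its header row, adjacency in the rows behind it. Its header row also occupies the first n
  -- cells, where the output is expected.
  start : St
  start = st (λ _ → 0) (λ a ρ j → if j <ᵇ n then m (addr n a ρ j) else 0)

  start-cells : Cells n (ar start) m
  start-cells = record
    { cell = λ a ρ j _ j<n → sym (cong (λ b → if b then m (addr n a ρ j) else 0) (<ᵇ-true j<n))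
    ; out  = λ a ρ j n≤j → cong (λ b → if b then m (addr n a ρ j) else 0) (<ᵇ-false n≤j) }

  module _ (P : Program) (at : At P 0 prologue) where

    f₀ = proj₁ at
    f₁ = proj₁ (proj₂ at)
    f₂ = proj₁ (proj₂ (proj₂ at))
    f₃ = proj₁ (proj₂ (proj₂ (proj₂ at)))
    f₄ = proj₁ (proj₂ (proj₂ (proj₂ (proj₂ at))))
    f₅ = proj₁ (proj₂ (proj₂ (proj₂ (proj₂ (proj₂ at)))))

    prologue-loop : ∀ j r → r (tmp 4) ≡ j → r oneᴿ ≡ 1 →
      ∃[ r′ ] Steps P ⟨ 2 , r , m ⟩ (1 + j * 4) ⟨ 6 , r′ , m ⟩ ×
        r′ areaᴿ ≡ r areaᴿ + j * r nᴿ ×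
        (∀ q → areaᴿ ≢ q → tmp 4 ≢ q → r′ q ≡ r q)
    prologue-loop zero r r≡j one =
      r , jz-zero f₂ r≡j done , sym (+-identityʳ _) , λ _ _ _ → refl
    prologue-loop (suc j) r r≡j one
      with prologue-loop j (r [ areaᴿ ≔ r areaᴿ + r nᴿ ] [ tmp 4 ≔ r (tmp 4) ∸ r oneᴿ ])
             (cong₂ _∸_ r≡j one) one
    ... | r′ , steps , area-eq , keep =
      r′ ,
      jz-suc f₂ (λ eq → 0≢1+n (trans (sym eq) r≡j)) (f₃ ▸ f₄ ▸ f₅ ▸ steps) ,
      trans area-eq (+-assoc (r areaᴿ) (r nᴿ) _) ,
      λ q q≢ q≢′ → trans (keep q q≢ q≢′) (trans (≔-miss (r [ areaᴿ ≔ r areaᴿ + r nᴿ ]) q≢′) (≔-miss r q≢))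

    prologue-correct : ∃[ r ] Steps P ⟨ 0 , (λ _ → 0) [ 0 ≔ n ] , m ⟩ (3 + suc n * 4) ⟨ 6 , r , m ⟩ ×
                       Regs n 0 (λ _ → 0) (λ _ → 0) r
    prologue-correct
      with prologue-loop (suc n) ((λ _ → 0) [ 0 ≔ n ] [ oneᴿ ≔ 1 ] [ tmp 4 ≔ n + 1 ]) (+-comm n 1) refl
    ... | r , steps , area-eq , keep = r , f₀ ▸ f₁ ▸ steps , record
      { n-ok    = keep nᴿ (λ ()) (λ ())
      ; one-ok  = keep oneᴿ (λ ()) (λ ())
      ; area-ok = area-eq
      ; zero-ok = keep zeroᴿ (λ ()) (λ ())
      ; scl-ok  = λ x → trans (keep (reg scl x) (differ 2 x) (differ 4 x))
          (trans (≔-miss ((λ _ → 0) [ 0 ≔ n ] [ oneᴿ ≔ 1 ]) (differ 4 x))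
            (trans (≔-miss ((λ _ → 0) [ 0 ≔ n ]) (differ 1 x)) (≔-miss (λ _ → 0) (differ 0 x))))
      ; idx-ok  = λ ()
      ; off-ok  = λ ()
      ; bound   = λ () }
      where
      differ : ∀ i x → reg aux i ≢ reg scl x
      differ i x eq = case reg-injective {aux} {scl} {i} {x} eq of λ { (() , _) }

  assemble-correct : ∀ (c : Cmd 0) →
    ∃[ t ] ∃[ c′ ] Halts (assemble c) ⟨ 0 , (λ _ → 0) [ 0 ≔ n ] , m ⟩ t c′ ×
      t ≤ 3 + suc n * 4 + time c n × Cells n (ar (run n c (λ _ → 0) start)) (Config.mem c′)
  assemble-correct c = _ , _ ,
    steps-halt (proj₁ (proj₂ setup) ▸▸ Outcome.steps O)
      (subst (λ p → fetch P p ≡ nothing) (endOf-++ 0 prologue {compile c 6}) (fetch-end P 0 P refl)) ,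
    +-monoʳ-≤ (3 + suc n * 4) (Outcome.τ≤ O) , Outcome.cells O
    where
    P = assemble c
    at = at-drop P 0 P refl
    setup = prologue-correct P (at-++ˡ 0 prologue at)
    O = compile-correct n P {s = start} c (proj₂ (proj₂ setup)) start-cells (at-++ʳ 0 prologue at)

-- Sums

when unless : ℕ → ℕ → ℕ
when h v = onZero h 0 v
unless h v = onZero h v 0

when-zero : ∀ {h v} → h ≡ 0 → when h v ≡ 0
when-zero refl = refl

when-nonzero : ∀ {h v} → h ≢ 0 → when h v ≡ v
when-nonzero {zero}  h≢0 = contradiction refl h≢0
when-nonzero {suc h} _   = refl

unless-nonzero : ∀ {h v} → h ≢ 0 → unless h v ≡ 0
unless-nonzero {zero}  h≢0 = contradiction refl h≢0
unless-nonzero {suc h} _   = refl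

unless-zero : ∀ {h v} → h ≡ 0 → unless h v ≡ v
unless-zero refl = refl

when≤ : ∀ h v → when h v ≤ v
when≤ zero    v = z≤n
when≤ (suc h) v = ≤-refl

sumTo : ℕ → (ℕ → ℕ) → ℕ
sumTo zero    f = 0
sumTo (suc n) f = sumTo n f + f n

sum-cong : ∀ n {f g} → (∀ {x} → x < n → f x ≡ g x) → sumTo n f ≡ sumTo n g
sum-cong zero    eq = refl
sum-cong (suc n) eq = cong₂ _+_ (sum-cong n (eq ∘ m≤n⇒m≤1+n)) (eq ≤-refl)

sum-mono : ∀ n {f g} → (∀ {x} → x < n → f x ≤ g x) → sumTo n f ≤ sumTo n g
sum-mono zero    le = z≤n
sum-mono (suc n) le = +-mono-≤ (sum-mono n (le ∘ m≤n⇒m≤1+n)) (le ≤-refl)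

sum-+ : ∀ n f g → sumTo n (λ x → f x + g x) ≡ sumTo n f + sumTo n g
sum-+ zero    f g = refl
sum-+ (suc n) f g = trans (cong (_+ (f n + g n)) (sum-+ n f g)) (rearrange (sumTo n f) (sumTo n g) (f n) (g n))
  where
  rearrange : ∀ a b c d → a + b + (c + d) ≡ a + c + (b + d)
  rearrange = solve-∀

sum-*ˡ : ∀ n c f → sumTo n (λ x → c * f x) ≡ c * sumTo n f
sum-*ˡ zero    c f = sym (*-zeroʳ c)
sum-*ˡ (suc n) c f = trans (cong (_+ c * f n) (sum-*ˡ n c f)) (sym (*-distribˡ-+ c (sumTo n f) (f n)))

sum-const : ∀ n c → sumTo n (λ _ → c) ≡ n * c
sum-const zero    c = refl
sum-const (suc n) c = trans (cong (_+ c) (sum-const n c)) (+-comm (n * c) c)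

sum-zero : ∀ n {f} → (∀ {x} → x < n → f x ≡ 0) → sumTo n f ≡ 0
sum-zero n eq = trans (sum-cong n eq) (trans (sum-const n 0) (*-zeroʳ n))

term≤sum : ∀ n f {x} → x < n → f x ≤ sumTo n f
term≤sum (suc n) f {x} x<1+n with x ≟ n
... | yes refl = m≤n+m (f n) (sumTo n f)
... | no x≢n   = ≤-trans (term≤sum n f (≤∧≢⇒< (s≤s⁻¹ x<1+n) x≢n)) (m≤m+n _ (f n))

-- Adding the exchanged terms on opposite sides avoids truncated subtraction.
sum-update : ∀ n {f g u} → u < n → (∀ {x} → x < n → x ≢ u → f x ≡ g x) →
             sumTo n f + g u ≡ sumTo n g + f u
sum-update (suc n) {f} {g} {u} u<1+n eq with u ≟ n
... | yes refl = begin
  sumTo n f + f n + g n ≡⟨ cong (λ s → s + f n + g n) (sum-cong n λ x<n → eq (m≤n⇒m≤1+n x<n) (<⇒≢ x<n)) ⟩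
  sumTo n g + f n + g n ≡⟨ swap (sumTo n g) (f n) (g n) ⟩
  sumTo n g + g n + f n ∎
  where
  open ≡-Reasoning
  swap : ∀ a b c → a + b + c ≡ a + c + b
  swap = solve-∀
... | no u≢n = begin
  sumTo n f + f n + g u ≡⟨ swap (sumTo n f) (f n) (g u) ⟩
  sumTo n f + g u + f n ≡⟨ cong₂ _+_ (sum-update n (≤∧≢⇒< (s≤s⁻¹ u<1+n) u≢n) λ x<n → eq (m≤n⇒m≤1+n x<n)) (eq ≤-refl (u≢n ∘ sym)) ⟩
  sumTo n g + f u + g n ≡⟨ swap (sumTo n g) (f u) (g n) ⟩
  sumTo n g + g n + f u ∎
  where
  open ≡-Reasoning
  swap : ∀ a b c → a + b + c ≡ a + c + b
  swap = solve-∀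

-- Neighbourhoods and walks

record Reflexive-Symmetric (n : ℕ) (nb : ℕ → ℕ → ℕ) : Set where
  field
    nb-refl : ∀ {i} → i < n → nb i i ≢ 0
    nb-sym  : ∀ {i j} → i < n → j < n → nb i j ≢ 0 → nb j i ≢ 0

  nb-sym₀ : ∀ {i j} → i < n → j < n → nb i j ≡ 0 → nb j i ≡ 0
  nb-sym₀ {i} {j} i<n j<n eq with nb j i ≟ 0
  ... | yes eq′ = eq′
  ... | no ne   = contradiction eq (nb-sym j<n i<n ne)

module _ (n : ℕ) (nb : ℕ → ℕ → ℕ) where

  Edge : (ℕ → Set) → ℕ → ℕ → Set
  Edge P x y = (x < n × P x) × (y < n × P y) × nb x y ≢ 0

  -- Both ends of each edge satisfy P, but the empty walk says nothing about its vertex. Hence the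
  -- lemmas assume P at the start separately where they need it.
  Conn : (ℕ → Set) → ℕ → ℕ → Set
  Conn P = Star (Edge P)

  Free : ℕ → ℕ → Set
  Free w x = nb w x ≡ 0

  In : (ℕ → ℕ) → ℕ → Set
  In h x = h x ≢ 0

  conn-end : ∀ {P u v} → u < n × P u → Conn P u v → v < n × P v
  conn-end Pu ε                    = Pu
  conn-end _  ((_ , Py , _) ◅ y⇝v) = conn-end Py y⇝v

  conn-map : ∀ {P Q u v} → (∀ {x} → x < n → P x → Q x) → Conn P u v → Conn Q u v
  conn-map f = gmap (λ x → x) λ ((x<n , Px) , (y<n , Py) , xy) → (x<n , f x<n Px) , (y<n , f y<n Py) , xy

  -- Representative points of the intervals give such a preorder.
  record Order : Set₁ where
    field
      _⊑_      : ℕ → ℕ → Set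
      ⊑-trans  : ∀ {i j k} → i ⊑ j → j ⊑ k → i ⊑ k
      ⊑-total  : ∀ {i j} → i < n → j < n → i ⊑ j ⊎ j ⊑ i
      umbrella : ∀ {i j k} → i < n → j < n → k < n → nb i j ≢ 0 → i ⊑ k → k ⊑ j →
                 nb k i ≢ 0 ⊎ nb k j ≢ 0

  reverse-order : Reflexive-Symmetric n nb → Order → Order
  reverse-order rs O = record
    { _⊑_      = λ i j → j ⊑ i
    ; ⊑-trans  = λ p q → ⊑-trans q p
    ; ⊑-total  = λ i<n j<n → ⊑-total j<n i<n
    ; umbrella = λ i<n j<n k<n ij i⊒k k⊒j →
        case umbrella j<n i<n k<n (Reflexive-Symmetric.nb-sym rs i<n j<n ij) k⊒j i⊒k of λ
          { (inj₁ p) → inj₂ p ; (inj₂ p) → inj₁ p } }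
    where open Order O

  module _ (rs : Reflexive-Symmetric n nb) where

    open Reflexive-Symmetric rs

    -- An edge that crossed w in the preorder would have an end in N(w) by `umbrella`, so a walk
    -- avoiding N(w) never passes w.
    same-side : (O : Order) (let open Order O) → ∀ {u v w} → w < n → Conn (Free w) u v → u ⊑ w → v ⊑ w
    same-side O w<n ε u⊑w = u⊑w
    same-side O w<n (((x<n , wx) , (y<n , wy) , xy) ◅ y⇝v) x⊑w with Order.⊑-total O y<n w<n
    ... | inj₁ y⊑w = same-side O w<n y⇝v y⊑w
    ... | inj₂ w⊑y with Order.umbrella O x<n y<n w<n xy x⊑w w⊑y
    ... | inj₁ wx′ = contradiction wx wx′
    ... | inj₂ wy′ = contradiction wy wy′

    -- Such a walk would stay below w, forcing v ⊑ w ⊑ v; `umbrella` for the pair v, v then puts v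
    -- into N(w), where the walk may not end. This places a connected set inside D(u, v) for its
    -- extreme vertices.
    between : (O : Order) (let open Order O) → ∀ {u v w} → u < n → v < n → w < n →
              u ⊑ w → w ⊑ v → nb w u ≡ 0 → ¬ Conn (Free w) u v
    between O u<n v<n w<n u⊑w w⊑v wu u⇝v
      with Order.umbrella O v<n v<n w<n (nb-refl v<n) (same-side O w<n u⇝v u⊑w) w⊑v
         | proj₂ (conn-end (u<n , wu) u⇝v)
    ... | inj₁ wv′ | wv = wv′ wv
    ... | inj₂ wv′ | wv = wv′ wv

    -- A constructive dichotomy: scanning the walk yields a vertex in N(w), or the same walk read as
    -- one that avoids N(w).
    meets : ∀ {S u v} w → u < n → S u → Conn S u v →
            (∃[ x ] x < n × S x × nb w x ≢ 0) ⊎ (nb w u ≡ 0 × Conn (Free w) u v)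
    meets {u = u} w u<n Su p with nb w u ≟ 0
    ... | no wu = inj₁ (_ , u<n , Su , wu)
    meets w u<n Su ε | yes wu = inj₂ (wu , ε)
    meets w u<n Su ((_ , (y<n , Sy) , uy) ◅ p) | yes wu with meets w y<n Sy p
    ... | inj₁ hit       = inj₁ hit
    ... | inj₂ (wy , q) = inj₂ (wu , ((u<n , wu) , (y<n , wy) , uy) ◅ q)

  module _ (wt : ℕ → ℕ) where

    -- Walks from i to j with inner vertices below k; the weight omits wt i.
    data Path (k : ℕ) : ℕ → ℕ → ℕ → Set where
      here : ∀ {i} → Path k i i 0
      edge : ∀ {i j} → j < n → nb i j ≢ 0 → Path k i j (wt j)
      via  : ∀ {i x j c} → x < n → x < k → nb i x ≢ 0 → Path k x j c → Path k i j (wt x + c)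

    -- The path is cut at its first and last visit to k. What lies between is a closed walk and is
    -- dropped, hence the inequality.
    path-split : ∀ {k i j c} → Path (suc k) i j c →
                 Path k i j c ⊎ ∃[ c₁ ] ∃[ c₂ ] Path k i k c₁ × Path k k j c₂ × c₁ + c₂ ≤ c
    path-split here           = inj₁ here
    path-split (edge j<n ij)  = inj₁ (edge j<n ij)
    path-split {k} (via {x = x} {c = c} x<n x<1+k i∼x p) with x ≟ k | path-split p
    ... | no x≢k   | inj₁ q = inj₁ (via x<n (≤∧≢⇒< (s≤s⁻¹ x<1+k) x≢k) i∼x q)
    ... | no x≢k   | inj₂ (c₁ , c₂ , p₁ , p₂ , le) =
      inj₂ (wt x + c₁ , c₂ , via x<n (≤∧≢⇒< (s≤s⁻¹ x<1+k) x≢k) i∼x p₁ , p₂ ,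
            ≤-trans (≤-reflexive (+-assoc (wt x) c₁ c₂)) (+-monoʳ-≤ (wt x) le))
    ... | yes refl | inj₁ q = inj₂ (wt x , c , edge x<n i∼x , q , ≤-refl)
    ... | yes refl | inj₂ (c₁ , c₂ , p₁ , p₂ , le) =
      inj₂ (wt x , c₂ , edge x<n i∼x , p₂ , +-monoʳ-≤ (wt x) (≤-trans (m≤n+m c₂ c₁) le))

    Walk : ℕ → ℕ → ℕ → Set
    Walk = Path n

    step-walk : ∀ {i x j c} → x < n → nb i x ≢ 0 → Walk x j c → Walk i j (wt x + c)
    step-walk x<n i∼x p = via x<n x<n i∼x p

    infixr 5 _++ʷ_

    _++ʷ_ : ∀ {i x j c d} → Walk i x c → Walk x j d → Walk i j (c + d)
    here                    ++ʷ q = q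
    edge x<n i∼x             ++ʷ q = step-walk x<n i∼x q
    via {x = x} {c = c} x<n _ i∼x p ++ʷ q =
      subst (Path n _ _) (sym (+-assoc (wt x) c _)) (step-walk x<n i∼x (p ++ʷ q))

    last-weight : ∀ {i j c} → Walk i j c → i ≢ j → wt j ≤ c
    last-weight here                      i≢j = contradiction refl i≢j
    last-weight (edge _ _)                i≢j = ≤-refl
    last-weight {j = j} (via {x = x} {c = c} _ _ _ p) i≢j with x ≟ j
    ... | yes refl = m≤m+n (wt x) c
    ... | no x≢j   = ≤-trans (last-weight p x≢j) (m≤n+m c (wt x))

    first-step : ∀ {i j c} → Walk i j c → i ≢ j → j < n →
                 ∃[ x ] ∃[ c′ ] x < n × nb i x ≢ 0 × Walk x j c′ × c ≡ wt x + c′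
    first-step here            i≢j _   = contradiction refl i≢j
    first-step (edge j<n ij)   i≢j _   = _ , 0 , j<n , ij , here , sym (+-identityʳ _)
    first-step (via x<n _ i∼x p) i≢j _  = _ , _ , x<n , i∼x , p , refl

    module _ (rs : Reflexive-Symmetric n nb) where

      open Reflexive-Symmetric rs

      -- Some vertex or edge of the walk spans v in the preorder, and `umbrella` puts one of its
      -- ends into N(v); the walk is cut there.
      hits : (O : Order) (let open Order O) → ∀ {u v w c} → u < n → v < n → w < n →
             Walk u w c → u ⊑ v → v ⊑ w →
             ∃[ x ] ∃[ c₁ ] ∃[ c₂ ] x < n × nb v x ≢ 0 × Walk u x c₁ × Walk x w c₂ × c₁ + c₂ ≡ c
      hits O u<n v<n w<n here u⊑v v⊑w with Order.umbrella O u<n u<n v<n (nb-refl u<n) u⊑v v⊑w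
      ... | inj₁ vu = _ , 0 , 0 , u<n , vu , here , here , refl
      ... | inj₂ vu = _ , 0 , 0 , u<n , vu , here , here , refl
      hits O u<n v<n w<n (edge _ uw) u⊑v v⊑w with Order.umbrella O u<n w<n v<n uw u⊑v v⊑w
      ... | inj₁ vu = _ , 0 , _ , u<n , vu , here , edge w<n uw , refl
      ... | inj₂ vw = _ , _ , 0 , w<n , vw , edge w<n uw , here , +-identityʳ _
      hits O u<n v<n w<n (via {x = x} x<n _ ux p) u⊑v v⊑w with Order.⊑-total O x<n v<n
      ... | inj₁ x⊑v with hits O x<n v<n w<n p x⊑v v⊑w
      ... | y , c₁ , c₂ , y<n , vy , p₁ , p₂ , eq =
        y , wt x + c₁ , c₂ , y<n , vy , step-walk x<n ux p₁ , p₂ , trans (+-assoc (wt x) c₁ c₂) (cong (wt x +_) eq)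
      hits O u<n v<n w<n (via {x = x} x<n _ ux p) u⊑v v⊑w | inj₂ v⊑x
        with Order.umbrella O u<n x<n v<n ux u⊑v v⊑x
      ... | inj₁ vu = _ , 0 , _ , u<n , vu , here , step-walk x<n ux p , refl
      ... | inj₂ vx = _ , wt x , _ , x<n , vx , edge x<n ux , p , refl

      module _ (wt-pos : ∀ x → 0 < wt x) where

        record IsDistance (∞ : ℕ) (D : ℕ → ℕ → ℕ) : Set where
          field
            sound    : ∀ {i j} → i < n → j < n → D i j < ∞ → Walk i j (D i j)
            complete : ∀ {i j c} → i < n → j < n → Walk i j c → D i j ≤ c

        module _ {∞ D} (isD : IsDistance ∞ D) where

          open IsDistance isD

          private
            -- If a shortest walk from u to v ran through w and an undominated
            -- detour existed, then w would lie beyond u or v, and a shortcut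
            -- through the neighbourhood of v (or u) would be cheaper.
            beyond-v : (O : Order) (let open Order O) → ∀ {u v w} → u < n → v < n → w < n →
                       D u v < ∞ → D u w + D w v ≤ D u v → nb w v ≡ 0 → u ⊑ v → v ⊑ w → ⊥
            beyond-v O {u} {v} {w} u<n v<n w<n fin le wv u⊑v v⊑w
              with hits O u<n v<n w<n (sound u<n w<n (≤-<-trans (≤-trans (m≤m+n _ _) le) fin)) u⊑v v⊑w
            ... | x , c₁ , c₂ , x<n , vx , p₁ , p₂ , eq = <-irrefl refl (begin-strict
              c₁ + wt v         ≤⟨ +-monoʳ-≤ c₁ (last-weight (sound w<n v<n (≤-<-trans (≤-trans (m≤n+m _ _) le) fin))
                                     λ { refl → nb-refl v<n wv }) ⟩
              c₁ + D w v        <⟨ +-monoˡ-< (D w v) (≤-trans (≤-reflexive (+-comm 1 c₁)) (+-monoʳ-≤ c₁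
                                     (≤-trans (wt-pos w) (last-weight p₂ λ { refl → vx (nb-sym₀ x<n v<n wv) })))) ⟩
              c₁ + c₂ + D w v   ≡⟨ cong (_+ D w v) eq ⟩
              D u w + D w v     ≤⟨ le ⟩
              D u v             ≤⟨ complete u<n v<n (p₁ ++ʷ edge v<n (nb-sym v<n x<n vx)) ⟩
              c₁ + wt v         ∎)
              where open ≤-Reasoning

            -- Weights omit the first vertex, so distances are not symmetric and this case is not
            -- `beyond-v` for the reversed walk. Here the prefix from w to N(u) pays for its last
            -- vertex x, which covers the step from u to x.
            beyond-u : (O : Order) (let open Order O) → ∀ {u v w} → u < n → v < n → w < n →
                       D u v < ∞ → D u w + D w v ≤ D u v → nb w u ≡ 0 → w ⊑ u → u ⊑ v → ⊥
            beyond-u O {u} {v} {w} u<n v<n w<n fin le wu w⊑u u⊑v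
              with hits O w<n u<n v<n (sound w<n v<n (≤-<-trans (≤-trans (m≤n+m _ _) le) fin)) w⊑u u⊑v
            ... | x , c₁ , c₂ , x<n , ux , p₁ , p₂ , eq = <-irrefl refl (begin-strict
              D u v             ≤⟨ complete u<n v<n (step-walk x<n ux p₂) ⟩
              wt x + c₂         ≤⟨ +-monoˡ-≤ c₂ (last-weight p₁ λ { refl → ux (nb-sym₀ x<n u<n wu) }) ⟩
              c₁ + c₂           ≡⟨ eq ⟩
              D w v             <⟨ +-monoˡ-≤ (D w v) (≤-trans (wt-pos w) (last-weight
                                     (sound u<n w<n (≤-<-trans (≤-trans (m≤m+n _ _) le) fin)) λ { refl → nb-refl u<n wu })) ⟩
              D u w + D w v     ≤⟨ le ⟩
              D u v             ∎)
              where open ≤-Reasoning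

            shortest-side : (O : Order) (let open Order O) → ∀ {u v w} → u < n → v < n → w < n →
                            D u v < ∞ → D u w + D w v ≤ D u v → nb w u ≡ 0 → Conn (Free w) u v → u ⊑ w → ⊥
            shortest-side O u<n v<n w<n fin le wu u⇝v u⊑w with Order.⊑-total O u<n v<n
            ... | inj₁ u⊑v = beyond-v O u<n v<n w<n fin le (proj₂ (conn-end (u<n , wu) u⇝v)) u⊑v (same-side rs O w<n u⇝v u⊑w)
            ... | inj₂ v⊑u = beyond-u (reverse-order rs O) u<n v<n w<n fin le wu u⊑w v⊑u

          -- The inequality of distances says that w is on a shortest walk without naming the walk,
          -- and in this form it is remembered for traced vertices. A walk avoiding N(w) keeps u and
          -- v on one side of w, which leaves only the two cases above.
          shortest-dominated : Order → ∀ {u v w} → u < n → v < n → w < n →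
            D u v < ∞ → D u w + D w v ≤ D u v → nb w u ≡ 0 → ¬ Conn (Free w) u v
          shortest-dominated O u<n v<n w<n fin le wu u⇝v with Order.⊑-total O u<n w<n
          ... | inj₁ u⊑w = shortest-side O u<n v<n w<n fin le wu u⇝v u⊑w
          ... | inj₂ w⊑u = shortest-side (reverse-order rs O) u<n v<n w<n fin le wu u⇝v w⊑u

        private
          -- The walk ends in u, or leaves u for the last time towards some y, or never meets u. The
          -- third case cannot occur for x = u; it is there because the induction moves the starting
          -- point.
          last-visit : ∀ {h u x v} → x < n → In h x → Conn (In h) x v →
            let h′ = h [ u ≔ 0 ] in
            v ≡ u ⊎
            (∃[ y ] y < n × In h′ y × nb u y ≢ 0 × Conn (In h′) y v) ⊎
            (x ≢ u × Conn (In h′) x v)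
          last-visit {h} {u} {x} x<n hx ε with x ≟ u
          ... | yes x≡u = inj₁ x≡u
          ... | no x≢u  = inj₂ (inj₂ (x≢u , ε))
          last-visit {h} {u} {x} x<n hx ((_ , (y<n , hy) , xy) ◅ p) with last-visit {h} {u} y<n hy p
          ... | inj₁ v≡u = inj₁ v≡u
          ... | inj₂ (inj₁ q) = inj₂ (inj₁ q)
          ... | inj₂ (inj₂ (y≢u , q)) with x ≟ u
          ... | yes refl = inj₂ (inj₁ (_ , y<n , (λ eq → hy (trans (sym (≔-miss h (y≢u ∘ sym))) eq)) , xy , q))
          ... | no x≢u   = inj₂ (inj₂ (x≢u ,
            ((x<n , λ eq → hx (trans (sym (≔-miss h (x≢u ∘ sym))) eq)) ,
             (y<n , λ eq → hy (trans (sym (≔-miss h (y≢u ∘ sym))) eq)) , xy) ◅ q))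

        -- Repeatedly leaving the current vertex for good after its last visit
        -- makes the walk simple.
        simple-walk : ∀ b {h u v} → sumTo n (λ x → when (h x) (wt x)) ≤ b →
                      u < n → In h u → Conn (In h) u v →
                      ∃[ c ] Walk u v c × c + wt u ≤ sumTo n (λ x → when (h x) (wt x))
        simple-walk zero {h} {u} ≤b u<n hu p =
          contradiction (≤-trans (≤-trans (wt-pos u) (≤-reflexive (sym (when-nonzero hu))))
            (≤-trans (term≤sum n (λ x → when (h x) (wt x)) u<n) ≤b)) λ ()
        simple-walk (suc b) {h} {u} {v} ≤b u<n hu p with last-visit {h} {u} u<n hu p
        ... | inj₁ refl = 0 , here ,
          ≤-trans (≤-reflexive (sym (when-nonzero hu))) (term≤sum n (λ x → when (h x) (wt x)) u<n)
        ... | inj₂ (inj₂ (u≢u , _)) = contradiction refl u≢u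
        ... | inj₂ (inj₁ (y , y<n , h′y , uy , q)) =
          wt y + proj₁ rest , step-walk y<n uy (proj₁ (proj₂ rest)) ,
          ≤-trans (+-monoˡ-≤ (wt u) (≤-trans (≤-reflexive (+-comm (wt y) _)) (proj₂ (proj₂ rest)))) (≤-reflexive removed)
          where
          h′ = h [ u ≔ 0 ]
          removed : sumTo n (λ x → when (h′ x) (wt x)) + wt u ≡ sumTo n (λ x → when (h x) (wt x))
          removed = begin
            sumTo n (λ x → when (h′ x) (wt x)) + wt u
              ≡⟨ cong (sumTo n (λ x → when (h′ x) (wt x)) +_) (when-nonzero hu) ⟨
            sumTo n (λ x → when (h′ x) (wt x)) + when (h u) (wt u)
              ≡⟨ sum-update n u<n (λ {x} _ x≢u → cong (λ z → when z (wt x)) (≔-miss h (x≢u ∘ sym))) ⟩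
            sumTo n (λ x → when (h x) (wt x)) + when (h′ u) (wt u)
              ≡⟨ cong (sumTo n (λ x → when (h x) (wt x)) +_) (when-zero (≔-hit h u)) ⟩
            sumTo n (λ x → when (h x) (wt x)) + 0
              ≡⟨ +-identityʳ _ ⟩
            sumTo n (λ x → when (h x) (wt x)) ∎
            where open ≡-Reasoning
          rest = simple-walk b {h′} {y}
            (s≤s⁻¹ (≤-trans (≤-trans (≤-reflexive (+-comm 1 _)) (+-monoʳ-≤ (sumTo n (λ x → when (h′ x) (wt x))) (wt-pos u)))
              (≤-trans (≤-reflexive removed) ≤b))) y<n h′y q

  least : (O : Order) (let open Order O) → ∀ h k → k ≤ n →
          (∀ {x} → x < k → h x ≡ 0) ⊎ ∃[ u ] u < n × In h u × (∀ {x} → x < k → In h x → u ⊑ x)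
  least O h zero    _   = inj₁ λ ()
  least O h (suc k) k<n with h k ≟ 0 | least O h k (<⇒≤ k<n)
  ... | yes hk | inj₁ none = inj₁ λ {x} x<1+k → case x ≟ k of λ
        { (yes refl) → hk ; (no x≢k) → none (≤∧≢⇒< (s≤s⁻¹ x<1+k) x≢k) }
  ... | yes hk | inj₂ (u , u<n , hu , min) = inj₂ (u , u<n , hu , λ {x} x<1+k hx → case x ≟ k of λ
        { (yes refl) → contradiction hk hx ; (no x≢k) → min (≤∧≢⇒< (s≤s⁻¹ x<1+k) x≢k) hx })
  ... | no hk | inj₁ none = inj₂ (k , k<n , hk , λ {x} x<1+k hx → case x ≟ k of λ
        { (yes refl) → k⊑k ; (no x≢k) → contradiction (none (≤∧≢⇒< (s≤s⁻¹ x<1+k) x≢k)) hx })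
    where
    k⊑k : Order._⊑_ O k k
    k⊑k with Order.⊑-total O k<n k<n
    ... | inj₁ p = p
    ... | inj₂ p = p
  ... | no hk | inj₂ (u , u<n , hu , min) with Order.⊑-total O u<n k<n
  ... | inj₁ u⊑k = inj₂ (u , u<n , hu , λ {x} x<1+k hx → case x ≟ k of λ
        { (yes refl) → u⊑k ; (no x≢k) → min (≤∧≢⇒< (s≤s⁻¹ x<1+k) x≢k) hx })
  ... | inj₂ k⊑u = inj₂ (k , k<n , hk , λ {x} x<1+k hx → case x ≟ k of λ
        { (yes refl) → k⊑k ; (no x≢k) → Order.⊑-trans O k⊑u (min (≤∧≢⇒< (s≤s⁻¹ x<1+k) x≢k) hx) })
    where
    k⊑k : Order._⊑_ O k k
    k⊑k with Order.⊑-total O k<n k<n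
    ... | inj₁ p = p
    ... | inj₂ p = p

-- Frames

-- A syntactic check by computation: for a concrete command each frame condition is closed by
-- `refl`.
keepsArr keepsScl : ∀ {d} → Cmd d → ℕ → Bool
keepsArr skip            a = true
keepsArr (set _ _)       a = true
keepsArr (write b _ _ _) a = not (b ≡ᵇ a)
keepsArr (c ⨾ c′)        a = keepsArr c a ∧ keepsArr c′ a
keepsArr (ifz _ c c′)    a = keepsArr c a ∧ keepsArr c′ a
keepsArr (for c)         a = keepsArr c a
keepsScl skip            x = true
keepsScl (set y _)       x = not (y ≡ᵇ x)
keepsScl (write _ _ _ _) x = true
keepsScl (c ⨾ c′)        x = keepsScl c x ∧ keepsScl c′ x
keepsScl (ifz _ c c′)    x = keepsScl c x ∧ keepsScl c′ x
keepsScl (for c)         x = keepsScl c x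

∧-trueˡ : ∀ {b c} → b ∧ c ≡ true → b ≡ true
∧-trueˡ {true} _ = refl

∧-trueʳ : ∀ {b c} → b ∧ c ≡ true → c ≡ true
∧-trueʳ {true} eq = eq

record Frame {d} (c : Cmd d) (s s′ : St) : Set where
  constructor framed
  field
    arr : ∀ a → keepsArr c a ≡ true → ar s′ a ≡ ar s a
    sca : ∀ x → keepsScl c x ≡ true → sc s′ x ≡ sc s x

open Frame

frame-refl : ∀ {d} {c : Cmd d} {s} → Frame c s s
frame-refl = framed (λ _ _ → refl) (λ _ _ → refl)

frame-trans : ∀ {d} {c : Cmd d} {s s′ s″} → Frame c s s′ → Frame c s′ s″ → Frame c s s″
frame-trans p q = framed (λ a k → trans (arr q a k) (arr p a k)) (λ x k → trans (sca q x k) (sca p x k))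

iter-inv : {A : Set} (n : ℕ) {f : ℕ → A → A} {s : A} (I : ℕ → A → Set) → I 0 s →
           (∀ k s′ → k < n → I k s′ → I (suc k) (f k s′)) → I n (iter n f s)
iter-inv zero    I base next = base
iter-inv (suc n) I base next = next n _ ≤-refl (iter-inv n I base λ k s′ k<n → next k s′ (m≤n⇒m≤1+n k<n))

onZero-elim : {A : Set} (Q : A → Set) (v : ℕ) {x y : A} → (v ≡ 0 → Q x) → (v ≢ 0 → Q y) → Q (onZero v x y)
onZero-elim Q zero    z s = z refl
onZero-elim Q (suc v) z s = s λ ()

onZero-map : {A B : Set} (f : A → B) (v : ℕ) {x y : A} → f (onZero v x y) ≡ onZero v (f x) (f y)
onZero-map f zero    = refl
onZero-map f (suc v) = refl

gap≡0 : ∀ {a b} → a ≡ b → (a ∸ b) + (b ∸ a) ≡ 0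
gap≡0 {a} refl = cong₂ _+_ (n∸n≡0 a) (n∸n≡0 a)

gap≡0⁻¹ : ∀ {a b} → (a ∸ b) + (b ∸ a) ≡ 0 → a ≡ b
gap≡0⁻¹ {a} {b} eq = ≤-antisym (m∸n≡0⇒m≤n (m+n≡0⇒m≡0 (a ∸ b) eq)) (m∸n≡0⇒m≤n (m+n≡0⇒n≡0 (a ∸ b) eq))

module _ (n : ℕ) where

  frame : ∀ {d} (c : Cmd d) ρ s → Frame c s (run n c ρ s)
  frame skip            ρ s = frame-refl
  frame (set x e)       ρ s = framed (λ _ _ → refl) λ y k → ≔-miss (sc s) (not-≡ᵇ {x} {y} k)
    where
    not-≡ᵇ : ∀ {a b} → not (a ≡ᵇ b) ≡ true → a ≢ b
    not-≡ᵇ {a} k refl with a ≡ᵇ a | ≡ᵇ-true {a} refl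
    not-≡ᵇ () refl | _ | refl
  frame (write b r j e) ρ s = framed lemma λ _ _ → refl
    where
    lemma : ∀ a → not (b ≡ᵇ a) ≡ true → ar (run n (write b r j e) ρ s) a ≡ ar s a
    lemma a k with b ≡ᵇ a
    lemma a k  | false = refl
    lemma a () | true
  frame (c ⨾ c′)        ρ s = framed
    (λ a k → trans (arr (frame c′ ρ _) a (∧-trueʳ {keepsArr c a} k)) (arr (frame c ρ s) a (∧-trueˡ k)))
    (λ x k → trans (sca (frame c′ ρ _) x (∧-trueʳ {keepsScl c x} k)) (sca (frame c ρ s) x (∧-trueˡ k)))
  frame (ifz e c c′)    ρ s = onZero-elim (Frame (ifz e c c′) s) (evalᴱ n e ρ s)
    (λ _ → framed (λ a k → arr (frame c ρ s) a (∧-trueˡ k)) (λ x k → sca (frame c ρ s) x (∧-trueˡ k)))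
    (λ _ → framed (λ a k → arr (frame c′ ρ s) a (∧-trueʳ {keepsArr c a} k))
                  (λ x k → sca (frame c′ ρ s) x (∧-trueʳ {keepsScl c x} k)))
  frame {d} (for c)     ρ s = framed (arr all) (sca all)
    where
    all : Frame c s (run n (for c) ρ s)
    all = iter-inv n (λ _ → Frame c s) frame-refl λ k s′ _ fr → frame-trans fr (frame c (ρ [ d ≔ k ]) s′)

  for-inv : ∀ {d} (c : Cmd (suc d)) ρ s (I : ℕ → St → Set) → I 0 s →
            (∀ k s′ → k < n → Frame c s s′ → I k s′ → I (suc k) (run n c (ρ [ d ≔ k ]) s′)) →
            I n (run n (for c) ρ s)
  for-inv {d} c ρ s I base next = proj₂ (iter-inv n (λ k s′ → Frame c s s′ × I k s′) (frame-refl , base)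
    λ k s′ k<n (fr , i) → frame-trans fr (frame c (ρ [ d ≔ k ]) s′) , next k s′ k<n fr i)

  -- R describes component k before its own round and Q after it. Rounds for other components must
  -- preserve both, since they occur on either side of round k.
  sweep : ∀ {d} (c : Cmd (suc d)) ρ s (R Q : ℕ → St → Set) →
          (∀ k s′ → k < n → Frame c s s′ → R k s′ → Q k (run n c (ρ [ d ≔ k ]) s′)) →
          (∀ j k s′ → j < n → k < n → Frame c s s′ → k ≢ j → R j s′ → R j (run n c (ρ [ d ≔ k ]) s′)) →
          (∀ j k s′ → j < n → k < n → Frame c s s′ → k ≢ j → Q j s′ → Q j (run n c (ρ [ d ≔ k ]) s′)) →
          (∀ {k} → k < n → R k s) → ∀ {k} → k < n → Q k (run n (for c) ρ s)
  sweep {d} c ρ s R Q hit missR missQ base {k} k<n = proj₁ result k<n k<n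
    where
    I : ℕ → St → Set
    I k s′ = (∀ {j} → j < n → j < k → Q j s′) × (∀ {j} → j < n → k ≤ j → R j s′)
    result : I n (run n (for c) ρ s)
    result = for-inv c ρ s I ((λ _ ()) , λ j<n _ → base j<n)
      λ k s′ k<n fr (past , todo) →
        (λ {j} j<n j<1+k → case k ≟ j of λ
          { (yes refl) → hit k s′ k<n fr (todo k<n ≤-refl)
          ; (no k≢j)   → missQ j k s′ j<n k<n fr k≢j (past j<n (≤∧≢⇒< (s≤s⁻¹ j<1+k) (k≢j ∘ sym))) }) ,
        (λ {j} j<n k<j → missR j k s′ j<n k<n fr (<⇒≢ k<j) (todo j<n (<⇒≤ k<j)))

  fill-row : ∀ {d} (c : Cmd (suc d)) ρ s a r (g : ℕ → ℕ) →
    (∀ k s′ → k < n → Frame c s s′ → ar s′ a r k ≡ ar s a r k → ar (run n c (ρ [ d ≔ k ]) s′) a r k ≡ g k) →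
    (∀ j k s′ → j < n → k < n → k ≢ j → ar (run n c (ρ [ d ≔ k ]) s′) a r j ≡ ar s′ a r j) →
    ∀ {k} → k < n → ar (run n (for c) ρ s) a r k ≡ g k
  fill-row c ρ s a r g hit miss =
    sweep c ρ s (λ k s′ → ar s′ a r k ≡ ar s a r k) (λ k s′ → ar s′ a r k ≡ g k)
      hit
      (λ j k s′ j<n k<n fr k≢j eq → trans (miss j k s′ j<n k<n k≢j) eq)
      (λ j k s′ j<n k<n fr k≢j eq → trans (miss j k s′ j<n k<n k≢j) eq)
      (λ _ → refl)

  fill-grid : ∀ {d} (c : Cmd (2 + d)) ρ s a (g : ℕ → ℕ → ℕ) →
    (∀ i j s′ → i < n → j < n → Frame c s s′ → ar s′ a (suc i) j ≡ ar s a (suc i) j →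
      ar (run n c (ρ [ d ≔ i ] [ suc d ≔ j ]) s′) a (suc i) j ≡ g i j) →
    (∀ i j i′ j′ s′ → i < n → j < n → j′ < n → (i ≡ i′ → j ≢ j′) →
      ar (run n c (ρ [ d ≔ i ] [ suc d ≔ j ]) s′) a (suc i′) j′ ≡ ar s′ a (suc i′) j′) →
    ∀ {i j} → i < n → j < n → ar (run n (for (for c)) ρ s) a (suc i) j ≡ g i j
  fill-grid {d} c ρ s a g hit miss {j = j} i<n =
    sweep (for c) ρ s (λ i s′ → ∀ {j} → j < n → ar s′ a (suc i) j ≡ ar s a (suc i) j)
      (λ i s′ → ∀ {j} → j < n → ar s′ a (suc i) j ≡ g i j)
      (λ i s′ i<n fr R {j} j<n →
        fill-row c (ρ [ d ≔ i ]) s′ a (suc i) (g i)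
          (λ j s″ j<n fr′ eq → hit i j s″ i<n j<n
             (frame-trans {c = c} (framed (arr fr) (sca fr)) fr′) (trans eq (R j<n)))
          (λ j′ j s″ j′<n j<n j≢j′ → miss i j i j′ s″ i<n j<n j′<n λ _ → j≢j′)
          j<n)
      (λ i′ i s′ i′<n i<n fr i≢i′ R {j} j<n → trans (other-rows i i′ s′ i<n i≢i′ j<n) (R j<n))
      (λ i′ i s′ i′<n i<n fr i≢i′ Q {j} j<n → trans (other-rows i i′ s′ i<n i≢i′ j<n) (Q j<n))
      (λ _ _ → refl) i<n
    where
    other-rows : ∀ i i′ s′ → i < n → i ≢ i′ → ∀ {j} → j < n →
                 ar (run n (for c) (ρ [ d ≔ i ]) s′) a (suc i′) j ≡ ar s′ a (suc i′) j
    other-rows i i′ s′ i<n i≢i′ {j} j<n =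
      iter-inv n (λ _ s″ → ar s″ a (suc i′) j ≡ ar s′ a (suc i′) j) refl
        λ k s″ k<n eq → trans (miss i k i′ j s″ i<n k<n j<n λ i≡i′ → contradiction i≡i′ i≢i′) eq

-- Components of G − N(w)

-- The input (colours in the header row), closed neighbourhoods, weights,
-- distances, component labels, marks, light and heavy counts, the best set.
pattern aG = 0
pattern aN = 1
pattern aW = 2
pattern aD = 3
pattern aL = 4
pattern aM = 5
pattern aC₀ = 6
pattern aC₁ = 7
pattern aS = 8

col₀ : ∀ {d} → Exp (suc d)
col₀ = ix (# 0)

col₁ : ∀ {d} → Exp (2 + d)
col₁ = ix (# 1)

col₂ : ∀ {d} → Exp (3 + d)
col₂ = ix (# 2)

row₀ : ∀ {d} → Row (suc d)
row₀ = row (# 0)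

row₁ : ∀ {d} → Row (2 + d)
row₁ = row (# 1)

row₂ : ∀ {d} → Row (3 + d)
row₂ = row (# 2)

-- The absolute difference; it expresses equality in a language that can only test for zero.
gap : ∀ {d} → Exp d → Exp d → Exp d
gap e f = (e ⊖ f) ⊕ (f ⊖ e)

closure : Cmd 0
closure =
  for (for (ifz (gap col₀ col₁)
    (write aN row₀ col₁ (lit 1))
    (write aN row₀ col₁ (read aG row₀ col₁))))

mark-neighbours relabel : Cmd 2
mark-neighbours =
  for (ifz (read aN row₀ col₂)
        (ifz (read aN row₁ col₂) skip
          (write aM hdr (read aL hdr col₂) (lit 1)))
        skip)
relabel =
  for (ifz (read aM hdr (read aL hdr col₂)) skip (write aL hdr col₂ col₁))

-- Union by relabelling: x unites all classes that its free closed neighbourhood meets. Marking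
-- labels first, and relabelling afterwards, costs O(n) for each x, hence O(n²) for each w.
merge : Cmd 2
merge =
  ifz (read aN row₀ col₁)
    (for (write aM hdr col₂ (lit 0)) ⨾ mark-neighbours ⨾ relabel)
    skip

labels : Cmd 1
labels = for (write aL hdr col₁ col₁) ⨾ for merge

module _ (n : ℕ) (nb : ℕ → ℕ → ℕ) where

  Holds : (ℕ → ℕ → ℕ) → Set
  Holds table = ∀ {i j} → i < n → j < n → table (suc i) j ≡ nb i j

  closure-correct : ∀ ρ s → (∀ {i j} → i < n → j < n → onZero ((i ∸ j) + (j ∸ i)) 1 (ar s aG (suc i) j) ≡ nb i j) →
                    Holds (ar (run n closure ρ s) aN)
  closure-correct ρ s spec i<n j<n = trans
    (fill-grid n body ρ s aN (λ i j → onZero ((i ∸ j) + (j ∸ i)) 1 (ar s aG (suc i) j))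
      (λ i j s′ i<n j<n fr _ → trans (onZero-map (λ s → ar s aN (suc i) j) ((i ∸ j) + (j ∸ i)))
        (cong₂ (onZero ((i ∸ j) + (j ∸ i))) (put-hit n aN (suc i) j (ar s′) j<n)
          (trans (put-hit n aN (suc i) j (ar s′) j<n) (cong (λ f → f (suc i) j) (arr fr aG refl)))))
      (λ i j i′ j′ s′ i<n j<n j′<n ne → onZero-elim (λ s → ar s aN (suc i′) j′ ≡ ar s′ aN (suc i′) j′)
        ((i ∸ j) + (j ∸ i))
        (λ _ → put-miss n aN (suc i) j (ar s′) (λ _ eq → ne (suc-injective eq)))
        (λ _ → put-miss n aN (suc i) j (ar s′) (λ _ eq → ne (suc-injective eq))))
      i<n j<n)
    (spec i<n j<n)
    where
    body : Cmd 2
    body = ifz (gap col₀ col₁)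
      (write aN row₀ col₁ (lit 1))
      (write aN row₀ col₁ (read aG row₀ col₁))

  module _ (rs : Reflexive-Symmetric n nb) where

    open Reflexive-Symmetric rs

    conn-sym : ∀ {P u v} → Conn n nb P u v → Conn n nb P v u
    conn-sym = reverse λ (Px , Py , xy) → Py , Px , nb-sym (proj₁ Px) (proj₁ Py) xy

    record Separates (w : ℕ) (lab : ℕ → ℕ) : Set where
      field
        same→conn : ∀ {u v} → u < n → v < n → lab u ≡ lab v → Conn n nb (Free n nb w) u v
        conn→same : ∀ {u v} → Conn n nb (Free n nb w) u v → lab u ≡ lab v

    -- By `label~` a label is a vertex of the component it names, so different components never
    -- share one. `merged` bounds only one end of the edge; after n rounds it covers every edge.
    record Partial (w k : ℕ) (lab : ℕ → ℕ) : Set where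
      field
        label< : ∀ {y} → y < n → lab y < n
        label~ : ∀ {y} → y < n → Conn n nb (Free n nb w) y (lab y)
        merged : ∀ {x y} → x < k → x < n → y < n → nb w x ≡ 0 → nb w y ≡ 0 → nb x y ≢ 0 → lab x ≡ lab y

    open Partial

    partial-cong : ∀ {w k lab lab′} → (∀ {y} → y < n → lab′ y ≡ lab y) → Partial w k lab → Partial w k lab′
    partial-cong eq p = record
      { label< = λ y<n → subst (_< n) (sym (eq y<n)) (label< p y<n)
      ; label~ = λ y<n → subst (Conn n nb _ _) (sym (eq y<n)) (label~ p y<n)
      ; merged = λ x<k x<n y<n wx wy xy → trans (eq x<n) (trans (merged p x<k x<n y<n wx wy xy) (sym (eq y<n))) }

    module _ (ρ : Store) (x : ℕ) (w<n : ρ 0 < n) (x<n : x < n) (wx : nb (ρ 0) x ≡ 0) where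

      private
        w = ρ 0
        ρ′ = ρ [ 1 ≔ x ]

      record Marked (k : ℕ) (lab mark : ℕ → ℕ) : Set where
        field
          marks  : ∀ {y} → y < k → y < n → nb w y ≡ 0 → nb x y ≢ 0 → mark (lab y) ≢ 0
          marked : ∀ {l} → l < n → mark l ≢ 0 → ∃[ y ] y < n × nb w y ≡ 0 × nb x y ≢ 0 × lab y ≡ l

      open Marked

      mark-correct : ∀ s → Holds (ar s aN) → (∀ {y} → y < n → ar s aL 0 y < n) →
                     (∀ {l} → l < n → ar s aM 0 l ≡ 0) →
                     Marked n (ar s aL 0) (ar (run n mark-neighbours ρ′ s) aM 0)
      mark-correct s G bnd clear =
        for-inv n body ρ′ s (λ k s′ → Marked k lab (ar s′ aM 0))
          (record { marks = λ () ; marked = λ l<n m≢0 → contradiction (clear l<n) m≢0 })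
          mark-one
        where
        lab = ar s aL 0
        body : Cmd 3
        body = ifz (read aN row₀ col₂)
          (ifz (read aN row₁ col₂) skip
            (write aM hdr (read aL hdr col₂) (lit 1)))
          skip
        mark-one : ∀ k s′ → k < n → Frame body s s′ → Marked k lab (ar s′ aM 0) →
               Marked (suc k) lab (ar (run n body (ρ′ [ 2 ≔ k ]) s′) aM 0)
        mark-one k s′ k<n fr M rewrite arr fr aN refl | arr fr aL refl | G w<n k<n | G x<n k<n
          with nb w k in wk
        ... | suc _ = record
          { marks  = λ {y} y<1+k y<n wy → case y ≟ k of λ
              { (yes refl) → λ _ → contradiction (trans (sym wk) wy) λ ()
              ; (no y≢k)   → marks M (≤∧≢⇒< (s≤s⁻¹ y<1+k) y≢k) y<n wy }
          ; marked = marked M }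
        ... | zero with nb x k in xk
        ... | zero = record
          { marks  = λ {y} y<1+k y<n wy xy → case y ≟ k of λ
              { (yes refl) → contradiction xk xy
              ; (no y≢k)   → marks M (≤∧≢⇒< (s≤s⁻¹ y<1+k) y≢k) y<n wy xy }
          ; marked = marked M }
        ... | suc _ = record { marks = marks′ ; marked = marked′ }
          where
          mark′ = put n aM 0 (lab k) 1 (ar s′) aM 0
          hit : mark′ (lab k) ≡ 1
          hit = put-hit n aM 0 (lab k) (ar s′) (bnd k<n)
          marks′ : ∀ {y} → y < suc k → y < n → nb w y ≡ 0 → nb x y ≢ 0 → mark′ (lab y) ≢ 0
          marks′ {y} y<1+k y<n wy xy eq with lab k ≟ lab y
          ... | yes same = contradiction (trans (sym hit) (trans (cong mark′ same) eq)) λ ()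
          ... | no differ with y ≟ k
          ... | yes refl = differ refl
          ... | no y≢k   = marks M (≤∧≢⇒< (s≤s⁻¹ y<1+k) y≢k) y<n wy xy
                             (trans (sym (put-miss n aM 0 (lab k) (ar s′) λ _ _ → differ)) eq)
          marked′ : ∀ {l} → l < n → mark′ l ≢ 0 → ∃[ y ] y < n × nb w y ≡ 0 × nb x y ≢ 0 × lab y ≡ l
          marked′ {l} l<n m≢0 with lab k ≟ l
          ... | yes same  = k , k<n , wk , (λ eq → 0≢1+n (trans (sym eq) xk)) , same
          ... | no differ = marked M l<n λ eq → m≢0 (trans (put-miss n aM 0 (lab k) (ar s′) λ _ _ → differ) eq)

      relabel-value : ∀ s {y} → y < n →
        ar (run n relabel ρ′ s) aL 0 y ≡ onZero (ar s aM 0 (ar s aL 0 y)) (ar s aL 0 y) x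
      relabel-value s = fill-row n {2} (ifz (read aM hdr (read aL hdr col₂)) skip (write aL hdr col₂ col₁))
        ρ′ s aL 0 (λ y → onZero (ar s aM 0 (ar s aL 0 y)) (ar s aL 0 y) x)
        (λ k s′ k<n fr eq → trans (onZero-map (λ s → ar s aL 0 k) (ar s′ aM 0 (ar s′ aL 0 k)))
          (trans (cong (onZero (ar s′ aM 0 (ar s′ aL 0 k)) (ar s′ aL 0 k)) (put-hit n aL 0 k (ar s′) k<n))
            (cong₂ (λ z f → onZero (f 0 z) z x) eq (arr fr aM refl))))
        (λ j k s′ j<n k<n k≢j → onZero-elim (λ s → ar s aL 0 j ≡ ar s′ aL 0 j) (ar s′ aM 0 (ar s′ aL 0 k))
          (λ _ → refl) (λ _ → put-miss n aL 0 k (ar s′) λ _ _ → k≢j))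

      partial-relabel : ∀ {lab mark} → Partial w x lab → Marked n lab mark →
                        Partial w (suc x) (λ y → onZero (mark (lab y)) (lab y) x)
      partial-relabel {lab} {mark} P M = record
        { label< = λ {y} y<n → onZero-elim (_< n) (mark (lab y)) (λ _ → label< P y<n) (λ _ → x<n)
        ; label~ = λ {y} y<n → onZero-elim (Conn n nb _ y) (mark (lab y)) (λ _ → label~ P y<n) λ m≢0 →
            -- A marked label is shared with some free y′ in N(x), which links y to x through the
            -- common label and y′.
            case marked M (label< P y<n) m≢0 of λ { (y′ , y′<n , wy′ , xy′ , eq) →
              label~ P y<n ◅◅ conn-sym (subst (Conn n nb _ y′) eq (label~ P y′<n)) ◅◅
              ((y′<n , wy′) , (x<n , wx) , nb-sym x<n y′<n xy′) ◅ ε }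
        -- As `nb` is reflexive, x marks its own class too, so x and its free neighbours all end
        -- with label x. Edges of earlier rounds survive because equal labels are changed alike.
        ; merged = λ {z} {y} z<1+x z<n y<n wz wy zy → case z ≟ x of λ
            { (yes refl) → trans (new (marks M x<n x<n wx (nb-refl x<n))) (sym (new (marks M y<n y<n wy zy)))
            ; (no z≢x)   → cong (λ l → onZero (mark l) l x) (merged P (≤∧≢⇒< (s≤s⁻¹ z<1+x) z≢x) z<n y<n wz wy zy) } }
        where
        new : ∀ {m l} → m ≢ 0 → onZero m l x ≡ x
        new {zero}  m≢0 = contradiction refl m≢0
        new {suc m} _   = refl

    merge-correct : ∀ ρ x s → ρ 0 < n → x < n → Holds (ar s aN) → Partial (ρ 0) x (ar s aL 0) →
                    Partial (ρ 0) (suc x) (ar (run n merge (ρ [ 1 ≔ x ]) s) aL 0)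
    merge-correct ρ x s w<n x<n G P rewrite G w<n x<n with nb (ρ 0) x in wx
    ... | suc _ = record { label< = label< P ; label~ = label~ P ; merged = λ {z} z<1+x z<n y<n wz → case z ≟ x of λ
      { (yes refl) → λ _ _ → contradiction (trans (sym wz) wx) λ ()
      ; (no z≢x)   → merged P (≤∧≢⇒< (s≤s⁻¹ z<1+x) z≢x) z<n y<n wz } }
    ... | zero = partial-cong (λ y<n → trans (relabel-value ρ x w<n x<n wx s₂ y<n)
                   (cong (λ f → onZero (ar s₂ aM 0 (f 0 _)) (f 0 _) x) lab-eq))
                   (partial-relabel ρ x w<n x<n wx P
                     (subst (λ f → Marked ρ x w<n x<n wx n (f 0) (ar s₂ aM 0)) (arr (frame n clear ρ′ s) aL refl)
                      (mark-correct ρ x w<n x<n wx s₁ (subst Holds (sym (arr (frame n clear ρ′ s) aN refl)) G)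
                       (λ {y} y<n → subst (λ f → f 0 y < n) (sym (arr (frame n clear ρ′ s) aL refl)) (label< P y<n))
                       (fill-row n {2} (write aM hdr col₂ (lit 0)) ρ′ s aM 0 (λ _ → 0)
                         (λ k s′ k<n fr _ → put-hit n aM 0 k (ar s′) k<n)
                         (λ j k s′ j<n k<n k≢j → put-miss n aM 0 k (ar s′) λ _ _ → k≢j)))))
      where
      ρ′ = ρ [ 1 ≔ x ]
      clear : Cmd 2
      clear = for (write aM hdr col₂ (lit 0))
      s₁ = run n clear ρ′ s
      s₂ = run n mark-neighbours ρ′ s₁
      lab-eq : ar s₂ aL ≡ ar s aL
      lab-eq = trans (arr (frame n mark-neighbours ρ′ s₁) aL refl) (arr (frame n clear ρ′ s) aL refl)

    labels-correct : ∀ ρ s → ρ 0 < n → Holds (ar s aN) → Separates (ρ 0) (ar (run n labels ρ s) aL 0)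
    labels-correct ρ s w<n G = record
      { same→conn = λ u<n v<n eq → label~ final u<n ◅◅ conn-sym (subst (Conn n nb _ _) (sym eq) (label~ final v<n))
      ; conn→same = λ u⇝v → along u⇝v }
      where
      init : Cmd 1
      init = for (write aL hdr col₁ col₁)
      s₁ = run n init ρ s
      lab₁ : ∀ {y} → y < n → ar s₁ aL 0 y ≡ y
      lab₁ = fill-row n {1} (write aL hdr col₁ col₁) ρ s aL 0 (λ y → y)
        (λ k s′ k<n fr _ → put-hit n aL 0 k (ar s′) k<n)
        (λ j k s′ j<n k<n k≢j → put-miss n aL 0 k (ar s′) λ _ _ → k≢j)
      final : Partial (ρ 0) n (ar (run n labels ρ s) aL 0)
      final = for-inv n merge ρ s₁ (λ k s′ → Partial (ρ 0) k (ar s′ aL 0))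
        (partial-cong lab₁ record { label< = λ y<n → y<n ; label~ = λ _ → ε ; merged = λ () })
        λ k s′ k<n fr → merge-correct ρ k s′ w<n k<n
          (subst Holds (sym (trans (arr fr aN refl) (arr (frame n init ρ s) aN refl))) G)
      along : ∀ {u v} → Conn n nb (Free n nb (ρ 0)) u v → ar (run n labels ρ s) aL 0 u ≡ ar (run n labels ρ s) aL 0 v
      along ε = refl
      along (((x<n , wx) , (y<n , wy) , xy) ◅ p) = trans (merged final x<n x<n y<n wx wy xy) (along p)

pattern sBest = 0
pattern sFound = 1
pattern sU = 2
pattern sV = 3
pattern sRem = 4
pattern sCur = 5
pattern sNext = 6
pattern sNextRem = 7
pattern sCount = 8

-- Shortest walks, dominated sets and the choice of a pair

-- The invariant is indexed by the set of pairs already treated, and may always be weakened to a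
-- smaller set; a client therefore handles single pairs only and never the loop counters.
grid-inv : ∀ n {d} (c : Cmd (2 + d)) ρ s (Inv : (ℕ → ℕ → Set) → St → Set) →
  (∀ {P Q s′} → (∀ {u v} → v < n → Q u v → P u v) → Inv P s′ → Inv Q s′) →
  Inv (λ _ _ → ⊥) s →
  (∀ P i j s′ → i < n → j < n → Frame c s s′ → Inv P s′ →
    Inv (λ u v → P u v ⊎ u ≡ i × v ≡ j) (run n c (ρ [ d ≔ i ] [ suc d ≔ j ]) s′)) →
  Inv (λ u _ → u < n) (run n (for (for c)) ρ s)
grid-inv n {d} c ρ s Inv weaken base next =
  for-inv n (for c) ρ s (λ i → Inv (λ u _ → u < i)) (weaken (λ _ ()) base)
    λ i s′ i<n fr inv → weaken
      (λ {u} v<n u<1+i → case u ≟ i of λ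
        { (yes u≡i) → inj₂ (u≡i , v<n) ; (no u≢i) → inj₁ (≤∧≢⇒< (s≤s⁻¹ u<1+i) u≢i) })
      (for-inv n c (ρ [ d ≔ i ]) s′ (λ j → Inv (λ u v → u < i ⊎ u ≡ i × v < j))
        (weaken (λ { _ (inj₁ p) → p ; _ (inj₂ (_ , ())) }) inv)
        λ j s″ j<n fr′ inv′ → weaken
          (λ { _ (inj₁ p) → inj₁ (inj₁ p)
             ; {v = v} _ (inj₂ (p , v<1+j)) → case v ≟ j of λ
                 { (yes v≡j) → inj₂ (p , v≡j) ; (no v≢j) → inj₁ (inj₂ (p , ≤∧≢⇒< (s≤s⁻¹ v<1+j) v≢j)) } })
          (next _ i j s″ i<n j<n (frame-trans {c = c} (framed (arr fr) (sca fr)) fr′) inv′))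

-- The colour c is counted as heavy: red for true, blue for false.
tint : Bool → ℕ → ℕ
tint true  x = 1 ∸ x
tint false x = x

tintᴱ : ∀ {d} → Bool → Exp d → Exp d
tintᴱ true  e = lit 1 ⊖ read aG hdr e
tintᴱ false e = read aG hdr e

tintᴱ-value : ∀ {n d} c (e : Exp d) ρ s → evalᴱ n (tintᴱ c e) ρ s ≡ tint c (ar s aG 0 (evalᴱ n e ρ s))
tintᴱ-value true  e ρ s = refl
tintᴱ-value false e ρ s = refl

set-weight : Bool → Cmd 1
set-weight c = ifz (tintᴱ c col₀) (write aW hdr col₀ (size ⊕ lit 1)) (write aW hdr col₀ (lit 1))

set-distance : Cmd 2
set-distance =
  ifz (read aN row₀ col₁)
    (write aD row₀ col₁ (area ⊕ size ⊕ lit 1))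
    (ifz (gap col₀ col₁)
      (write aD row₀ col₁ (lit 0))
      (write aD row₀ col₁ (read aW hdr col₁)))

relax : Cmd 3
relax =
  ifz (read aD row₁ col₂ ⊖ (read aD row₁ col₀ ⊕ read aD row₀ col₂))
    skip
    (write aD row₁ col₂ (read aD row₁ col₀ ⊕ read aD row₀ col₂))

distances : Bool → Cmd 0
distances c = for (set-weight c) ⨾ for (for set-distance) ⨾ for (for (for relax))

-- With the labels of G - N(w) in place, this vanishes exactly when u and v lie in one component of
-- G - N(w), that is, when w is not in D(u, v).
outside : ∀ {d} → Exp (suc d) → Exp (suc d) → Exp (suc d)
outside u v = read aN row₀ u ⊕ gap (read aL hdr u) (read aL hdr v)

tally : Bool → Cmd 3
tally c =
  ifz (outside col₁ col₂) skip
    (ifz (tintᴱ c col₀)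
      (write aC₁ row₁ col₂ (read aC₁ row₁ col₂ ⊕ (size ⊕ lit 1)))
      (write aC₀ row₁ col₂ (read aC₀ row₁ col₂ ⊕ (size ⊕ lit 1))))

reset : Cmd 2
reset = write aC₀ row₀ col₁ (lit 0) ⨾ write aC₁ row₀ col₁ (lit 0)

counts : Bool → Cmd 0
counts c = for (for reset) ⨾ for (labels ⨾ for (for (tally c)))

onZero-cong : ∀ {A : Set} {v w} {x y : A} → (v ≡ 0 → w ≡ 0) → (w ≡ 0 → v ≡ 0) → onZero v x y ≡ onZero w x y
onZero-cong {v = zero}  {zero}  f g = refl
onZero-cong {v = zero}  {suc w} f g = contradiction (f refl) λ ()
onZero-cong {v = suc v} {zero}  f g = contradiction (g refl) λ ()
onZero-cong {v = suc v} {suc w} f g = refl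

-- The two truncated differences vanish together exactly for the acceptable pairs. `read aW` adds
-- the first vertex, which distances omit. Only a strictly larger count is kept, so a solution of
-- the earlier phase yields only to a better one.
keep try : Cmd 2
keep =
  set sBest (read aC₀ row₀ col₁) ⨾
  set sU col₀ ⨾ set sV col₁ ⨾
  set sRem (read aD row₀ col₁) ⨾ set sFound (lit 1)
try =
  ifz ((read aC₀ row₀ col₁ ⊖ read aC₁ row₀ col₁) ⊕
       ((read aD row₀ col₁ ⊕ read aW hdr col₀) ⊖ (read aC₀ row₀ col₁ ⊕ size)))
    (ifz (read aC₀ row₀ col₁ ⊖ var sBest) skip keep)
    skip

scan : Cmd 0
scan = set sFound (lit 0) ⨾ for (for try)

-- No predecessors are stored: a neighbour x of the current vertex continues a shortest walk exactly
-- when its weight plus its distance to the target equals the remaining distance.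
find : Cmd 3
find =
  ifz (read aN row₂ (var sCur)) skip
    (ifz (gap (var sRem) (read aW hdr col₂ ⊕ read aD row₂ (var sV)))
      (set sNext col₂ ⨾ set sNextRem (read aD row₂ (var sV)))
      skip)

advance : Cmd 2
advance =
  ifz (var sRem) skip
    (for find ⨾ set sCur (var sNext) ⨾ set sRem (var sNextRem) ⨾ write aS hdr (var sCur) (lit 1))

-- The remaining distance starts below 3 n² and drops in every step.
trace : Cmd 0
trace =
  for (write aS hdr col₀ (lit 0)) ⨾
  set sCur (var sU) ⨾ write aS hdr (var sCur) (lit 1) ⨾
  for (for (advance ⨾ advance ⨾ advance))

count-one : Bool → Cmd 1
count-one c =
  ifz (read aS hdr col₀) skip
    (ifz (tintᴱ c col₀) (set sCount (var sCount ⊕ (size ⊕ lit 1))) skip)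

extend : Bool → Cmd 1
extend c =
  ifz (outside (var sU) (var sV)) skip
    (ifz (read aS hdr col₀)
      (ifz (tintᴱ c col₀)
        (ifz (var sBest ⊖ var sCount) skip
          (write aS hdr col₀ (lit 1) ⨾ set sCount (var sCount ⊕ (size ⊕ lit 1))))
        (write aS hdr col₀ (lit 1)))
      skip)

-- All w share a single row of labels, so the labels are computed afresh for each vertex; n
-- labellings still fit into cubic time.
fill : Bool → Cmd 0
fill c = set sCount (lit 0) ⨾ for (count-one c) ⨾ for (labels ⨾ extend c)

phase : Bool → Cmd 0
phase c = distances c ⨾ counts c ⨾ scan ⨾ ifz (var sFound) skip (trace ⨾ fill c)

opaque
  program : Cmd 0
  program =
    closure ⨾ for (write aS hdr col₀ (lit 0)) ⨾ phase true ⨾ phase false ⨾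
    for (write aG hdr col₀ (read aS hdr col₀))

  depth-program : depth program ≡ 3
  depth-program = refl

Acceptable : ℕ → (L H D : ℕ → ℕ → ℕ) → (ℕ → ℕ) → ℕ → ℕ → Set
Acceptable n L H D W u v = L u v ≤ H u v × D u v + W u ≤ L u v + n

-- `sBest` is carried over from the earlier phase. `idle` lets the solution of that phase stand when
-- nothing larger is found.
record Scanned (n : ℕ) (L H D : ℕ → ℕ → ℕ) (W : ℕ → ℕ) (s : St) (P : ℕ → ℕ → Set) (s′ : St) : Set where
  field
    covers : ∀ {u v} → u < n → v < n → P u v → Acceptable n L H D W u v → L u v ≤ sc s′ sBest
    grows  : sc s sBest ≤ sc s′ sBest
    idle   : sc s′ sFound ≡ 0 → sc s′ sBest ≡ sc s sBest
    found  : sc s′ sFound ≢ 0 → sc s′ sU < n × sc s′ sV < n ×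
             Acceptable n L H D W (sc s′ sU) (sc s′ sV) ×
             sc s′ sBest ≡ L (sc s′ sU) (sc s′ sV) × sc s′ sRem ≡ D (sc s′ sU) (sc s′ sV)

open Scanned

scan-correct : ∀ n ρ s → Scanned n (λ u → ar s aC₀ (suc u)) (λ u → ar s aC₁ (suc u)) (λ u → ar s aD (suc u))
  (ar s aW 0) s (λ u _ → u < n) (run n scan ρ s)
scan-correct n ρ s = grid-inv n try ρ (run n (set {0} sFound (lit 0)) ρ s) (Scanned n L H D W s)
  (λ imp S → record { covers = λ u<n v<n q → covers S u<n v<n (imp v<n q) ; grows = grows S ; idle = idle S ; found = found S })
  (record { covers = λ _ _ () ; grows = ≤-refl ; idle = λ _ → refl ; found = λ ne → contradiction refl ne })
  next
  where
  L H D : ℕ → ℕ → ℕ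
  L u = ar s aC₀ (suc u)
  H u = ar s aC₁ (suc u)
  D u = ar s aD (suc u)
  W = ar s aW 0
  next : ∀ P i j s′ → i < n → j < n → Frame try (run n (set {0} sFound (lit 0)) ρ s) s′ → Scanned n L H D W s P s′ →
         Scanned n L H D W s (λ u v → P u v ⊎ u ≡ i × v ≡ j) (run n try (ρ [ 0 ≔ i ] [ 1 ≔ j ]) s′)
  next P i j s′ i<n j<n fr S rewrite arr fr aC₀ refl | arr fr aC₁ refl | arr fr aD refl | arr fr aW refl
    with (L i j ∸ H i j) + ((D i j + W i) ∸ (L i j + n)) in test
  ... | suc _ = record { grows = grows S ; idle = idle S ; found = found S ; covers = λ
          { u<n v<n (inj₁ p) acc → covers S u<n v<n p acc
          ; u<n v<n (inj₂ (refl , refl)) (l≤h , d≤l) → contradiction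
              (trans (sym test) (cong₂ _+_ (m≤n⇒m∸n≡0 l≤h) (m≤n⇒m∸n≡0 d≤l))) λ () } }
  ... | zero with L i j ∸ sc s′ sBest in better
  ... | zero = record { grows = grows S ; idle = idle S ; found = found S ; covers = λ
          { u<n v<n (inj₁ p) acc → covers S u<n v<n p acc
          ; u<n v<n (inj₂ (refl , refl)) _ → m∸n≡0⇒m≤n better } }
  ... | suc _ = record
          { grows  = ≤-trans (grows S) best≤
          ; idle   = λ ()
          ; found  = λ _ → i<n , j<n ,
              (m∸n≡0⇒m≤n (m+n≡0⇒m≡0 (L i j ∸ H i j) test) ,
               m∸n≡0⇒m≤n (m+n≡0⇒n≡0 (L i j ∸ H i j) test)) , refl , refl
          ; covers = λ
              { u<n v<n (inj₁ p) acc → ≤-trans (covers S u<n v<n p acc) best≤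
              ; u<n v<n (inj₂ (refl , refl)) _ → ≤-refl } }
    where
    best≤ : sc s′ sBest ≤ L i j
    best≤ = <⇒≤ (m∸n≢0⇒n<m λ eq → 0≢1+n (trans (sym eq) better))

-- Correctness of the program relative to a domination function.

module Model (n : ℕ) (nb : ℕ → ℕ → ℕ) (rs : Reflexive-Symmetric n nb) (col : ℕ → ℕ) (dom : ℕ → ℕ → ℕ → ℕ)
  (dom-spec : ∀ {w u v} → w < n → u < n → v < n →
    (dom w u v ≡ 0 → nb w u ≡ 0 × Conn n nb (Free n nb w) u v) ×
    (nb w u ≡ 0 → Conn n nb (Free n nb w) u v → dom w u v ≡ 0)) where

  open Reflexive-Symmetric rs

  record Base (s : St) : Set where
    field
      graph  : Holds n nb (ar s aN)
      colour : ∀ {x} → x < n → ar s aG 0 x ≡ col x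

  open Base

  base-frame : ∀ {d} (c : Cmd d) ρ {s} → keepsArr c aN ≡ true → keepsArr c aG ≡ true →
               Base s → Base (run n c ρ s)
  base-frame c ρ {s} kN kG B = record
    { graph  = subst (Holds n nb) (sym (arr (frame n c ρ s) aN kN)) (graph B)
    ; colour = λ {x} x<n → trans (cong (λ f → f 0 x) (arr (frame n c ρ s) aG kG)) (colour B x<n) }

  -- Vertices are counted in multiples of M, since the machine cannot multiply.
  -- No acceptable walk weighs more than n M + n, so ∞ is out of reach.
  M ∞ : ℕ
  M = n + 1
  ∞ = suc n * n + n + 1

  heavy light : Bool → ℕ → ℕ → ℕ
  heavy c u v = sumTo n (λ w → when (dom w u v) (unless (tint c (col w)) M))
  light c u v = sumTo n (λ w → when (dom w u v) (when (tint c (col w)) M))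

  weight : Bool → ℕ → ℕ
  weight c x = onZero (tint c (col x)) M 1

  weight-pos : ∀ c x → 0 < weight c x
  weight-pos c x with tint c (col x)
  ... | zero  = m≤n+m 1 n
  ... | suc _ = ≤-refl

  Table : (ℕ → ℕ → ℕ) → ℕ → ℕ → ℕ
  Table t i j = t (suc i) j

  module _ (c : Bool) where

    private
      wt = weight c

    IsDist : (ℕ → ℕ → ℕ) → Set
    IsDist = IsDistance n nb wt rs (weight-pos c) ∞

    weights-correct : ∀ ρ s → Base s → ∀ {x} → x < n → ar (run n (for (set-weight c)) ρ s) aW 0 x ≡ wt x
    weights-correct ρ s B = fill-row n (set-weight c) ρ s aW 0 wt
      (λ k s′ k<n fr _ → trans (onZero-map (λ s → ar s aW 0 k) (evalᴱ n (tintᴱ c col₀) (ρ [ 0 ≔ k ]) s′))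
        (trans (cong₂ (onZero (evalᴱ n (tintᴱ c col₀) (ρ [ 0 ≔ k ]) s′))
                 (put-hit n aW 0 k (ar s′) k<n) (put-hit n aW 0 k (ar s′) k<n))
          (cong (λ z → onZero z M 1) (trans (tintᴱ-value {n} c col₀ (ρ [ 0 ≔ k ]) s′)
            (cong (tint c) (trans (cong (λ f → f 0 k) (arr fr aG refl)) (colour B k<n)))))))
      (λ j k s′ j<n k<n k≢j → onZero-elim (λ s → ar s aW 0 j ≡ ar s′ aW 0 j) (evalᴱ n (tintᴱ c col₀) (ρ [ 0 ≔ k ]) s′)
        (λ _ → put-miss n aW 0 k (ar s′) λ _ _ → k≢j) (λ _ → put-miss n aW 0 k (ar s′) λ _ _ → k≢j))

    start-distance : ℕ → ℕ → ℕ
    start-distance i j = onZero (nb i j) ∞ (onZero ((i ∸ j) + (j ∸ i)) 0 (wt j))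

    start-correct : ∀ ρ s → Base s → (∀ {x} → x < n → ar s aW 0 x ≡ wt x) →
                    ∀ {i j} → i < n → j < n → ar (run n (for (for set-distance)) ρ s) aD (suc i) j ≡ start-distance i j
    start-correct ρ s B W = fill-grid n set-distance ρ s aD start-distance
      (λ i j s′ i<n j<n fr _ → hit i j s′ i<n j<n fr)
      (λ i j i′ j′ s′ i<n j<n j′<n ne → onZero-elim (λ s → ar s aD (suc i′) j′ ≡ ar s′ aD (suc i′) j′) (ar s′ aN (suc i) j)
        (λ _ → put-miss n aD (suc i) j (ar s′) λ _ eq → ne (suc-injective eq))
        (λ _ → onZero-elim (λ s → ar s aD (suc i′) j′ ≡ ar s′ aD (suc i′) j′) ((i ∸ j) + (j ∸ i))
          (λ _ → put-miss n aD (suc i) j (ar s′) λ _ eq → ne (suc-injective eq))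
          (λ _ → put-miss n aD (suc i) j (ar s′) λ _ eq → ne (suc-injective eq))))
      where
      hit : ∀ i j s′ → i < n → j < n → Frame set-distance s s′ →
            ar (run n set-distance (ρ [ 0 ≔ i ] [ 1 ≔ j ]) s′) aD (suc i) j ≡ start-distance i j
      hit i j s′ i<n j<n fr rewrite arr fr aN refl | graph B i<n j<n with nb i j
      ... | zero = put-hit n aD (suc i) j (ar s′) j<n
      ... | suc _ with (i ∸ j) + (j ∸ i)
      ... | zero  = put-hit n aD (suc i) j (ar s′) j<n
      ... | suc _ = trans (put-hit n aD (suc i) j (ar s′) j<n) (trans (cong (λ f → f 0 j) (arr fr aW refl)) (W j<n))

    -- Entries of at least ∞ assert nothing, so sums that involve ∞ need no special treatment in
    -- `relax`.
    Sound : (ℕ → ℕ → ℕ) → Set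
    Sound D = ∀ {i j} → i < n → j < n → D i j < ∞ → Walk n nb wt i j (D i j)

    Complete : ℕ → (ℕ → ℕ → ℕ) → Set
    Complete k D = ∀ {i j c} → i < n → j < n → Path n nb wt k i j c → D i j ≤ c

    -- The table is updated in place, so row and column k may change within a round. They only
    -- decrease, so comparison with the entries D from the start of the round is enough.
    record Relaxed (k : ℕ) (D : ℕ → ℕ → ℕ) (P : ℕ → ℕ → Set) (D′ : ℕ → ℕ → ℕ) : Set where
      field
        sound  : Sound D′
        below  : ∀ {i j} → i < n → j < n → D′ i j ≤ D i j
        short  : ∀ {i j} → i < n → j < n → P i j → D′ i j ≤ D i k + D k j

    open Relaxed

    relax-correct : ∀ k ρ s → k < n → Sound (Table (ar s aD)) →
      Relaxed k (Table (ar s aD)) (λ u _ → u < n) (Table (ar (run n (for (for relax)) (ρ [ 0 ≔ k ]) s) aD))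
    relax-correct k ρ s k<n snd = grid-inv n relax (ρ [ 0 ≔ k ]) s
      (λ P s′ → Relaxed k D₀ P (Table (ar s′ aD)))
      (λ imp R → record { sound = sound R ; below = below R ; short = λ i<n j<n q → short R i<n j<n (imp j<n q) })
      (record { sound = snd ; below = λ _ _ → ≤-refl ; short = λ _ _ () })
      λ P i j s′ i<n j<n fr R → relax-one P i j s′ i<n j<n R
      where
      D₀ = Table (ar s aD)
      relax-one : ∀ P i j s′ → i < n → j < n → Relaxed k D₀ P (Table (ar s′ aD)) →
        Relaxed k D₀ (λ u v → P u v ⊎ u ≡ i × v ≡ j) (Table (ar (run n relax (ρ [ 0 ≔ k ] [ 1 ≔ i ] [ 2 ≔ j ]) s′) aD))
      relax-one P i j s′ i<n j<n R = onZero-elim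
        (λ s → Relaxed k D₀ (λ u v → P u v ⊎ u ≡ i × v ≡ j) (Table (ar s aD)))
        (D i j ∸ (D i k + D k j))
        (λ eq → record
          { sound = sound R ; below = below R
          ; short = λ { u<n v<n (inj₁ p) → short R u<n v<n p
                      ; u<n v<n (inj₂ (refl , refl)) → ≤-trans (m∸n≡0⇒m≤n eq) new≤ } })
        (λ ne → record { sound = sound′ ; below = λ u<n v<n → ≤-trans (shrinks ne u<n v<n) (below R u<n v<n)
                       ; short = short′ ne })
        where
        D = Table (ar s′ aD)
        new = D i k + D k j
        new≤ : new ≤ D₀ i k + D₀ k j
        new≤ = +-mono-≤ (below R i<n k<n) (below R k<n j<n)
        D′ = Table (put n aD (suc i) j new (ar s′) aD)
        hit : D′ i j ≡ new
        hit = put-hit n aD (suc i) j (ar s′) j<n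
        miss : ∀ {u v} → ¬ (u ≡ i × v ≡ j) → D′ u v ≡ D u v
        miss ne = put-miss n aD (suc i) j (ar s′) λ { _ refl refl → ne (refl , refl) }
        same? : ∀ u v → Dec (u ≡ i × v ≡ j)
        same? u v with u ≟ i | v ≟ j
        ... | yes p | yes q = yes (p , q)
        ... | no ¬p | _     = no (¬p ∘ proj₁)
        ... | _     | no ¬q = no (¬q ∘ proj₂)
        sound′ : Sound D′
        sound′ {u} {v} u<n v<n fin with same? u v
        ... | no ne = subst (Walk n nb wt u v) (sym (miss ne)) (sound R u<n v<n (subst (_< ∞) (miss ne) fin))
        ... | yes (refl , refl) = subst (Walk n nb wt u v) (sym hit)
          (_++ʷ_ n nb wt (sound R i<n k<n (≤-<-trans (m≤m+n _ _) fin′)) (sound R k<n j<n (≤-<-trans (m≤n+m _ _) fin′)))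
          where fin′ = subst (_< ∞) hit fin
        shrinks : D i j ∸ new ≢ 0 → ∀ {u v} → u < n → v < n → D′ u v ≤ D u v
        shrinks ne {u} {v} u<n v<n with same? u v
        ... | no ne′ = ≤-reflexive (miss ne′)
        ... | yes (refl , refl) = ≤-trans (≤-reflexive hit) (<⇒≤ (m∸n≢0⇒n<m ne))
        short′ : D i j ∸ new ≢ 0 → ∀ {u v} → u < n → v < n → P u v ⊎ u ≡ i × v ≡ j → D′ u v ≤ D₀ u k + D₀ k v
        short′ ne u<n v<n (inj₁ p) = ≤-trans (shrinks ne u<n v<n) (short R u<n v<n p)
        short′ ne u<n v<n (inj₂ (refl , refl)) = ≤-trans (≤-reflexive hit) new≤

    floyd-warshall : ∀ ρ s → Sound (Table (ar s aD)) → Complete 0 (Table (ar s aD)) →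
                     IsDist (Table (ar (run n (for (for (for relax))) ρ s) aD))
    floyd-warshall ρ s snd cmp = record { sound = proj₁ final ; complete = proj₂ final }
      where
      final = for-inv n (for (for relax)) ρ s (λ k s′ → Sound (Table (ar s′ aD)) × Complete k (Table (ar s′ aD)))
        (snd , cmp)
        λ k s′ k<n fr (snd′ , cmp′) →
          let R = relax-correct k ρ s′ k<n snd′ in
          sound R , λ i<n j<n p → case path-split n nb wt p of λ
            { (inj₁ q) → ≤-trans (below R i<n j<n) (cmp′ i<n j<n q)
            ; (inj₂ (c₁ , c₂ , q₁ , q₂ , le)) → ≤-trans (short R i<n j<n i<n)
                (≤-trans (+-mono-≤ (cmp′ i<n k<n q₁) (cmp′ k<n j<n q₂)) le) }

    distances-correct : ∀ ρ s → Base s → let s′ = run n (distances c) ρ s in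
                        (∀ {x} → x < n → ar s′ aW 0 x ≡ wt x) × IsDist (Table (ar s′ aD))
    distances-correct ρ s B =
      (λ {x} x<n → trans (cong (λ f → f 0 x) (trans (arr (frame n (for (for (for relax))) ρ s₂) aW refl) W₂)) (W x<n)) ,
      floyd-warshall ρ s₂
        (λ i<n j<n fin → subst (Walk n nb wt _ _) (sym (initially i<n j<n))
          (start-sound i<n j<n (subst (_< ∞) (initially i<n j<n) fin)))
        (λ i<n j<n p → ≤-trans (≤-reflexive (initially i<n j<n)) (start-complete i<n j<n p))
      where
      s₁ = run n (for (set-weight c)) ρ s
      s₂ = run n (for (for set-distance)) ρ s₁
      W : ∀ {x} → x < n → ar s₁ aW 0 x ≡ wt x
      W = weights-correct ρ s B
      W₂ : ar s₂ aW ≡ ar s₁ aW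
      W₂ = arr (frame n (for (for set-distance)) ρ s₁) aW refl
      initially : ∀ {i j} → i < n → j < n → Table (ar s₂ aD) i j ≡ start-distance i j
      initially = start-correct ρ s₁ (base-frame (for (set-weight c)) ρ refl refl B) W
      start-sound : Sound start-distance
      start-sound {i} {j} i<n j<n fin with nb i j in eq
      ... | zero = contradiction fin (<-irrefl refl)
      ... | suc _ with (i ∸ j) + (j ∸ i) in eq′
      ... | zero  = subst (λ z → Walk n nb wt i z 0) (gap≡0⁻¹ {i} eq′) here
      ... | suc _ = edge j<n λ eq″ → 0≢1+n (trans (sym eq″) eq)
      start-complete : Complete 0 start-distance
      start-complete {i} i<n _ here rewrite gap≡0 {i} refl with nb i i in eq
      ... | zero  = contradiction eq (nb-refl i<n)
      ... | suc _ = z≤n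
      start-complete {i} {j} _ _ (edge _ ij) with nb i j
      ... | zero  = contradiction refl ij
      ... | suc _ with (i ∸ j) + (j ∸ i)
      ... | zero  = z≤n
      ... | suc _ = ≤-refl

    outside-zero : ∀ {w u v lab} → w < n → u < n → v < n → Separates n nb rs w lab →
      let out = nb w u + ((lab u ∸ lab v) + (lab v ∸ lab u)) in
      (out ≡ 0 → dom w u v ≡ 0) × (dom w u v ≡ 0 → out ≡ 0)
    outside-zero {w} {u} {v} {lab} w<n u<n v<n sep =
      (λ eq → proj₂ (dom-spec w<n u<n v<n) (m+n≡0⇒m≡0 (nb w u) eq)
                (Separates.same→conn sep u<n v<n (gap≡0⁻¹ {lab u} (m+n≡0⇒n≡0 (nb w u) eq)))) ,
      (λ eq → let (wu , p) = proj₁ (dom-spec w<n u<n v<n) eq in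
                cong₂ _+_ wu (gap≡0 (Separates.conn→same sep p)))

    tally-correct : ∀ ρ s → ρ 0 < n → Base s → Separates n nb rs (ρ 0) (ar s aL 0) →
      let s′ = run n (for (for (tally c))) ρ s ; w = ρ 0 in
      (∀ {u v} → u < n → v < n → ar s′ aC₀ (suc u) v ≡ ar s aC₀ (suc u) v + when (dom w u v) (when (tint c (col w)) M)) ×
      (∀ {u v} → u < n → v < n → ar s′ aC₁ (suc u) v ≡ ar s aC₁ (suc u) v + when (dom w u v) (unless (tint c (col w)) M))
    tally-correct ρ s w<n B sep =
      fill-grid n (tally c) ρ s aC₀ _
        (λ i j s′ i<n j<n fr eq → trans (trans (hit₀ i j s′ i<n j<n)
           (cong₂ _+_ eq (cong₂ when (out-frame i j s′ fr) (cong (λ z → when z M) (tint-frame i j s′ fr)))))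
           (cong (ar s aC₀ (suc i) j +_) (when-dom i<n j<n)))
        (λ i j i′ j′ s′ i<n j<n j′<n ne → onZero-elim (λ s → ar s aC₀ (suc i′) j′ ≡ ar s′ aC₀ (suc i′) j′) (out i j s′)
          (λ _ → refl)
          (λ _ → onZero-elim (λ s → ar s aC₀ (suc i′) j′ ≡ ar s′ aC₀ (suc i′) j′) (tnt i j s′)
            (λ _ → refl)
            (λ _ → put-miss n aC₀ (suc i) j (ar s′) λ _ eq → ne (suc-injective eq)))) ,
      fill-grid n (tally c) ρ s aC₁ _
        (λ i j s′ i<n j<n fr eq → trans (trans (hit₁ i j s′ i<n j<n)
           (cong₂ _+_ eq (cong₂ when (out-frame i j s′ fr) (cong (λ z → unless z M) (tint-frame i j s′ fr)))))
           (cong (ar s aC₁ (suc i) j +_) (when-dom i<n j<n)))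
        (λ i j i′ j′ s′ i<n j<n j′<n ne → onZero-elim (λ s → ar s aC₁ (suc i′) j′ ≡ ar s′ aC₁ (suc i′) j′) (out i j s′)
          (λ _ → refl)
          (λ _ → onZero-elim (λ s → ar s aC₁ (suc i′) j′ ≡ ar s′ aC₁ (suc i′) j′) (tnt i j s′)
            (λ _ → put-miss n aC₁ (suc i) j (ar s′) λ _ eq → ne (suc-injective eq))
            (λ _ → refl)))
      where
      w = ρ 0
      env : ℕ → ℕ → Store
      env i j = ρ [ 1 ≔ i ] [ 2 ≔ j ]
      out tnt : ℕ → ℕ → St → ℕ
      out i j s = evalᴱ n {3} (outside col₁ col₂) (env i j) s
      tnt i j s = evalᴱ n {3} (tintᴱ c col₀) (env i j) s
      hit₀ : ∀ i j s′ → i < n → j < n →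
        ar (run n (tally c) (env i j) s′) aC₀ (suc i) j ≡ ar s′ aC₀ (suc i) j + when (out i j s′) (when (tnt i j s′) M)
      hit₀ i j s′ i<n j<n with out i j s′
      ... | zero = sym (+-identityʳ _)
      ... | suc _ with tnt i j s′
      ... | zero  = sym (+-identityʳ _)
      ... | suc _ = put-hit n aC₀ (suc i) j (ar s′) j<n
      hit₁ : ∀ i j s′ → i < n → j < n →
        ar (run n (tally c) (env i j) s′) aC₁ (suc i) j ≡ ar s′ aC₁ (suc i) j + when (out i j s′) (unless (tnt i j s′) M)
      hit₁ i j s′ i<n j<n with out i j s′
      ... | zero = sym (+-identityʳ _)
      ... | suc _ with tnt i j s′
      ... | zero  = put-hit n aC₁ (suc i) j (ar s′) j<n
      ... | suc _ = sym (+-identityʳ _)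
      out-frame : ∀ i j s′ → Frame (tally c) s s′ → out i j s′ ≡ out i j s
      out-frame i j s′ fr rewrite arr fr aN refl | arr fr aL refl = refl
      tint-frame : ∀ i j s′ → Frame (tally c) s s′ → tnt i j s′ ≡ tint c (col w)
      tint-frame i j s′ fr = trans (tintᴱ-value {n} {3} c col₀ (env i j) s′)
        (cong (tint c) (trans (cong (λ f → f 0 w) (arr fr aG refl)) (colour B w<n)))
      when-dom : ∀ {i j v} → i < n → j < n → when (out i j s) v ≡ when (dom w i j) v
      when-dom {i} {j} {v} i<n j<n = onZero-cong (proj₁ zeros ∘ trans (sym eq)) (trans eq ∘ proj₂ zeros)
        where
        zeros = outside-zero w<n i<n j<n sep
        lab = ar s aL 0
        eq : out i j s ≡ nb w i + ((lab i ∸ lab j) + (lab j ∸ lab i))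
        eq = cong (_+ ((lab i ∸ lab j) + (lab j ∸ lab i))) (graph B w<n i<n)

    counts-correct : ∀ ρ s → Base s → let s′ = run n (counts c) ρ s in
      (∀ {u v} → u < n → v < n → ar s′ aC₀ (suc u) v ≡ light c u v) ×
      (∀ {u v} → u < n → v < n → ar s′ aC₁ (suc u) v ≡ heavy c u v)
    counts-correct ρ s B = for-inv n body ρ s₁
      (λ k s′ → (∀ {u v} → u < n → v < n → ar s′ aC₀ (suc u) v ≡ sumTo k (λ w → when (dom w u v) (when (tint c (col w)) M))) ×
                (∀ {u v} → u < n → v < n → ar s′ aC₁ (suc u) v ≡ sumTo k (λ w → when (dom w u v) (unless (tint c (col w)) M))))
      (fill-grid n reset ρ s aC₀ (λ _ _ → 0)
         (λ i j s′ i<n j<n _ _ → put-hit n aC₀ (suc i) j (ar s′) j<n)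
         (λ i j i′ j′ s′ i<n j<n j′<n ne → put-miss n aC₀ (suc i) j (ar s′) λ _ eq → ne (suc-injective eq)) ,
       fill-grid n reset ρ s aC₁ (λ _ _ → 0)
         (λ i j s′ i<n j<n _ _ → put-hit n aC₁ (suc i) j (put n aC₀ (suc i) j 0 (ar s′)) j<n)
         (λ i j i′ j′ s′ i<n j<n j′<n ne → put-miss n aC₁ (suc i) j (put n aC₀ (suc i) j 0 (ar s′)) {aC₁} λ _ eq → ne (suc-injective eq)))
      λ k s′ k<n fr (C₀ , C₁) →
        let ρ′ = ρ [ 0 ≔ k ]
            B′ = base-carry fr
            sₗ = run n labels ρ′ s′
            fl = frame n labels ρ′ s′
            (T₀ , T₁) = tally-correct ρ′ sₗ k<n (base-frame labels ρ′ refl refl B′) (labels-correct n nb rs ρ′ s′ k<n (graph B′))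
        in (λ {u} {v} u<n v<n → trans (T₀ u<n v<n) (cong (_+ _) (trans (cong (λ f → f (suc u) v) (arr fl aC₀ refl)) (C₀ u<n v<n)))) ,
           (λ {u} {v} u<n v<n → trans (T₁ u<n v<n) (cong (_+ _) (trans (cong (λ f → f (suc u) v) (arr fl aC₁ refl)) (C₁ u<n v<n))))
      where
      body : Cmd 1
      body = labels ⨾ for (for (tally c))
      s₁ = run n (for (for reset)) ρ s
      B₁ = base-frame (for (for reset)) ρ refl refl B
      base-carry : ∀ {s′} → Frame body s₁ s′ → Base s′
      base-carry fr = record
        { graph  = subst (Holds n nb) (sym (arr fr aN refl)) (graph B₁)
        ; colour = λ {x} x<n → trans (cong (λ f → f 0 x) (arr fr aG refl)) (colour B₁ x<n) }

  -- Growing a set along a shortest walk.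

  Bits : (ℕ → ℕ) → Set
  Bits S = ∀ {x} → x < n → S x ≡ 0 ⊎ S x ≡ 1

  record Inserts (y : ℕ) (S S′ : ℕ → ℕ) : Set where
    field
      new  : S′ y ≡ 1
      rest : ∀ {x} → x ≢ y → S′ x ≡ S x

    keeps : ∀ {x} → S x ≢ 0 → S′ x ≢ 0
    keeps {x} Sx eq with x ≟ y
    ... | yes refl = 0≢1+n (trans (sym eq) new)
    ... | no x≢y   = Sx (trans (sym (rest x≢y)) eq)

    present : S′ y ≢ 0
    present eq = 0≢1+n (trans (sym eq) new)

    split : ∀ {x} → S′ x ≢ 0 → x ≡ y ⊎ S x ≢ 0
    split {x} S′x with x ≟ y
    ... | yes x≡y = inj₁ x≡y
    ... | no x≢y  = inj₂ λ eq → S′x (trans (rest x≢y) eq)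

    bits : Bits S → Bits S′
    bits b {x} x<n with x ≟ y
    ... | yes refl = inj₂ new
    ... | no x≢y   = subst (λ z → z ≡ 0 ⊎ z ≡ 1) (sym (rest x≢y)) (b x<n)

    sum-insert : y < n → ∀ (f : ℕ → ℕ) → sumTo n (λ x → when (S′ x) (f x)) + when (S y) (f y) ≡ sumTo n (λ x → when (S x) (f x)) + f y
    sum-insert y<n f = trans
      (sum-update n y<n λ {x} _ x≢y → cong (λ z → when z (f x)) (rest x≢y))
      (cong (sumTo n (λ x → when (S x) (f x)) +_) (when-nonzero present))

    sum-insert≤ : y < n → ∀ (f : ℕ → ℕ) → sumTo n (λ x → when (S′ x) (f x)) ≤ sumTo n (λ x → when (S x) (f x)) + f y
    sum-insert≤ y<n f = ≤-trans (m≤m+n _ _) (≤-reflexive (sum-insert y<n f))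

  open Inserts

  put-inserts : ∀ a y (A : ℕ → ℕ → ℕ → ℕ) → y < n → Inserts y (A a 0) (put n a 0 y 1 A a 0)
  put-inserts a y A y<n = record
    { new  = put-hit n a 0 y A y<n
    ; rest = λ x≢y → put-miss n a 0 y A λ _ _ eq → x≢y (sym eq) }

  module _ (c : Bool) (Dt : ℕ → ℕ → ℕ) (isD : IsDist c (Table Dt)) (u v : ℕ) (u<n : u < n) (v<n : v < n)
           (fin : Dt (suc u) v < ∞) where

    private
      wt = weight c
      D = Table Dt

    open IsDistance isD

    record Context (s : St) : Set where
      field
        graphᶜ    : Holds n nb (ar s aN)
        weightᶜ   : ∀ {x} → x < n → ar s aW 0 x ≡ wt x
        distanceᶜ : ar s aD ≡ Dt
        targetᶜ   : sc s sV ≡ v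

    open Context

    context-frame : ∀ {d} (e : Cmd d) {s s′} → keepsArr e aN ≡ true → keepsArr e aW ≡ true → keepsArr e aD ≡ true →
                    keepsScl e sV ≡ true → Frame e s s′ → Context s → Context s′
    context-frame e kN kW kD kV fr C = record
      { graphᶜ    = subst (Holds n nb) (sym (arr fr aN kN)) (graphᶜ C)
      ; weightᶜ   = λ {x} x<n → trans (cong (λ f → f 0 x) (arr fr aW kW)) (weightᶜ C x<n)
      ; distanceᶜ = trans (arr fr aD kD) (distanceᶜ C)
      ; targetᶜ   = trans (sca fr sV kV) (targetᶜ C) }

    -- `weigh` bounds the weight of a set by that of a walk, and a revisited vertex only makes the
    -- set lighter. `onpath` is the premise of `shortest-dominated`.
    record Partway (S : ℕ → ℕ) (cur rem : ℕ) : Set where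
      field
        cur<n  : cur < n
        cur∈   : S cur ≢ 0
        u∈     : S u ≢ 0
        rem≡   : rem ≡ D cur v
        binary : Bits S
        reach  : ∀ {x} → x < n → S x ≢ 0 → Conn n nb (In n nb S) u x
        weigh  : sumTo n (λ x → when (S x) (wt x)) + rem ≤ wt u + D u v
        onpath : ∀ {x} → x < n → S x ≢ 0 → D u x + D x v ≤ D u v

    open Partway

    Next : ℕ → ℕ → ℕ → Set
    Next cur rem x = nb x cur ≢ 0 × rem ≡ wt x + D x v

    partway-fin : ∀ {S cur rem} → Partway S cur rem → D cur v < ∞
    partway-fin {cur = cur} P = ≤-<-trans (≤-trans (m≤n+m (D cur v) (D u cur)) (onpath P (cur<n P) (cur∈ P))) fin

    -- The second vertex of a walk of weight `D cur v` qualifies: a cheaper continuation would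
    -- contradict minimality, a dearer one completeness.
    next-exists : ∀ {S cur rem} → Partway S cur rem → rem ≢ 0 → ∃[ x ] x < n × Next cur rem x
    next-exists {S} {cur} {rem} P rem≢0 with first-step n nb wt (sound (cur<n P) v<n (partway-fin P)) cur≢v v<n
      where
      cur≢v : cur ≢ v
      cur≢v refl = rem≢0 (trans (rem≡ P) (n≤0⇒n≡0 (complete v<n v<n here)))
    ... | x , c′ , x<n , cx , p , eq = x , x<n , nb-sym (cur<n P) x<n cx ,
      ≤-antisym (≤-trans (≤-reflexive (rem≡ P)) (complete (cur<n P) v<n (step-walk n nb wt x<n cx (sound x<n v<n
                  (≤-<-trans (≤-trans Dxv≤ (≤-trans (m≤n+m c′ (wt x)) (≤-reflexive (sym eq)))) (partway-fin P))))))
                (≤-trans (+-monoʳ-≤ (wt x) Dxv≤) (≤-reflexive (sym (trans (rem≡ P) eq))))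
      where
      Dxv≤ : D x v ≤ c′
      Dxv≤ = complete x<n v<n p

    find-correct : ∀ ρ s → Context s → sc s sCur < n → (∃[ x ] x < n × Next (sc s sCur) (sc s sRem) x) →
      let s′ = run n (for find) ρ s in
      sc s′ sNext < n × Next (sc s sCur) (sc s sRem) (sc s′ sNext) × sc s′ sNextRem ≡ D (sc s′ sNext) v
    find-correct ρ s C cur<n (y , y<n , Ny) = case final of λ
      { (inj₁ none) → contradiction Ny (none y<n y<n) ; (inj₂ good) → good }
      where
      Good : St → Set
      Good s′ = sc s′ sNext < n × Next (sc s sCur) (sc s sRem) (sc s′ sNext) × sc s′ sNextRem ≡ D (sc s′ sNext) v
      I : ℕ → St → Set
      I k s′ = (∀ {x} → x < k → x < n → ¬ Next (sc s sCur) (sc s sRem) x) ⊎ Good s′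
      extendᴺ : ∀ {k s′} → ¬ Next (sc s sCur) (sc s sRem) k → I k s′ → I (suc k) s′
      extendᴺ ne (inj₂ g) = inj₂ g
      extendᴺ {k} ne (inj₁ none) = inj₁ λ {x} x<1+k x<n → case x ≟ k of λ
        { (yes refl) → ne ; (no x≢k) → none (≤∧≢⇒< (s≤s⁻¹ x<1+k) x≢k) x<n }
      try-one : ∀ k s′ → k < n → Frame find s s′ → I k s′ → I (suc k) (run n find (ρ [ 2 ≔ k ]) s′)
      try-one k s′ k<n fr i rewrite arr fr aN refl | arr fr aW refl | arr fr aD refl | sca fr sCur refl
        | sca fr sRem refl | sca fr sV refl | graphᶜ C k<n cur<n | weightᶜ C k<n | targetᶜ C | distanceᶜ C
        with nb k (sc s sCur) in adj
      ... | zero = extendᴺ {k} {s′} (λ (a , _) → a adj) i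
      ... | suc _ with (sc s sRem ∸ (wt k + D k v)) + ((wt k + D k v) ∸ sc s sRem) in eq
      ... | zero  = inj₂ (k<n , ((λ z → 0≢1+n (trans (sym z) adj)) , gap≡0⁻¹ eq) , refl)
      ... | suc _ = extendᴺ {k} {s′} (λ (_ , r) → 0≢1+n (trans (sym (gap≡0 r)) eq)) i
      final : I n (run n (for find) ρ s)
      final = for-inv n find ρ s I (inj₁ λ ()) try-one

    partway-insert : ∀ {S S′ cur rem y} → Partway S cur rem → Inserts y S S′ → y < n → Next cur rem y →
                     Partway S′ y (D y v)
    partway-insert {S} {S′} {cur} {rem} {y} P J y<n (yc , eq) = record
      { cur<n  = y<n
      ; cur∈   = present J
      ; u∈     = keeps J (u∈ P)
      ; rem≡   = refl
      ; binary = bits J (binary P)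
      ; reach  = λ {x} x<n S′x → case split J S′x of λ
          { (inj₁ refl) → lift (reach P (cur<n P) (cur∈ P)) ◅◅
                          ((cur<n P , keeps J (cur∈ P)) , (y<n , present J) , nb-sym y<n (cur<n P) yc) ◅ ε
          ; (inj₂ Sx)   → lift (reach P x<n Sx) }
      ; weigh  = begin
          sumTo n (λ x → when (S′ x) (wt x)) + D y v
            ≤⟨ +-monoˡ-≤ (D y v) (sum-insert≤ J y<n wt) ⟩
          sumTo n (λ x → when (S x) (wt x)) + wt y + D y v
            ≡⟨ +-assoc (sumTo n (λ x → when (S x) (wt x))) (wt y) (D y v) ⟩
          sumTo n (λ x → when (S x) (wt x)) + (wt y + D y v)
            ≡⟨ cong (sumTo n (λ x → when (S x) (wt x)) +_) eq ⟨
          sumTo n (λ x → when (S x) (wt x)) + rem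
            ≤⟨ weigh P ⟩
          wt u + D u v ∎
      ; onpath = λ {x} x<n S′x → case split J S′x of λ
          { (inj₂ Sx)   → onpath P x<n Sx
          ; (inj₁ refl) → begin
              D u y + D y v
                ≤⟨ +-monoˡ-≤ (D y v) (complete u<n y<n (_++ʷ_ n nb wt (sound u<n (cur<n P)
                     (≤-<-trans (≤-trans (m≤m+n (D u cur) (D cur v)) (onpath P (cur<n P) (cur∈ P))) fin))
                     (edge y<n (nb-sym y<n (cur<n P) yc)))) ⟩
              D u cur + wt y + D y v
                ≡⟨ +-assoc (D u cur) (wt y) (D y v) ⟩
              D u cur + (wt y + D y v)
                ≡⟨ cong (D u cur +_) (trans (sym eq) (rem≡ P)) ⟩
              D u cur + D cur v
                ≤⟨ onpath P (cur<n P) (cur∈ P) ⟩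
              D u v ∎ } }
      where
      open ≤-Reasoning
      lift : ∀ {x} → Conn n nb (In n nb S) u x → Conn n nb (In n nb S′) u x
      lift = conn-map n nb λ _ → keeps J

    -- Weights are positive, so each step spends at least one unit and the initial distance bounds
    -- the number of steps. Truncated subtraction covers the idle steps after arrival.
    record Progress (t : ℕ) (s : St) : Set where
      field
        context : Context s
        partway : Partway (ar s aS 0) (sc s sCur) (sc s sRem)
        ahead   : sc s sRem ≤ D u v ∸ t

    open Progress

    advance-correct : ∀ t ρ s → Progress t s → Progress (suc t) (run n advance ρ s)
    advance-correct t ρ s G = onZero-elim (Progress (suc t)) (sc s sRem)
      (λ rem≡0 → record { context = context G ; partway = partway G ; ahead = ≤-trans (≤-reflexive rem≡0) z≤n })
      λ rem≢0 →
        let found = find-correct ρ s (context G) (cur<n (partway G)) (next-exists (partway G) rem≢0)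
            y<n = proj₁ found
            nx = proj₁ (proj₂ found)
            rem′ = proj₂ (proj₂ found)
            P′ = partway-insert (partway G)
                   (subst (λ S → Inserts y (S 0) (put n aS 0 y 1 (ar s₁) aS 0)) (arr (frame n (for find) ρ s) aS refl)
                     (put-inserts aS y (ar s₁) y<n)) y<n nx
        in record
          { context = context-frame tail refl refl refl refl (frame n tail ρ s) (context G)
          ; partway = subst (Partway _ y) (sym rem′) P′
          ; ahead   = begin
              sc s₁ sNextRem          ≡⟨ rem′ ⟩
              D y v                   ≤⟨ ≤-pred′ (weight-pos c y) (proj₂ nx) ⟩
              sc s sRem ∸ 1           ≤⟨ ∸-monoˡ-≤ 1 (ahead G) ⟩
              D u v ∸ t ∸ 1           ≡⟨ ∸-+-assoc (D u v) t 1 ⟩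
              D u v ∸ (t + 1)         ≡⟨ cong (D u v ∸_) (+-comm t 1) ⟩
              D u v ∸ suc t           ∎ }
      where
      open ≤-Reasoning
      tail : Cmd 2
      tail = for find ⨾ set sCur (var sNext) ⨾ set sRem (var sNextRem) ⨾ write aS hdr (var sCur) (lit 1)
      s₁ = run n (for find) ρ s
      y = sc s₁ sNext
      ≤-pred′ : ∀ {a b r} → 0 < a → r ≡ a + b → b ≤ r ∸ 1
      ≤-pred′ {suc a} {b} _ refl = m≤n+m b a

    trace-loops : ∀ ρ s → Progress 0 s →
                  Progress (n * (n * 3)) (run n (for (for (advance ⨾ advance ⨾ advance))) ρ s)
    trace-loops ρ s G = for-inv n (for three) ρ s (λ i → Progress (i * (n * 3))) G
      λ i s′ _ _ G′ → subst (λ t → Progress t (run n (for three) (ρ [ 0 ≔ i ]) s′)) (+-comm (i * (n * 3)) (n * 3))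
        (for-inv n three (ρ [ 0 ≔ i ]) s′ (λ j → Progress (i * (n * 3) + j * 3))
          (subst (λ t → Progress t s′) (sym (+-identityʳ (i * (n * 3)))) G′)
          λ j s″ _ _ G″ →
            let ρ′ = ρ [ 0 ≔ i ] [ 1 ≔ j ] in
            subst (λ t → Progress t (run n three ρ′ s″)) (rearrange (i * (n * 3)) j)
              (advance-correct _ ρ′ _ (advance-correct _ ρ′ _ (advance-correct _ ρ′ s″ G″))))
      where
      three : Cmd 2
      three = advance ⨾ advance ⨾ advance
      rearrange : ∀ a j → suc (suc (suc (a + j * 3))) ≡ a + suc j * 3
      rearrange = solve-∀

    record Traced (S : ℕ → ℕ) : Set where
      field
        start∈ : S u ≢ 0
        end∈   : S v ≢ 0
        binary : Bits S
        reach  : ∀ {x} → x < n → S x ≢ 0 → Conn n nb (In n nb S) u x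
        weigh  : sumTo n (λ x → when (S x) (wt x)) ≤ wt u + D u v
        onpath : ∀ {x} → x < n → S x ≢ 0 → D u x + D x v ≤ D u v

    trace-correct : ∀ ρ s → Context s → sc s sU ≡ u → sc s sRem ≡ D u v → D u v ≤ n * (n * 3) →
                    Traced (ar (run n trace ρ s) aS 0)
    trace-correct ρ s C u≡ rem≡₀ D≤ = record
      { start∈ = u∈ P
      ; end∈   = subst (λ z → S′ z ≢ 0) cur≡v (cur∈ P)
      ; binary = binary P
      ; reach  = reach P
      ; weigh  = ≤-trans (m≤m+n _ _) (weigh P)
      ; onpath = onpath P }
      where
      clear begun : Cmd 0
      clear = for (write aS hdr col₀ (lit 0))
      begun = clear ⨾ set sCur (var sU) ⨾ write aS hdr (var sCur) (lit 1)
      s₁ = run n clear ρ s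
      s₂ = run n begun ρ s
      S₂ = ar s₂ aS 0
      cleared : ∀ {x} → x < n → ar s₁ aS 0 x ≡ 0
      cleared = fill-row n {0} (write aS hdr col₀ (lit 0)) ρ s aS 0 (λ _ → 0)
        (λ k s′ k<n _ _ → put-hit n aS 0 k (ar s′) k<n)
        (λ j k s′ j<n k<n k≢j → put-miss n aS 0 k (ar s′) λ _ _ → k≢j)
      cur₂ : sc s₂ sCur ≡ u
      cur₂ = trans (sca (frame n clear ρ s) sU refl) u≡
      rem₂ : sc s₂ sRem ≡ D u v
      rem₂ = trans (sca (frame n begun ρ s) sRem refl) rem≡₀
      J : Inserts u (ar s₁ aS 0) S₂
      J = subst (λ z → Inserts u (ar s₁ aS 0) (put n aS 0 z 1 (ar s₁) aS 0)) (sym cur₂) (put-inserts aS u (ar s₁) u<n)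
      only-u : ∀ {x} → x < n → S₂ x ≢ 0 → x ≡ u
      only-u x<n S₂x with split J S₂x
      ... | inj₁ eq = eq
      ... | inj₂ ne = contradiction (cleared x<n) ne
      P₂ : Partway S₂ u (D u v)
      P₂ = record
        { cur<n  = u<n
        ; cur∈   = present J
        ; u∈     = present J
        ; rem≡   = refl
        ; binary = bits J (inj₁ ∘ cleared)
        ; reach  = λ x<n S₂x → subst (Conn n nb _ u) (sym (only-u x<n S₂x)) ε
        ; weigh  = +-monoˡ-≤ (D u v) (≤-trans (sum-insert≤ J u<n wt)
                     (≤-reflexive (cong (_+ wt u) (sum-zero n λ {x} x<n → when-zero {v = wt x} (cleared x<n)))))
        ; onpath = λ x<n S₂x → subst (λ x → D u x + D x v ≤ D u v) (sym (only-u x<n S₂x))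
                     (+-monoˡ-≤ (D u v) (complete u<n u<n here)) }
      G : Progress (n * (n * 3)) (run n trace ρ s)
      G = trace-loops ρ s₂ (record
        { context = context-frame begun refl refl refl refl (frame n begun ρ s) C
        ; partway = subst₂ (Partway S₂) (sym cur₂) (sym rem₂) P₂
        ; ahead   = ≤-reflexive rem₂ })
      P = partway G
      S′ = ar (run n trace ρ s) aS 0
      cur = sc (run n trace ρ s) sCur
      rem≡0 : sc (run n trace ρ s) sRem ≡ 0
      rem≡0 = n≤0⇒n≡0 (≤-trans (ahead G) (≤-reflexive (m≤n⇒m∸n≡0 D≤)))
      cur≡v : cur ≡ v
      -- A walk between different vertices pays for its last vertex, so remaining distance 0 means
      -- arrival.
      cur≡v = decidable-stable (cur ≟ v) λ ne → contradiction
        (≤-trans (weight-pos c v) (≤-trans (last-weight n nb wt (sound (cur<n P) v<n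
          (≤-<-trans (≤-reflexive D≡0) (m≤n+m 1 (suc n * n + n)))) ne) (≤-reflexive D≡0))) λ ()
        where
        D≡0 : D cur v ≡ 0
        D≡0 = trans (sym (rem≡ P)) rem≡0

  -- Extending the walk to a balanced solution.

  heavyIn lightIn : Bool → (ℕ → ℕ) → ℕ
  heavyIn c S = sumTo n (λ x → when (S x) (unless (tint c (col x)) M))
  lightIn c S = sumTo n (λ x → when (S x) (when (tint c (col x)) M))

  -- `heavies` for both colours is balance: M times the number of red vertices and M times the
  -- number of blue ones are both `best`.
  record Solution (S : ℕ → ℕ) (best : ℕ) : Set where
    field
      binary    : Bits S
      connected : ∀ {x y} → x < n → y < n → S x ≢ 0 → S y ≢ 0 → Conn n nb (In n nb S) x y
      heavies   : ∀ c → heavyIn c S ≡ best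

  heavy-multiple : ∀ c S → heavyIn c S ≡ M * sumTo n (λ x → when (S x) (unless (tint c (col x)) 1))
  heavy-multiple c S = trans (sum-cong n λ {x} _ → factor-out (S x) (tint c (col x))) (sum-*ˡ n M _)
    where
    factor-out : ∀ h t → when h (unless t M) ≡ M * when h (unless t 1)
    factor-out zero    t       = sym (*-zeroʳ M)
    factor-out (suc h) zero    = sym (*-identityʳ M)
    factor-out (suc h) (suc t) = sym (*-zeroʳ M)

  light-multiple : ∀ c S → lightIn c S ≡ M * sumTo n (λ x → when (S x) (when (tint c (col x)) 1))
  light-multiple c S = trans (sum-cong n λ {x} _ → factor-out (S x) (tint c (col x))) (sum-*ˡ n M _)
    where
    factor-out : ∀ h t → when h (when t M) ≡ M * when h (when t 1)
    factor-out zero    t       = sym (*-zeroʳ M)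
    factor-out (suc h) zero    = sym (*-zeroʳ M)
    factor-out (suc h) (suc t) = sym (*-identityʳ M)

  -- This leaves room for one more heavy vertex whenever the quota is not yet reached, so the quota
  -- is never overshot.
  gap-of-multiples : ∀ {a b} → M * a < M * b → M * a + M ≤ M * b
  gap-of-multiples {a} {b} lt = begin
    M * a + M   ≡⟨ +-comm (M * a) M ⟩
    M + M * a   ≡⟨ *-suc M a ⟨
    M * suc a   ≤⟨ *-monoʳ-≤ M (*-cancelˡ-< M a b lt) ⟩
    M * b       ∎
    where open ≤-Reasoning

  -- Since n < M, the slack n granted to the light vertices of a walk cannot hide another heavy one.
  slack-of-multiples : ∀ {a b} → M * a ≤ M * b + n → M * a ≤ M * b
  slack-of-multiples {a} {b} le = *-monoʳ-≤ M (s≤s⁻¹ (*-cancelˡ-< M a (suc b) (begin-strict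
    M * a       ≤⟨ le ⟩
    M * b + n   <⟨ +-monoʳ-< (M * b) (≤-reflexive (+-comm 1 n)) ⟩
    M * b + M   ≡⟨ trans (+-comm (M * b) M) (sym (*-suc M b)) ⟩
    M * suc b   ∎)))
    where open ≤-Reasoning

  heavy-flip : ∀ c S → lightIn c S ≡ heavyIn (not c) S
  heavy-flip true  S = sum-cong n λ {x} _ → cong (when (S x)) (flip (col x))
    where
    flip : ∀ z → when (1 ∸ z) M ≡ unless z M
    flip zero    = refl
    flip (suc z) = cong (λ z → when z M) (0∸n≡0 z)
  heavy-flip false S = sum-cong n λ {x} _ → cong (when (S x)) (flip (col x))
    where
    flip : ∀ z → when z M ≡ unless (1 ∸ z) M
    flip zero    = refl
    flip (suc z) = cong (λ z → unless z M) (sym (0∸n≡0 z))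

  module _ (c : Bool) (Dt : ℕ → ℕ → ℕ) (isD : IsDist c (Table Dt)) (u v : ℕ) (u<n : u < n) (v<n : v < n)
           (l≤h : light c u v ≤ heavy c u v)
           (d≤l : Dt (suc u) v + weight c u ≤ light c u v + n) where

    private
      D = Table Dt
      L = light c u v
      dm : ℕ → ℕ
      dm w = dom w u v

    L≤ : L ≤ n * M
    L≤ = ≤-trans (sum-mono n λ {w} _ → ≤-trans (when≤ (dm w) _) (when≤ (tint c (col w)) M)) (≤-reflexive (sum-const n M))

    D≤ : D u v ≤ n * M + n
    D≤ = ≤-trans (m≤m+n (D u v) (weight c u)) (≤-trans d≤l (+-monoˡ-≤ n L≤))

    D-fin : D u v < ∞
    D-fin = ≤-<-trans D≤ (≤-reflexive (rearrange n))
      where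
      rearrange : ∀ n → suc (n * (n + 1) + n) ≡ suc n * n + n + 1
      rearrange = solve-∀

    -- The right side is the number of calls of `advance` in `trace`. The vertex u gives 1 ≤ n,
    -- which turns n² + 2n into 3n².
    D-steps : D u v ≤ n * (n * 3)
    D-steps = begin
      D u v                       ≤⟨ D≤ ⟩
      n * (n + 1) + n             ≡⟨ rearrange₁ n ⟩
      n * (n + 2 * 1)             ≤⟨ *-monoʳ-≤ n (+-monoʳ-≤ n (*-monoʳ-≤ 2 (≤-trans (s≤s z≤n) u<n))) ⟩
      n * (n + 2 * n)             ≡⟨ rearrange₂ n ⟩
      n * (n * 3)                 ∎
      where
      open ≤-Reasoning
      rearrange₁ : ∀ n → n * (n + 1) + n ≡ n * (n + 2 * 1)
      rearrange₁ = solve-∀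
      rearrange₂ : ∀ n → n * (n + 2 * n) ≡ n * (n * 3)
      rearrange₂ = solve-∀

    module _ (order : ¬ ¬ Order n nb) {S : ℕ → ℕ} (T : Traced c Dt isD u v u<n v<n D-fin S) where

      open Traced T

      -- The goal is a negation, so the doubly negated preorder may be used.
      traced⊆dominated : ∀ {x} → x < n → S x ≢ 0 → dm x ≢ 0
      traced⊆dominated x<n Sx eq = order λ O →
        let (xu , p) = proj₁ (dom-spec x<n u<n v<n) eq in
        shortest-dominated n nb (weight c) rs (weight-pos c) isD O u<n v<n x<n D-fin (onpath x<n Sx) xu p

      -- S contains a walk from u to v, which must meet N(w). Hence any vertices of D(u, v) can be
      -- added to S without losing connectedness.
      dominated-touches : ∀ {w} → w < n → dm w ≢ 0 → ∃[ x ] x < n × S x ≢ 0 × nb w x ≢ 0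
      dominated-touches {w} w<n d with meets n nb rs w u<n start∈ (reach v<n end∈)
      ... | inj₁ hit      = hit
      ... | inj₂ (wu , p) = contradiction (proj₂ (dom-spec w<n u<n v<n) wu p) d

      -- The heavy part of S weighs no more than the whole walk, hence at most L + n; being a
      -- multiple of M, as L is, it is at most L.
      heavyS≤ : heavyIn c S ≤ L
      heavyS≤ = subst₂ _≤_ (sym (heavy-multiple c S)) (sym (light-multiple c dm))
        (slack-of-multiples {sumTo n (λ x → when (S x) (unless (tint c (col x)) 1))} {sumTo n (λ x → when (dm x) (when (tint c (col x)) 1))} (begin
          M * _                                       ≡⟨ heavy-multiple c S ⟨
          heavyIn c S                                 ≤⟨ sum-mono n (λ {x} _ → bound (S x) (tint c (col x))) ⟩
          sumTo n (λ x → when (S x) (weight c x))     ≤⟨ weigh ⟩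
          weight c u + D u v                          ≡⟨ +-comm (weight c u) (D u v) ⟩
          D u v + weight c u                          ≤⟨ d≤l ⟩
          L + n                                       ≡⟨ cong (_+ n) (light-multiple c dm) ⟩
          M * _ + n                                   ∎))
        where
        open ≤-Reasoning
        bound : ∀ h t → when h (unless t M) ≤ when h (onZero t M 1)
        bound zero    t       = z≤n
        bound (suc h) zero    = ≤-refl
        bound (suc h) (suc t) = z≤n

      -- Light vertices of D(u, v) are always taken, heavy ones until the quota L is met. `heavies`
      -- records that the quota is met or that no heavy vertex has been refused so far.
      record Filling (k : ℕ) (S′ : ℕ → ℕ) (count : ℕ) : Set where
        field
          binary′ : Bits S′
          grown   : ∀ {x} → x < n → S x ≢ 0 → S′ x ≢ 0
          within  : ∀ {x} → x < n → S′ x ≢ 0 → dm x ≢ 0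
          lights  : ∀ {x} → x < k → x < n → dm x ≢ 0 → tint c (col x) ≢ 0 → S′ x ≢ 0
          counted : count ≡ heavyIn c S′
          count≤  : count ≤ L
          heavies : count ≡ L ⊎ (∀ {x} → x < k → x < n → dm x ≢ 0 → tint c (col x) ≡ 0 → S′ x ≢ 0)

      open Filling

      private
        settled : ∀ {k S′ count} → Filling k S′ count → (dm k ≢ 0 → S′ k ≢ 0 ⊎ (tint c (col k) ≡ 0 × count ≡ L)) →
                  Filling (suc k) S′ count
        settled {k} {S′} F at-k = record
          { binary′ = binary′ F ; grown = grown F ; within = within F ; counted = counted F ; count≤ = count≤ F
          ; lights  = λ {x} x<1+k x<n d t → case x ≟ k of λ
              { (yes refl) → case at-k d of λ { (inj₁ S′k) → S′k ; (inj₂ (t′ , _)) → contradiction t′ t }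
              ; (no x≢k)   → lights F (≤∧≢⇒< (s≤s⁻¹ x<1+k) x≢k) x<n d t }
          ; heavies = heavies′ }
          where
          heavies′ : _ ≡ L ⊎ (∀ {x} → x < suc k → x < n → dm x ≢ 0 → tint c (col x) ≡ 0 → S′ x ≢ 0)
          heavies′ with heavies F
          ... | inj₁ eq = inj₁ eq
          ... | inj₂ all with dm k ≟ 0
          ... | yes dk≡0 = inj₂ λ {x} x<1+k x<n d t → case x ≟ k of λ
                { (yes refl) → contradiction dk≡0 d ; (no x≢k) → all (≤∧≢⇒< (s≤s⁻¹ x<1+k) x≢k) x<n d t }
          ... | no dk with at-k dk
          ... | inj₂ (_ , eq) = inj₁ eq
          ... | inj₁ S′k = inj₂ λ {x} x<1+k x<n d t → case x ≟ k of λ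
                { (yes refl) → S′k ; (no x≢k) → all (≤∧≢⇒< (s≤s⁻¹ x<1+k) x≢k) x<n d t }

        inserted : ∀ {k S′ S″ count count′} → k < n → dm k ≢ 0 → Filling k S′ count → Inserts k S′ S″ →
                   count′ ≡ heavyIn c S″ → count′ ≤ L → (count ≡ L → count′ ≡ L) → Filling (suc k) S″ count′
        inserted {k} k<n dk F J eq le full = settled (record
          { binary′ = bits J (binary′ F)
          ; grown   = λ x<n Sx → keeps J (grown F x<n Sx)
          ; within  = λ x<n S″x → case split J S″x of λ { (inj₁ refl) → dk ; (inj₂ S′x) → within F x<n S′x }
          ; lights  = λ x<k x<n d t → keeps J (lights F x<k x<n d t)
          ; counted = eq
          ; count≤  = le
          ; heavies = Sum.map full (λ all {x} x<k x<n d t → keeps J (all {x} x<k x<n d t)) (heavies F) })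
          λ _ → inj₁ (present J)

      extend-correct : ∀ ρ k s → k < n → Base s → sc s sU ≡ u → sc s sV ≡ v → sc s sBest ≡ L →
        Filling k (ar s aS 0) (sc s sCount) →
        let s′ = run n (labels ⨾ extend c) (ρ [ 0 ≔ k ]) s in
        Filling (suc k) (ar s′ aS 0) (sc s′ sCount)
      extend-correct ρ k s k<n B u≡ v≡ best≡ F₀ = go
        where
        ρ′ = ρ [ 0 ≔ k ]
        s₁ = run n labels ρ′ s
        fr = frame n labels ρ′ s
        S′ = ar s₁ aS 0
        count = sc s₁ sCount
        F : Filling k S′ count
        F = subst₂ (Filling k) (cong (λ f → f 0) (sym (arr fr aS refl))) (sym (sca fr sCount refl)) F₀
        out = evalᴱ n {1} (outside (var sU) (var sV)) ρ′ s₁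
        tnt = evalᴱ n {1} (tintᴱ c col₀) ρ′ s₁
        tnt≡ : tnt ≡ tint c (col k)
        tnt≡ = trans (tintᴱ-value {n} {1} c col₀ ρ′ s₁)
          (cong (tint c) (trans (cong (λ f → f 0 k) (arr fr aG refl)) (colour B k<n)))
        best₁ : sc s₁ sBest ≡ L
        best₁ = trans (sca fr sBest refl) best≡
        lab = ar s₁ aL 0
        sep : Separates n nb rs k lab
        sep = labels-correct n nb rs ρ′ s k<n (graph B)
        out≡ : out ≡ nb k u + ((lab u ∸ lab v) + (lab v ∸ lab u))
        out≡ rewrite trans (sca fr sU refl) u≡ | trans (sca fr sV refl) v≡ | arr fr aN refl | graph B k<n u<n = refl
        zeros = outside-zero c k<n u<n v<n sep
        J : Inserts k S′ (put n aS 0 k 1 (ar s₁) aS 0)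
        J = put-inserts aS k (ar s₁) k<n
        sum-J : S′ k ≡ 0 → heavyIn c (put n aS 0 k 1 (ar s₁) aS 0) ≡ count + unless (tint c (col k)) M
        sum-J S′k = trans (sym (+-identityʳ _)) (trans (cong (heavyIn c (put n aS 0 k 1 (ar s₁) aS 0) +_)
            (sym (when-zero {v = unless (tint c (col k)) M} S′k)))
          (trans (sum-insert J k<n (λ x → unless (tint c (col x)) M)) (cong (_+ unless (tint c (col k)) M) (sym (counted F)))))
        Goal : St → Set
        Goal s′ = Filling (suc k) (ar s′ aS 0) (sc s′ sCount)
        go : Goal (run n (extend c) ρ′ s₁)
        go = onZero-elim Goal out
          (λ out≡0 → settled F λ dk → contradiction (proj₁ zeros (trans (sym out≡) out≡0)) dk)
          λ out≢0 →
            let dk : dm k ≢ 0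
                dk dk≡0 = out≢0 (trans out≡ (proj₂ zeros dk≡0)) in
            onZero-elim Goal (S′ k)
              (λ S′k → onZero-elim Goal tnt
                (λ t≡0 → onZero-elim Goal (sc s₁ sBest ∸ count)
                  (λ full → settled F λ _ → inj₂ (trans (sym tnt≡) t≡0 ,
                    ≤-antisym (count≤ F) (≤-trans (≤-reflexive (sym best₁)) (m∸n≡0⇒m≤n full))))
                  λ room →
                    let eq = trans (sum-J S′k) (cong (count +_) (unless-zero (trans (sym tnt≡) t≡0)))
                        lt = ≤-trans (m∸n≢0⇒n<m room) (≤-reflexive best₁) in
                    inserted k<n dk F J (sym eq) (more lt) (λ c≡L → contradiction c≡L (<⇒≢ lt)))
                λ t≢0 → inserted k<n dk F J
                  (sym (trans (sum-J S′k) (trans (cong (count +_) (unless-nonzero (t≢0 ∘ trans tnt≡))) (+-identityʳ count))))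
                  (count≤ F) (λ eq → eq))
              λ S′k → settled F λ _ → inj₁ S′k
          where
          more : count < L → count + M ≤ L
          more lt = subst₂ (λ a b → a + M ≤ b) (sym (trans (counted F) (heavy-multiple c S′))) (sym (light-multiple c dm))
            (gap-of-multiples {sumTo n (λ x → when (S′ x) (unless (tint c (col x)) 1))} {sumTo n (λ x → when (dm x) (when (tint c (col x)) 1))}
              (subst₂ _<_ (trans (counted F) (heavy-multiple c S′)) (light-multiple c dm) lt))

      filled-solution : ∀ {S′ count} → Filling n S′ count → Solution S′ L
      filled-solution {S′} {count} F = record
        { binary    = binary′ F
        ; connected = λ x<n y<n S′x S′y → to-u x<n S′x ◅◅ conn-sym n nb rs (to-u y<n S′y)
        ; heavies   = by-colour }
        where
        to-u : ∀ {x} → x < n → S′ x ≢ 0 → Conn n nb (In n nb S′) x u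
        to-u {x} x<n S′x with dominated-touches x<n (within F x<n S′x)
        ... | p , p<n , Sp , xp = ((x<n , S′x) , (p<n , grown F p<n Sp) , xp) ◅
              conn-map n nb (grown F) (conn-sym n nb rs (reach p<n Sp))
        total-heavy : heavyIn c S′ ≡ L
        total-heavy with heavies F
        ... | inj₁ eq  = trans (sym (counted F)) eq
        -- If no heavy vertex of D(u, v) was refused, the heavy count is at least that of D(u, v),
        -- which is at least L because the light colour is not the more frequent one.
        ... | inj₂ all = ≤-antisym (≤-trans (≤-reflexive (sym (counted F))) (count≤ F))
            (≤-trans l≤h (sum-mono n λ {x} x<n → dominate (dm x) (S′ x) (tint c (col x)) (all x<n x<n)))
          where
          dominate : ∀ d h t → (d ≢ 0 → t ≡ 0 → h ≢ 0) → when d (unless t M) ≤ when h (unless t M)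
          dominate zero    h t       imp = z≤n
          dominate (suc d) h (suc t) imp = z≤n
          dominate (suc d) h zero    imp = ≤-reflexive (sym (when-nonzero (imp (λ ()) refl)))
        total-light : lightIn c S′ ≡ L
        total-light = sum-cong n λ {x} x<n → same (S′ x) (dm x) (tint c (col x)) (within F x<n) (lights F x<n x<n)
          where
          same : ∀ h d t → (h ≢ 0 → d ≢ 0) → (d ≢ 0 → t ≢ 0 → h ≢ 0) → when h (when t M) ≡ when d (when t M)
          same zero    zero    t       f g = refl
          same (suc h) (suc d) t       f g = refl
          same (suc h) zero    t       f g = contradiction refl (f λ ())
          same zero    (suc d) zero    f g = refl
          same zero    (suc d) (suc t) f g = contradiction refl (g (λ ()) (λ ()))
        by-colour : ∀ c′ → heavyIn c′ S′ ≡ L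
        by-colour c′ = cases c c′ total-heavy (trans (sym (heavy-flip c S′)) total-light)
          where
          cases : ∀ c c′ → heavyIn c S′ ≡ L → heavyIn (not c) S′ ≡ L → heavyIn c′ S′ ≡ L
          cases true  true  p q = p
          cases true  false p q = q
          cases false true  p q = q
          cases false false p q = p

    fill-correct : ¬ ¬ Order n nb → ∀ ρ s → Base s → sc s sU ≡ u → sc s sV ≡ v → sc s sBest ≡ L →
                   Traced c Dt isD u v u<n v<n D-fin (ar s aS 0) → Solution (ar (run n (fill c) ρ s) aS 0) L
    fill-correct order ρ s B u≡ v≡ best≡ T = filled-solution order T
      (for-inv n body ρ s₂ (λ k s′ → Filling order T k (ar s′ aS 0) (sc s′ sCount)) filling₀
        λ k s′ k<n fr F → extend-correct order T ρ k s′ k<n (base-carry fr)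
          (trans (sca fr sU refl) (trans (sca fr₂ sU refl) u≡))
          (trans (sca fr sV refl) (trans (sca fr₂ sV refl) v≡))
          (trans (sca fr sBest refl) (trans (sca fr₂ sBest refl) best≡)) F)
      where
      body : Cmd 1
      body = labels ⨾ extend c
      prefix : Cmd 0
      prefix = set sCount (lit 0) ⨾ for (count-one c)
      s₂ = run n prefix ρ s
      fr₂ = frame n prefix ρ s
      S = ar s aS 0
      B₂ = base-frame prefix ρ refl refl B
      base-carry : ∀ {s′} → Frame body s₂ s′ → Base s′
      base-carry fr = record
        { graph  = subst (Holds n nb) (sym (arr fr aN refl)) (graph B₂)
        ; colour = λ {x} x<n → trans (cong (λ f → f 0 x) (arr fr aG refl)) (colour B₂ x<n) }
      s₁ = run n {0} (set sCount (lit 0)) ρ s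
      count₂ : sc s₂ sCount ≡ heavyIn c S
      count₂ = for-inv n (count-one c) ρ s₁
        (λ k s′ → sc s′ sCount ≡ sumTo k (λ x → when (S x) (unless (tint c (col x)) M))) refl
        λ k s′ k<n fr eq → trans (counted-one k s′)
          (cong₂ _+_ eq (cong₂ (λ z t → when z (unless t M)) (cong (λ f → f 0 k) (arr fr aS refl))
            (trans (tintᴱ-value {n} {1} c col₀ (ρ [ 0 ≔ k ]) s′)
              (cong (tint c) (trans (cong (λ f → f 0 k) (arr fr aG refl)) (colour B k<n))))))
        where
        counted-one : ∀ k s′ → sc (run n (count-one c) (ρ [ 0 ≔ k ]) s′) sCount ≡
          sc s′ sCount + when (ar s′ aS 0 k) (unless (evalᴱ n {1} (tintᴱ c col₀) (ρ [ 0 ≔ k ]) s′) M)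
        counted-one k s′ with ar s′ aS 0 k
        ... | zero = sym (+-identityʳ _)
        ... | suc _ with evalᴱ n {1} (tintᴱ c col₀) (ρ [ 0 ≔ k ]) s′
        ... | zero  = refl
        ... | suc _ = sym (+-identityʳ _)
      filling₀ : Filling order T 0 (ar s₂ aS 0) (sc s₂ sCount)
      filling₀ = subst₂ (Filling order T 0) (cong (λ f → f 0) (sym (arr fr₂ aS refl))) (sym count₂) record
        { binary′ = Traced.binary T
        ; grown   = λ _ Sx → Sx
        ; within  = traced⊆dominated order T
        ; lights  = λ ()
        ; counted = refl
        ; count≤  = heavyS≤ order T
        ; heavies = inj₂ λ () }

  -- Stated with an arbitrary walk instead of the distance table, so that it survives the next
  -- phase, which overwrites the table.
  Covers : Bool → ℕ → Set
  Covers c best = ∀ {u v} → u < n → v < n → light c u v ≤ heavy c u v →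
    ∀ {d} → Walk n nb (weight c) u v d → d + weight c u ≤ light c u v + n → light c u v ≤ best

  Improves : Bool → St → St → Set
  Improves c s s′ = Solution (ar s′ aS 0) (sc s′ sBest) × sc s sBest ≤ sc s′ sBest × Covers c (sc s′ sBest)

  phase-correct : ¬ ¬ Order n nb → ∀ c ρ s → Base s → Solution (ar s aS 0) (sc s sBest) →
    Improves c s (run n (phase c) ρ s)
  phase-correct order c ρ s B sol = onZero-elim (Improves c s) (sc s₃ sFound)
    (λ idle₃ →
      subst₂ Solution (cong (λ f → f 0) (sym S₃)) (trans (sym best₂) (sym (Scanned.idle scanned idle₃))) sol ,
      grows₃ , covers₃)
    λ found₃ →
      let (u<n , v<n , (l≤h , d≤l) , best≡ , rem≡) = Scanned.found scanned found₃
          u = sc s₃ sU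
          v = sc s₃ sV
          L≡ = proj₁ C u<n v<n
          l≤h′ = subst₂ _≤_ L≡ (proj₂ C u<n v<n) l≤h
          d≤l′ = subst₂ (λ w l → Dt (suc u) v + w ≤ l + n) (W u<n) L≡ d≤l
          T = trace-correct c Dt isD u v u<n v<n (D-fin c Dt isD u v u<n v<n l≤h′ d≤l′) ρ s₃
                (record { graphᶜ = graph B₃
                        ; weightᶜ = λ {x} x<n → trans (cong (λ f → f 0 x) (arr fr₃ aW refl)) (W x<n)
                        ; distanceᶜ = arr fr₃ aD refl ; targetᶜ = refl })
                refl rem≡ (D-steps c Dt isD u v u<n v<n l≤h′ d≤l′)
          F = fill-correct c Dt isD u v u<n v<n l≤h′ d≤l′ order ρ s₄
                (base-frame trace ρ refl refl B₃) (sca fr₄ sU refl) (sca fr₄ sV refl)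
                (trans (sca fr₄ sBest refl) (trans best≡ L≡)) T
          best₅ : sc s₅ sBest ≡ sc s₃ sBest
          best₅ = sca (frame n (trace ⨾ fill c) ρ s₃) sBest refl
      in subst (Solution (ar s₅ aS 0)) (sym (trans best₅ (trans best≡ L≡))) F ,
         ≤-trans grows₃ (≤-reflexive (sym best₅)) ,
         λ u<n v<n l≤h p le → ≤-trans (covers₃ u<n v<n l≤h p le) (≤-reflexive (sym best₅))
    where
    s₁ = run n (distances c) ρ s
    s₂ = run n (counts c) ρ s₁
    s₃ = run n scan ρ s₂
    s₄ = run n trace ρ s₃
    s₅ = run n (fill c) ρ s₄
    fr₁ = frame n (distances c) ρ s
    fr₂ = frame n (counts c) ρ s₁
    fr₃ = frame n scan ρ s₂
    fr₄ = frame n trace ρ s₃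
    B₁ = base-frame (distances c) ρ {s} refl refl B
    B₂ = base-frame (counts c) ρ {s₁} refl refl B₁
    B₃ = base-frame scan ρ {s₂} refl refl B₂
    Dt = ar s₂ aD
    dist = distances-correct c ρ s B
    W : ∀ {x} → x < n → ar s₂ aW 0 x ≡ weight c x
    W {x} x<n = trans (cong (λ f → f 0 x) (arr fr₂ aW refl)) (proj₁ dist x<n)
    isD : IsDist c (Table Dt)
    isD = subst (λ f → IsDist c (Table f)) (sym (arr fr₂ aD refl)) (proj₂ dist)
    C = counts-correct c ρ s₁ B₁
    scanned = scan-correct n ρ s₂
    best₂ : sc s₂ sBest ≡ sc s sBest
    best₂ = trans (sca fr₂ sBest refl) (sca fr₁ sBest refl)
    S₃ : ar s₃ aS ≡ ar s aS
    S₃ = trans (arr fr₃ aS refl) (trans (arr fr₂ aS refl) (arr fr₁ aS refl))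
    grows₃ : sc s sBest ≤ sc s₃ sBest
    grows₃ = ≤-trans (≤-reflexive (sym best₂)) (Scanned.grows scanned)
    covers₃ : Covers c (sc s₃ sBest)
    covers₃ {u} {v} u<n v<n l≤h {d} p le = ≤-trans (≤-reflexive (sym L≡)) (Scanned.covers scanned u<n v<n u<n
      (subst₂ _≤_ (sym L≡) (sym (proj₂ C u<n v<n)) l≤h ,
       ≤-trans (+-mono-≤ (IsDistance.complete isD u<n v<n p) (≤-reflexive (W u<n)))
         (≤-trans le (≤-reflexive (cong (_+ n) (sym L≡))))))
      where L≡ = proj₁ C u<n v<n

  -- The extremal vertices of a balanced connected set form a pair that dominates it.
  covers-optimal : ¬ ¬ Order n nb → ∀ {best} → (∀ c → Covers c best) → ∀ H k →
    (∀ {x y} → x < n → y < n → H x ≢ 0 → H y ≢ 0 → Conn n nb (In n nb H) x y) →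
    (∀ c → heavyIn c H ≡ k) → k ≤ best
  covers-optimal order {best} cov H k conn bal = decidable-stable (k ≤? best) λ k≰best → order λ O →
    k≰best (bound O)
    where
    bound : Order n nb → k ≤ best
    bound O with least n nb O H n ≤-refl | least n nb (reverse-order n nb rs O) H n ≤-refl
    ... | inj₁ none | _ = ≤-trans (≤-reflexive (trans (sym (bal true)) (sum-zero n λ x<n → when-zero (none x<n)))) z≤n
    ... | inj₂ _ | inj₁ none = ≤-trans (≤-reflexive (trans (sym (bal true)) (sum-zero n λ x<n → when-zero (none x<n)))) z≤n
    -- A colour that is at least as frequent in D(u, v) takes the role of heavy; exchanging the
    -- colours exchanges the two counts.
    ... | inj₂ (u , u<n , Hu , min) | inj₂ (v , v<n , Hv , max) = case ≤-total (light true u v) (heavy true u v) of λ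
      { (inj₁ le) → use true le
      ; (inj₂ ge) → use false (subst₂ _≤_ (sym (heavy-flip false dm)) (heavy-flip true dm) ge) }
      where
      dm : ℕ → ℕ
      dm w = dom w u v
      H⊆dm : ∀ {w} → w < n → H w ≢ 0 → dm w ≢ 0
      H⊆dm w<n Hw eq = let (wu , p) = proj₁ (dom-spec w<n u<n v<n) eq in
        between n nb rs O u<n v<n w<n (min w<n Hw) (max w<n Hw) wu p
      use : ∀ c → light c u v ≤ heavy c u v → k ≤ best
      -- The walk is charged only for vertices of H: k in total for the heavy ones and 1 for each
      -- light one, at most k + n together.
      use c l≤h with simple-walk n nb (weight c) rs (weight-pos c) _ ≤-refl u<n Hu (conn u<n v<n Hu Hv)
      ... | d , p , le = ≤-trans k≤light (cov c u<n v<n l≤h p (begin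
        d + weight c u                                   ≤⟨ le ⟩
        sumTo n (λ x → when (H x) (weight c x))          ≤⟨ sum-mono n (λ {x} _ → cost (H x) (tint c (col x))) ⟩
        sumTo n (λ x → when (H x) (unless (tint c (col x)) M) + 1)
                                                         ≡⟨ sum-+ n _ (λ _ → 1) ⟩
        heavyIn c H + sumTo n (λ _ → 1)                  ≡⟨ cong₂ _+_ (bal c) (trans (sum-const n 1) (*-identityʳ n)) ⟩
        k + n                                            ≤⟨ +-monoˡ-≤ n k≤light ⟩
        light c u v + n                                  ∎))
        where
        open ≤-Reasoning
        cost : ∀ h t → when h (onZero t M 1) ≤ when h (unless t M) + 1
        cost zero    t       = z≤n
        cost (suc h) zero    = m≤m+n M 1
        cost (suc h) (suc t) = ≤-refl
        k≤light : k ≤ light c u v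
        k≤light = begin
          k                ≡⟨ bal (not c) ⟨
          heavyIn (not c) H ≡⟨ heavy-flip c H ⟨
          lightIn c H      ≤⟨ sum-mono n (λ {x} x<n → mono (H x) (dm x) (H⊆dm x<n)) ⟩
          light c u v      ∎
          where
          mono : ∀ h d {z} → (h ≢ 0 → d ≢ 0) → when h z ≤ when d z
          mono zero    d       imp = z≤n
          mono (suc h) zero    imp = contradiction refl (imp λ ())
          mono (suc h) (suc d) imp = ≤-refl

  opaque
    unfolding program

    program-correct : ¬ ¬ Order n nb → ∀ ρ s → sc s sBest ≡ 0 →
      (∀ {i j} → i < n → j < n → onZero ((i ∸ j) + (j ∸ i)) 1 (ar s aG (suc i) j) ≡ nb i j) →
      (∀ {x} → x < n → ar s aG 0 x ≡ col x) →
      ∃[ S ] ∃[ best ] Solution S best × (∀ c → Covers c best) ×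
        (∀ {x} → x < n → ar (run n program ρ s) aG 0 x ≡ S x)
    program-correct order ρ s best≡0 nb-ok col-ok =
      ar s₄ aS 0 , sc s₄ sBest , proj₁ p₄ , covered ,
      fill-row n {0} (write aG hdr col₀ (read aS hdr col₀)) ρ s₄ aG 0 (ar s₄ aS 0)
        (λ k s′ k<n fr _ → trans (put-hit n aG 0 k (ar s′) k<n) (cong (λ f → f 0 k) (arr fr aS refl)))
        (λ j k s′ j<n k<n k≢j → put-miss n aG 0 k (ar s′) λ _ _ → k≢j)
      where
      clear : Cmd 0
      clear = for (write aS hdr col₀ (lit 0))
      s₁ s₂ s₃ s₄ : St
      s₁ = run n closure ρ s
      s₂ = run n clear ρ s₁
      s₃ = run n (phase true) ρ s₂
      s₄ = run n (phase false) ρ s₃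
      B₁ : Base s₁
      B₁ = record
        { graph  = closure-correct n nb ρ s nb-ok
        ; colour = λ {x} x<n → trans (cong (λ f → f 0 x) (arr (frame n closure ρ s) aG refl)) (col-ok x<n) }
      B₂ : Base s₂
      B₂ = base-frame clear ρ {s₁} refl refl B₁
      B₃ : Base s₃
      B₃ = base-frame (phase true) ρ {s₂} refl refl B₂
      cleared : ∀ {x} → x < n → ar s₂ aS 0 x ≡ 0
      cleared = fill-row n {0} (write aS hdr col₀ (lit 0)) ρ s₁ aS 0 (λ _ → 0)
        (λ k s′ k<n _ _ → put-hit n aS 0 k (ar s′) k<n)
        (λ j k s′ j<n k<n k≢j → put-miss n aS 0 k (ar s′) λ _ _ → k≢j)
      best₂ : sc s₂ sBest ≡ 0
      best₂ = trans (sca (frame n clear ρ s₁) sBest refl) (trans (sca (frame n closure ρ s) sBest refl) best≡0)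
      empty : Solution (ar s₂ aS 0) (sc s₂ sBest)
      empty = record
        { binary    = inj₁ ∘ cleared
        ; connected = λ x<n _ Sx _ → contradiction (cleared x<n) Sx
        ; heavies   = λ c → trans (sum-zero n λ x<n → when-zero (cleared x<n)) (sym best₂) }
      p₃ : Improves true s₂ s₃
      p₃ = phase-correct order true ρ s₂ B₂ empty
      p₄ : Improves false s₃ s₄
      p₄ = phase-correct order false ρ s₃ B₃ (proj₁ p₃)
      covered : ∀ c → Covers c (sc s₄ sBest)
      covered true  u<n v<n l≤h p le = ≤-trans (proj₂ (proj₂ p₃) u<n v<n l≤h p le) (proj₁ (proj₂ p₄))
      covered false = proj₂ (proj₂ p₄)

-- Input and output

fromList-++ˡ : ∀ xs ys {k} → k < length xs → fromList (xs ++ ys) k ≡ fromList xs k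
fromList-++ˡ (x ∷ xs) ys {zero}  _         = refl
fromList-++ˡ (x ∷ xs) ys {suc k} (s≤s k<l) = fromList-++ˡ xs ys k<l

fromList-++ʳ : ∀ xs ys k → fromList (xs ++ ys) (length xs + k) ≡ fromList ys k
fromList-++ʳ []       ys k = refl
fromList-++ʳ (x ∷ xs) ys k = fromList-++ʳ xs ys k

fromList-tabulate : ∀ {n} (f : Fin n → ℕ) v → fromList (tabulateᴸ f) (toℕ v) ≡ f v
fromList-tabulate f zero    = refl
fromList-tabulate f (suc v) = fromList-tabulate (f ∘ suc) v

fromList-map : ∀ {n} (f : Fin n → ℕ) v → fromList (map f (allFin n)) (toℕ v) ≡ f v
fromList-map f v = trans (cong (λ xs → fromList xs (toℕ v)) (map-tabulate id f)) (fromList-tabulate f v)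

length-map-allFin : ∀ {n} (f : Fin n → ℕ) → length (map f (allFin n)) ≡ n
length-map-allFin {n} f = trans (length-map f (allFin n)) (length-tabulate (id {A = Fin n}))

fromList-concatMap : ∀ {A : Set} {m n} (g : A → List ℕ) (h : Fin m → A) → (∀ a → length (g a) ≡ n) → ∀ u {j} → j < n →
                     fromList (concatMap g (tabulateᴸ h)) (toℕ u * n + j) ≡ fromList (g (h u)) j
fromList-concatMap g h len zero {j} j<n = fromList-++ˡ (g (h zero)) _ (≤-trans j<n (≤-reflexive (sym (len (h zero)))))
fromList-concatMap {n = n} g h len (suc u) {j} j<n = trans
  (cong (fromList (concatMap g (tabulateᴸ h)))
    (trans (+-assoc n (toℕ u * n) j) (cong (_+ (toℕ u * n + j)) (sym (len (h zero))))))
  (trans (fromList-++ʳ (g (h zero)) _ (toℕ u * n + j)) (fromList-concatMap g (h ∘ suc) len u j<n))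

extend₀ : ∀ {n} → (Fin n → ℕ) → ℕ → ℕ
extend₀ {zero}  f x       = 0
extend₀ {suc n} f zero    = f zero
extend₀ {suc n} f (suc x) = extend₀ (f ∘ suc) x

extend₀-toℕ : ∀ {n} (f : Fin n → ℕ) v → extend₀ f (toℕ v) ≡ f v
extend₀-toℕ f zero    = refl
extend₀-toℕ f (suc v) = extend₀-toℕ (f ∘ suc) v

sum-head : ∀ n f → sumTo (suc n) f ≡ f 0 + sumTo n (f ∘ suc)
sum-head zero    f = +-comm 0 (f 0)
sum-head (suc n) f = trans (cong (_+ f (suc n)) (sum-head n f)) (+-assoc (f 0) _ _)

sum-card : ∀ {n} (p : Subset n) f → (∀ v → f (toℕ v) ≡ bit (lookup p v)) → sumTo n f ≡ ∣ p ∣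
sum-card []               f eq = refl
sum-card {suc n} (true  ∷ p) f eq = trans (sum-head n f) (cong₂ _+_ (eq zero) (sum-card p (f ∘ suc) (eq ∘ suc)))
sum-card {suc n} (false ∷ p) f eq = trans (sum-head n f) (cong₂ _+_ (eq zero) (sum-card p (f ∘ suc) (eq ∘ suc)))

below : ∀ {n x} → x < n → ∃[ v ] toℕ {n} v ≡ x
below x<n = fromℕ< x<n , toℕ-fromℕ< x<n

-- Real numbers

open ℝ

lower-closed : ∀ x {q r} → q ℚ.< r → L x r → L x q
lower-closed x {q} q<r r∈L = Equivalence.from (L-rounded x q) (_ , q<r , r∈L)

lower<upper : ∀ x {q r} → L x q → U x r → q ℚ.< r
lower<upper x {q} {r} q∈L r∈U with ℚ.<-cmp q r
... | tri< q<r _ _  = q<r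
... | tri≈ _ refl _ = contradiction (q∈L , r∈U) (disjoint x q)
... | tri> _ _ r<q  = contradiction (lower-closed x r<q q∈L , r∈U) (disjoint x r)

-- If some q in L x is missing from L y, then a larger rational of L x is in U y, which gives y ≤ x.
-- So denying both alternatives makes each such q belong to L y up to double negation, and
-- locatedness of y at a slightly larger rational removes the double negation.
≤ᴿ-total : ∀ x y → ¬ ¬ (x ≤ᴿ y ⊎ y ≤ᴿ x)
≤ᴿ-total x y neither = neither (inj₁ λ {q} → x≤y q)
  where
  stable : ∀ q → L x q → ¬ ¬ L y q
  stable q q∈x q∉y with Equivalence.to (L-rounded x q) q∈x
  ... | r , q<r , r∈x with located y q<r
  ... | inj₁ q∈y = q∉y q∈y
  ... | inj₂ r∈U = neither (inj₂ λ s∈y → lower-closed x (lower<upper y s∈y r∈U) r∈x)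
  x≤y : ∀ q → L x q → L y q
  x≤y q q∈x with Equivalence.to (L-rounded x q) q∈x
  ... | r , q<r , r∈x with located y q<r
  ... | inj₁ q∈y = q∈y
  ... | inj₂ r∈U = contradiction (λ r∈y → disjoint y r (r∈y , r∈U)) (stable r r∈x)

-- The encoded graph as an instance of the model.

module Input {n : ℕ} (G : BicoloredGraph n) where

  open BicoloredGraph G using (adj?; color; Adj; graph; irrefl; B; R) renaming (sym to adj-sym)

  m₀ : Store
  m₀ = fromList (encode G)

  s₀ : St
  s₀ = start n m₀

  col : ℕ → ℕ
  col = ar s₀ aG 0

  nb : ℕ → ℕ → ℕ
  nb i j = onZero ((i ∸ j) + (j ∸ i)) 1 (ar s₀ aG (suc i) j)

  colours : List ℕ
  colours = map (λ v → bit (isRed (color v))) (allFin n)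

  matrix-row : Fin n → List ℕ
  matrix-row u = map (λ v → bit (does (adj? u v))) (allFin n)

  stored : ∀ ρ v → ar s₀ aG ρ (toℕ v) ≡ m₀ (ρ * n + toℕ v)
  stored ρ v = cong (λ b → if b then m₀ (ρ * n + toℕ v) else 0) (<ᵇ-true {toℕ v} {n} (toℕ<n v))

  col-input : ∀ v → col (toℕ v) ≡ bit (isRed (color v))
  col-input v = trans (stored 0 v) (trans
    (fromList-++ˡ colours _ (≤-trans (toℕ<n v) (≤-reflexive (sym (length-map-allFin {n} _)))))
    (fromList-map _ v))

  adj-input : ∀ u v → ar s₀ aG (suc (toℕ u)) (toℕ v) ≡ bit (does (adj? u v))
  adj-input u v = trans (stored (suc (toℕ u)) v) (trans
    (cong m₀ (trans (+-assoc n (toℕ u * n) (toℕ v))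
      (cong (_+ (toℕ u * n + toℕ v)) (sym (length-map-allFin {n} (λ v → bit (isRed (color v))))))))
    (trans (fromList-++ʳ colours _ (toℕ u * n + toℕ v))
      (trans (fromList-concatMap matrix-row id (λ u → length-map-allFin {n} _) u (toℕ<n v)) (fromList-map _ v))))

  nb→adj : ∀ u v → nb (toℕ u) (toℕ v) ≢ 0 → u ≡ v ⊎ Adj u v
  nb→adj u v uv with (toℕ u ∸ toℕ v) + (toℕ v ∸ toℕ u) in eq
  ... | zero = inj₁ (toℕ-injective (gap≡0⁻¹ eq))
  ... | suc _ with adj? u v | adj-input u v
  ... | yes a | _  = inj₂ a
  ... | no _  | eq′ = contradiction eq′ uv

  adj→nb : ∀ u v → u ≡ v ⊎ Adj u v → nb (toℕ u) (toℕ v) ≢ 0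
  adj→nb u v (inj₁ refl) eq = contradiction (trans (sym (cong (λ z → onZero z 1 (ar s₀ aG (suc (toℕ u)) (toℕ u))) (gap≡0 {toℕ u} refl))) eq) λ ()
  adj→nb u v (inj₂ a) eq with (toℕ u ∸ toℕ v) + (toℕ v ∸ toℕ u)
  ... | suc _ with adj? u v | adj-input u v
  ... | yes _ | eq′ = contradiction (trans (sym eq′) eq) λ ()
  ... | no ¬a | _   = ¬a a

  rs : Reflexive-Symmetric n nb
  rs = record
    { nb-refl = λ i<n → case below i<n of λ { (u , refl) → adj→nb u u (inj₁ refl) }
    ; nb-sym  = λ i<n j<n ij → case below i<n , below j<n of λ
        { ((u , refl) , (v , refl)) → adj→nb v u (Sum.map sym adj-sym (nb→adj u v ij)) } }

  private
    ρ₀ : ℕ → Store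
    ρ₀ w _ = w
    s₁ = run n closure (ρ₀ 0) s₀
    lab : ℕ → ℕ → ℕ
    lab w = ar (run n labels (ρ₀ w) s₁) aL 0

  -- D(u, v) is defined by a quantifier over walks. Taking the labels that the program computes as
  -- its definition turns it into a number that can be tested and summed, and `labels-correct` is
  -- its specification.
  dom : ℕ → ℕ → ℕ → ℕ
  dom w u v = nb w u + ((lab w u ∸ lab w v) + (lab w v ∸ lab w u))

  dom-spec : ∀ {w u v} → w < n → u < n → v < n →
    (dom w u v ≡ 0 → nb w u ≡ 0 × Conn n nb (Free n nb w) u v) ×
    (nb w u ≡ 0 → Conn n nb (Free n nb w) u v → dom w u v ≡ 0)
  dom-spec {w} {u} {v} w<n u<n v<n =
    (λ eq → m+n≡0⇒m≡0 (nb w u) eq , Separates.same→conn sep u<n v<n (gap≡0⁻¹ {lab w u} (m+n≡0⇒n≡0 (nb w u) eq))) ,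
    (λ wu p → cong₂ _+_ wu (gap≡0 (Separates.conn→same sep p)))
    where
    sep : Separates n nb rs w (lab w)
    sep = labels-correct n nb rs (ρ₀ w) s₁ w<n (closure-correct n nb (ρ₀ 0) s₀ λ _ _ → refl)

  open Model n nb rs col dom dom-spec

  -- Totality is known only up to double negation for each pair of points. There are finitely many
  -- pairs, so `sequence` moves all these double negations to the front.
  interval-order : IsIntervalGraph graph → ¬ ¬ Order n nb
  interval-order (I , rep) no-order = sequence applicative (λ u → sequence applicative (λ v → ≤ᴿ-total (p u) (p v)))
    λ total → no-order record
      { _⊑_      = λ i j → ∃[ u ] ∃[ v ] toℕ u ≡ i × toℕ v ≡ j × p u ≤ᴿ p v
      ; ⊑-trans  = λ { (u , v , refl , refl , u≤v) (v′ , w , eq , refl , v≤w) →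
          u , w , refl , refl , λ {q} q∈u → v≤w (subst (λ z → L (p z) q) (sym (toℕ-injective eq)) (u≤v q∈u)) }
      ; ⊑-total  = λ i<n j<n → case below i<n , below j<n of λ { ((u , refl) , (v , refl)) →
          Sum.map (λ le → u , v , refl , refl , λ {q} → le {q}) (λ le → v , u , refl , refl , λ {q} → le {q}) (total u v) }
      ; umbrella = λ { _ _ _ ij (u , w , refl , refl , u≤w) (w′ , v , eq , refl , w≤v) →
          umb ij (λ {q} → u≤w {q}) (λ {q} q∈w → w≤v (subst (λ z → L (p z) q) (sym (toℕ-injective eq)) q∈w)) } }
    where
    open Interval
    applicative = RawMonad.rawApplicative ¬¬-Monad
    p : Fin n → ℝ
    p u = proj₁ (nonempty (I u))
    p∈ : ∀ u → points (I u) (p u)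
    p∈ u = proj₂ (nonempty (I u))
    apart : ∀ {w u} → nb (toℕ w) (toℕ u) ≡ 0 → ¬ points (I u) (p w)
    apart {w} {u} wu pw with w Fin.≟ u
    ... | yes refl = adj→nb w w (inj₁ refl) wu
    ... | no w≢u   = adj→nb w u (inj₂ (Equivalence.from (rep w u w≢u) (p w , p∈ w , pw))) wu
    umb : ∀ {u v w} → nb (toℕ u) (toℕ v) ≢ 0 → p u ≤ᴿ p w → p w ≤ᴿ p v →
          nb (toℕ w) (toℕ u) ≢ 0 ⊎ nb (toℕ w) (toℕ v) ≢ 0
    umb {u} {v} {w} uv u≤w w≤v with nb (toℕ w) (toℕ u) ≟ 0 | nb (toℕ w) (toℕ v) ≟ 0
    ... | no wu  | _      = inj₁ wu
    ... | yes _  | no wv  = inj₂ wv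
    ... | yes wu | yes wv with u Fin.≟ v
    ... | yes refl = contradiction (convex (I u) (p∈ u) (p∈ u) (λ {q} → u≤w {q}) (λ {q} → w≤v {q})) (apart {w} {u} wu)
    ... | no u≢v with nb→adj u v uv
    ... | inj₁ u≡v = contradiction u≡v u≢v
    ... | inj₂ a with Equivalence.to (rep u v u≢v) a
    -- The point of w is compared with a common point x of the intervals of u and v. It lies between
    -- x and the point of v, hence in the interval of v, or between the point of u and x, hence in
    -- the interval of u.
    ... | x , x∈u , x∈v = contradiction (λ
      { (inj₁ x≤w) → apart {w} {v} wv (convex (I v) x∈v (p∈ v) (λ {q} → x≤w {q}) (λ {q} → w≤v {q}))
      ; (inj₂ w≤x) → apart {w} {u} wu (convex (I u) (p∈ u) x∈u (λ {q} → u≤w {q}) (λ {q} → w≤x {q})) })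
      (≤ᴿ-total x (p w))

  record Represents (X : Subset n) (S : ℕ → ℕ) : Set where
    constructor represents
    field bit-at : ∀ v → S (toℕ v) ≡ bit (lookup X v)

  open Represents

  bit-nonzero : ∀ {b} → bit b ≢ 0 → b ≡ true
  bit-nonzero {true}  _  = refl
  bit-nonzero {false} ne = contradiction refl ne

  member→ : ∀ {X S} → Represents X S → ∀ {v} → S (toℕ v) ≢ 0 → v ∈ₛ X
  member→ {X} rep {v} Sv = lookup⇒[]= v X (bit-nonzero (λ eq → Sv (trans (bit-at rep v) eq)))

  member← : ∀ {X S} → Represents X S → ∀ {v} → v ∈ₛ X → S (toℕ v) ≢ 0
  member← {X} rep {v} v∈X eq = contradiction (trans (sym eq) (trans (bit-at rep v) (cong bit ([]=⇒lookup v∈X)))) λ ()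

  reds blues : (ℕ → ℕ) → ℕ
  reds  S = sumTo n (λ x → when (S x) (unless (tint true (col x)) 1))
  blues S = sumTo n (λ x → when (S x) (unless (tint false (col x)) 1))

  card-reds : ∀ {X S} → Represents X S → reds S ≡ ∣ X ∩ R ∣
  card-reds {X} {S} rep = sum-card (X ∩ R) _ λ v → trans
    (cong₂ (λ h z → when h (unless (tint true z) 1)) (bit-at rep v) (col-input v))
    (trans (value (lookup X v) (isRed (color v)))
      (cong bit (trans (cong (lookup X v ∧_) (sym (lookup∘tabulate (λ v → isRed (color v)) v))) (sym (lookup-zipWith _∧_ v X R)))))
    where
    value : ∀ b r → when (bit b) (unless (tint true (bit r)) 1) ≡ bit (b ∧ r)
    value true  true  = refl
    value true  false = refl
    value false true  = refl
    value false false = refl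

  card-blues : ∀ {X S} → Represents X S → blues S ≡ ∣ X ∩ B ∣
  card-blues {X} {S} rep = sum-card (X ∩ B) _ λ v → trans
    (cong₂ (λ h z → when h (unless (tint false z) 1)) (bit-at rep v) (col-input v))
    (trans (value (lookup X v) (color v))
      (cong bit (trans (cong (lookup X v ∧_) (sym (lookup∘tabulate (λ v → isBlue (color v)) v))) (sym (lookup-zipWith _∧_ v X B)))))
    where
    value : ∀ b r → when (bit b) (unless (tint false (bit (isRed r))) 1) ≡ bit (b ∧ isBlue r)
    value true  red  = refl
    value true  blue = refl
    value false red  = refl
    value false blue = refl

  card-total : ∀ {X S} → Represents X S → ∣ X ∣ ≡ ∣ X ∩ R ∣ + ∣ X ∩ B ∣
  card-total {X} {S} rep = begin
    ∣ X ∣                         ≡⟨ sum-card X _ (λ v → trans (cong (λ h → when h 1) (bit-at rep v)) (value (lookup X v))) ⟨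
    sumTo n (λ x → when (S x) 1)  ≡⟨ sum-cong n (λ {x} _ → parts (S x) (col x)) ⟩
    sumTo n (λ x → when (S x) (unless (tint true (col x)) 1) + when (S x) (unless (tint false (col x)) 1))
                                  ≡⟨ sum-+ n _ _ ⟩
    reds S + blues S              ≡⟨ cong₂ _+_ (card-reds rep) (card-blues rep) ⟩
    ∣ X ∩ R ∣ + ∣ X ∩ B ∣         ∎
    where
    open ≡-Reasoning
    value : ∀ b → when (bit b) 1 ≡ bit b
    value true  = refl
    value false = refl
    parts : ∀ h z → when h 1 ≡ when h (unless (1 ∸ z) 1) + when h (unless z 1)
    parts zero    z             = refl
    parts (suc h) zero          = refl
    parts (suc h) (suc zero)    = refl
    parts (suc h) (suc (suc z)) = refl

  M-nonZero : NonZero M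
  M-nonZero = >-nonZero (m≤n+m 1 n)

  conn→star : ∀ {X S} → Represents X S → ∀ u v → Conn n nb (In n nb S) (toℕ u) (toℕ v) → Star (InducedAdj graph X) u v
  conn→star {X} {S} rep u v p = go u v refl refl p
    where
    go : ∀ u v {i j} → toℕ u ≡ i → toℕ v ≡ j → Conn n nb (In n nb S) i j → Star (InducedAdj graph X) u v
    go u v eq eq′ ε with toℕ-injective (trans eq (sym eq′))
    ... | refl = ε
    go u v refl eq′ (((_ , Su) , (y<n , Sy) , uy) ◅ p) with below y<n
    ... | y , refl with nb→adj u y uy
    -- Closed neighbourhoods allow a step that stays in place; it is dropped.
    ... | inj₁ refl = go y v refl eq′ p
    ... | inj₂ a    = (member→ rep Su , member→ rep Sy , a) ◅ go y v refl eq′ p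

  star→conn : ∀ {X S} → Represents X S → ∀ {u v} → Star (InducedAdj graph X) u v → Conn n nb (In n nb S) (toℕ u) (toℕ v)
  star→conn rep = gmap toℕ λ {u} {v} (u∈ , v∈ , a) →
    (toℕ<n u , member← rep u∈) , (toℕ<n v , member← rep v∈) , adj→nb u v (inj₂ a)

  optimal : ¬ ¬ Order n nb → ∀ {S best} → Solution S best → (∀ c → Covers c best) → ∀ {X} → Represents X S →
            IsOptimal G X
  optimal order {S} {best} sol cov {X} rep = (connected , balanced) , maximum
    where
    connected : InducesConnected graph X
    connected u v u∈ v∈ = conn→star rep u v
      (Solution.connected sol (toℕ<n u) (toℕ<n v) (member← rep u∈) (member← rep v∈))
    best-reds : best ≡ M * ∣ X ∩ R ∣
    best-reds = trans (sym (Solution.heavies sol true)) (trans (heavy-multiple true S) (cong (M *_) (card-reds rep)))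
    best-blues : best ≡ M * ∣ X ∩ B ∣
    best-blues = trans (sym (Solution.heavies sol false)) (trans (heavy-multiple false S) (cong (M *_) (card-blues rep)))
    balanced : ∣ X ∩ B ∣ ≡ ∣ X ∩ R ∣
    balanced = *-cancelˡ-≡ _ _ M {{M-nonZero}} (trans (sym best-blues) best-reds)
    maximum : ∀ Y → IsFeasible G Y → ∣ Y ∣ ≤ ∣ X ∣
    maximum Y (conn , bal) = begin
      ∣ Y ∣                   ≡⟨ card-total repY ⟩
      ∣ Y ∩ R ∣ + ∣ Y ∩ B ∣   ≤⟨ +-mono-≤ red≤ (≤-trans (≤-reflexive bal) (≤-trans red≤ (≤-reflexive (sym balanced)))) ⟩
      ∣ X ∩ R ∣ + ∣ X ∩ B ∣   ≡⟨ card-total rep ⟨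
      ∣ X ∣                   ∎
      where
      open ≤-Reasoning
      H = extend₀ (λ v → bit (lookup Y v))
      repY : Represents Y H
      repY = represents (extend₀-toℕ _)
      heavies : ∀ c → heavyIn c H ≡ M * ∣ Y ∩ R ∣
      heavies true  = trans (heavy-multiple true H) (cong (M *_) (card-reds repY))
      heavies false = trans (heavy-multiple false H) (cong (M *_) (trans (card-blues repY) bal))
      red≤ : ∣ Y ∩ R ∣ ≤ ∣ X ∩ R ∣
      red≤ = *-cancelˡ-≤ M {{M-nonZero}} (≤-trans
        (covers-optimal order cov H _ (λ x<n y<n Hx Hy → case below x<n , below y<n of λ
          { ((u , refl) , (v , refl)) → star→conn repY (conn u v (member→ repY Hx) (member→ repY Hy)) }) heavies)
        (≤-reflexive best-reds))

  outputs-optimal : ∀ (c : Cmd 0) {t c′ S best} → ¬ ¬ Order n nb →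
    Solution S best → (∀ c → Covers c best) → (∀ {x} → x < n → ar (run n c (λ _ → 0) s₀) aG 0 x ≡ S x) →
    Halts (assemble c) (initial G) t c′ → t ≤ 3 + suc n * 4 + time c n →
    Cells n (ar (run n c (λ _ → 0) s₀)) (Config.mem c′) →
    SolvesBCSWithin (assemble c) G (3 + suc n * 4 + time c n)
  outputs-optimal _ {t} {c′} {S} order sol cov out halts t≤ cells = t , c′ , X , halts , t≤ ,
    (λ v → trans (Cells.cell cells aG 0 (toℕ v) z≤n (toℕ<n v)) (trans (out (toℕ<n v)) (bit-at repX v))) ,
    optimal order sol cov {X} repX
    where
    nonzero : ℕ → Bool
    nonzero zero    = false
    nonzero (suc _) = true
    X : Subset n
    X = tabulate (λ v → nonzero (S (toℕ v)))
    bit-value : ∀ {z} → z ≡ 0 ⊎ z ≡ 1 → z ≡ bit (nonzero z)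
    bit-value (inj₁ refl) = refl
    bit-value (inj₂ refl) = refl
    repX : Represents X S
    repX = represents λ v →
      trans (bit-value (Solution.binary sol (toℕ<n v))) (cong bit (sym (lookup∘tabulate (λ v → nonzero (S (toℕ v))) v)))

  solved : IsIntervalGraph graph → SolvesBCSWithin (assemble program) G (3 + suc n * 4 + time program n)
  solved rep =
    let order = interval-order rep
        (_ , _ , sol , cov , out) = program-correct order (λ _ → 0) s₀ refl (λ _ _ → refl) (λ _ → refl)
        (_ , _ , halts , t≤ , cells) = assemble-correct n m₀ program
    in outputs-optimal program order sol cov out halts t≤ cells

-- For n ≥ 1 the inequality `suc n` ≤ 2n gives the factor 8, and 7 absorbs the 3 + 4 (n + 1) steps
-- of the prologue.
cubic : ∀ (c : Cmd 0) → depth c ≡ 3 → (λ n → 3 + suc n * 4 + time c n) ∈O (λ n → n ^ 3)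
cubic c deg = (7 + factor c) * 8 , 1 , λ n 1≤n → begin
  3 + suc n * 4 + time c n
    ≤⟨ +-mono-≤ (linear n) (subst (λ e → time c n ≤ factor c * suc n ^ e) deg (time≤ c n)) ⟩
  7 * suc n ^ 3 + factor c * suc n ^ 3
    ≡⟨ *-distribʳ-+ (suc n ^ 3) 7 (factor c) ⟨
  (7 + factor c) * suc n ^ 3
    ≤⟨ *-monoʳ-≤ (7 + factor c) (^-monoˡ-≤ 3 (≤-trans (+-monoˡ-≤ n 1≤n) (≤-reflexive (double n)))) ⟩
  (7 + factor c) * (2 * n) ^ 3
    ≡⟨ cong ((7 + factor c) *_) (cube n) ⟩
  (7 + factor c) * (8 * n ^ 3)
    ≡⟨ *-assoc (7 + factor c) 8 (n ^ 3) ⟨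
  (7 + factor c) * 8 * n ^ 3 ∎
  where
  open ≤-Reasoning
  double : ∀ n → n + n ≡ 2 * n
  double = solve-∀
  cube : ∀ n → (2 * n) * ((2 * n) * ((2 * n) * 1)) ≡ 8 * (n * (n * (n * 1)))
  cube = solve-∀
  linear : ∀ n → 3 + suc n * 4 ≤ 7 * suc n ^ 3
  linear n = begin
    3 + suc n * 4                  ≤⟨ +-monoˡ-≤ (suc n * 4) (*-monoʳ-≤ 3 (s≤s z≤n)) ⟩
    3 * suc n + suc n * 4          ≡⟨ seven (suc n) ⟩
    7 * suc n ^ 1                  ≤⟨ *-monoʳ-≤ 7 (^-monoʳ-≤ (suc n) {1} {3} (s≤s z≤n)) ⟩
    7 * suc n ^ 3                  ∎
    where
    seven : ∀ m → 3 * m + m * 4 ≡ 7 * (m * 1)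
    seven = solve-∀

theorem4 : Σ[ P ∈ Program ] Σ[ T ∈ (ℕ → ℕ) ]
    (T ∈O (λ n → n ^ 3)) ×
    (∀ (n : ℕ) (G : BicoloredGraph n) →
    IsIntervalGraph (BicoloredGraph.graph G) →
    SolvesBCSWithin P G (T n))
theorem4 =
  assemble program , (λ n → 3 + suc n * 4 + time program n) , cubic program depth-program ,
  λ n G → Input.solved G
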